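{- For every positive integer $n$, let $$d_n=\frac{1}{2^{n-1}\,\mathrm{Cat}_n}\sum_{\pi\in\mathrm{Int}(n),\ \rho\in\mathrm{NC}(n)} d_H(\pi,\rho).$$ Then $$\lim_{n\to\infty}\Bigl(d_n-\frac23 n\Bigr)=-\frac{28}{27}.$$
   Context: For a positive integer $n$, a partition $\pi$ of $\{1,\ldots,n\}$ is non-crossing if there are no two distinct blocks $V,W$ of $\pi$ and numbers $a<b<c<d$ with $a,c\in V$ and $b,d\in W$. $\mathrm{NC}(n)$ is the set of non-crossing partitions of $\{1,\ldots,n\}$, partially ordered by $\pi\le\rho$ iff every block of $\pi$ is contained in a block of $\rho$. The Hasse diagram $\mathcal{H}_n$ is the undirected graph with vertex set $\mathrm{NC}(n)$ in which $\pi_1,\pi_2$ are joined by an edge iff one of them covers the other in $(\mathrm{NC}(n),\le)$; $d_H(\pi,\rho)$ is the graph distance in $\mathcal{H}_n$. $\mathrm{Int}(n)\subseteq\mathrm{NC}(n)$ is the set of interval partitions: those in which every block has the form $\{i\in\mathbb{N}\mid p\le i\le q\}$ for some $p\le q$ in $\{1,\ldots,n\}$; $|\mathrm{Int}(n)|=2^{n-1}$. $\mathrm{Cat}_n=\frac{(2n)!}{n!(n+1)!}=|\mathrm{NC}(n)|$ is the $n$th Catalan number. -}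

module Defs where

open import Data.Bool.Base using (true; false)
open import Data.Empty using (⊥)
open import Data.Fin.Base as Fin using (Fin)
import Data.Fin.Properties as Fin
open import Data.Fin.Subset using (Subset; _∈_; _⊆_; _∩_; Empty; inside; outside)
  renaming (⊤ to full)
open import Data.Fin.Subset.Properties using (_∈?_; _⊆?_; nonempty?; ∈⊤; ⊆⊤; ⊆-refl; ⊆-trans; ⊆-antisym; x∈p∩q⁺)
open import Data.Integer.Base using (+_)
open import Data.Irrelevant using ([_])
open import Data.List.Base using (List; []; _∷_; map; filter; length; mapMaybe; cartesianProduct; cartesianProductWith)
open import Data.List.Membership.Propositional using () renaming (_∈_ to _∈ˡ_)
open import Data.List.Membership.Propositional.Properties using (∈-cartesianProductWith⁺)
open import Data.List.Properties using (filter-accept; filter-reject)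
open import Data.List.Relation.Unary.Any as AnyL using (here; there)
open import Data.List.Relation.Unary.All using () renaming (All to AllL; [] to []ᴬ; _∷_ to infixr 5 _∷ᴬ_)
open import Data.List.Relation.Unary.Unique.Propositional using (Unique) renaming ([] to []ᴾ; _∷_ to infixr 5 _∷ᴾ_)
import Data.List.Relation.Unary.Unique.Propositional.Properties as Unique
open import Data.Maybe.Base using (Maybe; just; nothing)
open import Data.Nat.Base as ℕ using (ℕ; zero; suc; pred; _^_; _!; NonZero)
import Data.Nat.Properties as ℕ
open import Data.Nat.ListAction using (sum)
open import Data.Nat.Induction using (<-wellFounded)
open import Data.Product using (∃; ∃₂; _×_; _,_; proj₁; proj₂; uncurry)
open import Data.Rational.Base as ℚ using (ℚ; 0ℚ; _/_; 1/_; ∣_∣)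
import Data.Rational.Properties as ℚ
open import Data.Refinement.Base using (Refinement-syntax; value; _,_)
open import Data.Sum.Base using (_⊎_; inj₁; swap)
open import Data.Vec.Base using (Vec; []; _∷_; lookup; replicate; tabulate)
open import Data.Vec.Properties using (≡-dec; lookup-replicate; ∷-injective)
open import Data.Vec.Relation.Binary.Pointwise.Extensional using (ext; Pointwise-≡⇒≡)
open import Data.Vec.Relation.Unary.All as All using (All; []; _∷_)
import Data.Vec.Relation.Unary.All.Properties as All
open import Data.Vec.Relation.Unary.Any as Any using (Any)
import Data.Vec.Relation.Unary.Any.Properties as Any
open import Data.Vec.Membership.Propositional.Properties using (∈-lookup)
import Data.Bool.Properties as Bool
open import Induction.WellFounded using (Acc; acc)
open import Relation.Binary.Core using (Rel)
open import Relation.Binary.Definitions using (DecidableEquality; Decidable)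
open import Relation.Binary.PropositionalEquality using (_≡_; _≢_; refl; sym; trans; cong; subst; isEquivalence)
open import Relation.Binary.Structures using (IsPartialOrder)
open import Relation.Nullary.Decidable using (Dec; yes; no; does; ¬?; _×-dec_; _⊎-dec_; _→-dec_; map′; recompute)
open import Relation.Nullary.Negation using (¬_; contradiction)
import Relation.Unary as U
open import Level using (0ℓ)

module Hasse
  {A : Set} {_≤_ : Rel A 0ℓ} (isPartialOrder : IsPartialOrder _≡_ _≤_)
  (_≟_ : DecidableEquality A) (_≤?_ : Decidable _≤_)
  (elements : List A) (complete : ∀ x → x ∈ˡ elements)
  (top : A) (≤-top : ∀ x → x ≤ top)
  where

  open import Relation.Binary.Construct.NonStrictToStrict _≡_ _≤_
    using (_<_; <-irrefl; <-decidable) renaming (<-trans to <-trans′)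

  _⋖_ : Rel A 0ℓ
  x ⋖ y = x < y × ¬ ∃ λ z → x < z × z < y

  Edge : Rel A 0ℓ
  Edge x y = x ⋖ y ⊎ y ⋖ x

  -- Walk k x y: a walk with k edges in the undirected Hasse diagram.
  data Walk : ℕ → A → A → Set where
    []  : ∀ {x} → Walk 0 x x
    _∷_ : ∀ {k x y z} → Edge x y → Walk k y z → Walk (suc k) x z

  IsDistance : A → A → ℕ → Set
  IsDistance x y k = Walk k x y × (∀ {j} → j ℕ.< k → ¬ Walk j x y)

  private
    <-trans : ∀ {x y z} → x < y → y < z → x < z
    <-trans = <-trans′ isPartialOrder

    _<?_ : Decidable _<_
    _<?_ = <-decidable _≟_ _≤?_

    ∃? : ∀ {P : A → Set} → U.Decidable P → Dec (∃ P)
    ∃? P? = map′ AnyL.satisfied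
      (λ (x , px) → AnyL.map (λ { refl → px }) (complete x)) (AnyL.any? P? elements)

    _⋖?_ : Decidable _⋖_
    x ⋖? y = (x <? y) ×-dec ¬? (∃? λ z → (x <? z) ×-dec (z <? y))

    walk? : ∀ k x y → Dec (Walk k x y)
    walk? zero x y = map′ (λ { refl → [] }) (λ { [] → refl }) (x ≟ y)
    walk? (suc k) x z = map′ (λ { (_ , e , w) → e ∷ w }) (λ { (e ∷ w) → _ , e , w })
      (∃? λ y → ((x ⋖? y) ⊎-dec (y ⋖? x)) ×-dec walk? k y z)

    infixr 5 _++_
    _++_ : ∀ {j k x y z} → Walk j x y → Walk k y z → Walk (j ℕ.+ k) x z
    []      ++ v = v
    (e ∷ w) ++ v = e ∷ (w ++ v)

    reverse : ∀ {k x y} → Walk k x y → ∃ λ j → Walk j y x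
    reverse [] = _ , []
    reverse (e ∷ w) = _ , proj₂ (reverse w) ++ swap e ∷ []

    module _ {P Q : A → Set} (P? : U.Decidable P) (Q? : U.Decidable Q)
             (P⊆Q : ∀ {x} → P x → Q x) where

      count-≤ : ∀ xs → length (filter P? xs) ℕ.≤ length (filter Q? xs)
      count-≤ [] = ℕ.z≤n
      count-≤ (x ∷ xs) with P? x | Q? x
      ... | yes p | yes q = ℕ.s≤s (count-≤ xs)
      ... | yes p | no ¬q = contradiction (P⊆Q p) ¬q
      ... | no ¬p | yes q = ℕ.m≤n⇒m≤1+n (count-≤ xs)
      ... | no ¬p | no ¬q = count-≤ xs

      count-< : ∀ {x xs} → x ∈ˡ xs → ¬ P x → Q x →
                length (filter P? xs) ℕ.< length (filter Q? xs)
      count-< {x} {_ ∷ xs} (here refl) ¬p q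
        rewrite filter-reject P? {x} {xs} ¬p | filter-accept Q? {x} {xs} q
        = ℕ.s≤s (count-≤ xs)
      count-< {xs = y ∷ _} (there x∈) ¬p q with P? y | Q? y
      ... | yes p | yes _ = ℕ.s≤s (count-< x∈ ¬p q)
      ... | yes p | no ¬q = contradiction (P⊆Q p) ¬q
      ... | no _  | yes _ = ℕ.m≤n⇒m≤1+n (count-< x∈ ¬p q)
      ... | no _  | no _  = count-< x∈ ¬p q

    between? : ∀ x y → U.Decidable (λ z → x < z × z < y)
    between? x y z = (x <? z) ×-dec (z <? y)

    gap : A → A → ℕ
    gap x y = length (filter (between? x y) elements)

    ascend : ∀ {x y} → Acc ℕ._<_ (gap x y) → x < y → ∃ λ k → Walk k x y
    ascend {x} {y} (acc rs) x<y with ∃? (between? x y)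
    ... | no ¬b = 1 , inj₁ (x<y , ¬b) ∷ []
    ... | yes (z , x<z , z<y) = _ , proj₂ (ascend (rs lower) x<z) ++ proj₂ (ascend (rs upper) z<y)
      where
      lower : gap x z ℕ.< gap x y
      lower = count-< (between? x z) (between? x y) (λ (p , q) → p , <-trans q z<y)
        (complete z) (λ (_ , q) → <-irrefl refl q) (x<z , z<y)
      upper : gap z y ℕ.< gap x y
      upper = count-< (between? z y) (between? x y) (λ (p , q) → <-trans x<z p , q)
        (complete z) (λ (p , _) → <-irrefl refl p) (x<z , z<y)

    to-top : ∀ x → ∃ λ k → Walk k x top
    to-top x with x ≟ top
    ... | yes refl = 0 , []
    ... | no x≢top = ascend (<-wellFounded _) (≤-top x , x≢top)

    least : ∀ {P : ℕ → Set} → U.Decidable P → ∀ {k} → Acc ℕ._<_ k → P k →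
            ∃ λ m → P m × (∀ {j} → j ℕ.< m → ¬ P j)
    least P? {k} (acc rs) pk with ℕ.anyUpTo? P? k
    ... | yes (j , j<k , pj) = least P? (rs j<k) pj
    ... | no ¬any = k , pk , λ j<k pj → ¬any (_ , j<k , pj)

  connected : ∀ x y → ∃ λ k → Walk k x y
  connected x y = _ , proj₂ (to-top x) ++ proj₂ (reverse (proj₂ (to-top y)))

  distance : ∀ x y → ∃ (IsDistance x y)
  distance x y = least (λ k → walk? k x y) (<-wellFounded _) (proj₂ (connected x y))

  dist : A → A → ℕ
  dist x y = proj₁ (distance x y)

-- Fin n plays the role of {1,…,n}. A partition is stored as the vector whose
-- i-th entry is the block containing i: its blocks are the entries of the vector
-- (a block of size m is listed m times), and each partition is represented by
-- exactly one vector.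

Blocks : ℕ → Set
Blocks n = Vec (Subset n) n

IsPartition : ∀ {n} → Blocks n → Set
IsPartition π = (∀ i → i ∈ lookup π i)
              × All (λ V → All (λ W → V ≢ W → Empty (V ∩ W)) π) π

NonCrossing : ∀ {n} → Blocks n → Set
NonCrossing π = All (λ V → All (λ W → V ≢ W → ∀ a b c d →
  a Fin.< b → b Fin.< c → c Fin.< d → a ∈ V → c ∈ V → b ∈ W → d ∈ W → ⊥) π) π

NC : ℕ → Set
NC n = [ π ∈ Blocks n ∣ IsPartition π × NonCrossing π ]

_≤_ : ∀ {n} → NC n → NC n → Set
π ≤ ρ = All (λ V → Any (λ W → V ⊆ W) (value ρ)) (value π)

interval : ∀ {n} → Fin n → Fin n → Subset n
interval p q = tabulate λ i → does (p Fin.≤? i ×-dec i Fin.≤? q)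

IsInterval : ∀ {n} → NC n → Set
IsInterval π = All (λ V → ∃₂ λ p q → p Fin.≤ q × V ≡ interval p q) (value π)

_≟ˢ_ : ∀ {n} → DecidableEquality (Subset n)
_≟ˢ_ = ≡-dec Bool._≟_

isPartition? : ∀ {n} → U.Decidable (IsPartition {n})
isPartition? π = Fin.all? (λ i → i ∈? lookup π i)
  ×-dec All.all? (λ V → All.all? (λ W → ¬? (V ≟ˢ W) →-dec ¬? (nonempty? (V ∩ W))) π) π

nonCrossing? : ∀ {n} → U.Decidable (NonCrossing {n})
nonCrossing? π = All.all? (λ V → All.all? (λ W → ¬? (V ≟ˢ W) →-dec
  Fin.all? λ a → Fin.all? λ b → Fin.all? λ c → Fin.all? λ d →
  (a Fin.<? b) →-dec (b Fin.<? c) →-dec (c Fin.<? d) →-dec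
  (a ∈? V) →-dec (c ∈? V) →-dec (b ∈? W) →-dec ¬? (d ∈? W)) π) π

isNC? : ∀ {n} → U.Decidable (λ (π : Blocks n) → IsPartition π × NonCrossing π)
isNC? π = isPartition? π ×-dec nonCrossing? π

isNC : ∀ {n} (π : NC n) → IsPartition (value π) × NonCrossing (value π)
isNC (π , [ p ]) = recompute (isNC? π) p

isInterval? : ∀ {n} → U.Decidable (IsInterval {n})
isInterval? π = All.all? (λ V → Fin.any? λ p → Fin.any? λ q →
  (p Fin.≤? q) ×-dec (V ≟ˢ interval p q)) (value π)

allVecs : ∀ {A : Set} → List A → ∀ n → List (Vec A n)
allVecs xs zero    = [] ∷ []
allVecs xs (suc n) = cartesianProductWith _∷_ xs (allVecs xs n)

allBlocks : ∀ n → List (Blocks n)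
allBlocks n = allVecs (allVecs (inside ∷ outside ∷ []) n) n

fromBlocks : ∀ {n} → Blocks n → Maybe (NC n)
fromBlocks π with isNC? π
... | yes p = just (π , [ p ])
... | no _  = nothing

allNC : ∀ n → List (NC n)
allNC n = mapMaybe fromBlocks (allBlocks n)

allInt : ∀ n → List (NC n)
allInt n = filter isInterval? (allNC n)

∈-allVecs : ∀ {A : Set} {xs : List A} → (∀ x → x ∈ˡ xs) → ∀ {n} (v : Vec A n) → v ∈ˡ allVecs xs n
∈-allVecs all∈ []      = here refl
∈-allVecs all∈ (x ∷ v) = ∈-cartesianProductWith⁺ _∷_ (all∈ x) (∈-allVecs all∈ v)

∈-allNC : ∀ {n} (π : NC n) → π ∈ˡ allNC n
∈-allNC {n} π = go (∈-allVecs (∈-allVecs λ { true → here refl ; false → there (here refl) }) (value π))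
  where
  go : ∀ {πs} → value π ∈ˡ πs → π ∈ˡ mapMaybe fromBlocks πs
  go {ρ ∷ _} (here refl) with isNC? ρ
  ... | yes _ = here refl
  ... | no ¬p = contradiction (isNC π) ¬p
  go {ρ ∷ _} (there π∈) with isNC? ρ
  ... | yes _ = there (go π∈)
  ... | no _  = go π∈

allVecs-unique : ∀ {A : Set} {xs : List A} → Unique xs → ∀ n → Unique (allVecs xs n)
allVecs-unique uxs zero    = []ᴬ ∷ᴾ []ᴾ
allVecs-unique uxs (suc n) = Unique.cartesianProductWith⁺ _∷_ ∷-injective uxs (allVecs-unique uxs n)

allNC-unique : ∀ n → Unique (allNC n)
allNC-unique n = go (allVecs-unique (allVecs-unique (((λ ()) ∷ᴬ []ᴬ) ∷ᴾ []ᴬ ∷ᴾ []ᴾ) n) n)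
  where
  fresh : ∀ {π : NC n} {πs} → AllL (value π ≢_) πs → AllL (π ≢_) (mapMaybe fromBlocks πs)
  fresh []ᴬ = []ᴬ
  fresh (_∷ᴬ_ {x = ρ} π≢ρ π∉) with isNC? ρ
  ... | yes _ = (λ { refl → π≢ρ refl }) ∷ᴬ fresh π∉
  ... | no _  = fresh π∉
  go : ∀ {πs} → Unique πs → Unique (mapMaybe fromBlocks πs)
  go []ᴾ = []ᴾ
  go (_∷ᴾ_ {x = ρ} ρ∉ u) with isNC? ρ
  ... | yes _ = fresh ρ∉ ∷ᴾ go u
  ... | no _  = go u

module _ {n : ℕ} where

  value-injective : {π ρ : NC n} → value π ≡ value ρ → π ≡ ρ
  value-injective refl = refl

  _≟_ : DecidableEquality (NC n)
  π ≟ ρ = map′ value-injective (cong value) (≡-dec _≟ˢ_ (value π) (value ρ))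

  _≤?_ : Decidable (_≤_ {n})
  π ≤? ρ = All.all? (λ V → Any.any? (λ W → V ⊆? W) (value ρ)) (value π)

  isPartition : (π : NC n) → IsPartition (value π)
  isPartition π = proj₁ (isNC π)

  ∈-block : (π : NC n) → ∀ i → i ∈ lookup (value π) i
  ∈-block π = proj₁ (isPartition π)

  block-unique : (π : NC n) → ∀ {i} j → i ∈ lookup (value π) j → lookup (value π) j ≡ lookup (value π) i
  block-unique π {i} j i∈ with lookup (value π) j ≟ˢ lookup (value π) i
  ... | yes eq = eq
  ... | no neq = contradiction (i , x∈p∩q⁺ (i∈ , ∈-block π i))
    (All.lookup⁺ (All.lookup⁺ (proj₂ (isPartition π)) j) i neq)

  lookup-⊆ : {π ρ : NC n} → π ≤ ρ → ∀ i → lookup (value π) i ⊆ lookup (value ρ) i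
  lookup-⊆ {π} {ρ} π≤ρ i = subst (lookup (value π) i ⊆_)
    (block-unique ρ (Any.index V⊆) (Any.lookup-index V⊆ (∈-block π i))) (Any.lookup-index V⊆)
    where V⊆ = All.lookup⁺ π≤ρ i

  ≤-lookup : {π ρ : NC n} → (∀ i → lookup (value π) i ⊆ lookup (value ρ) i) → π ≤ ρ
  ≤-lookup {π} {ρ} π⊆ρ = All.lookup⁻ λ i →
    Any.map {Q = lookup (value π) i ⊆_} (λ { refl → π⊆ρ i }) (∈-lookup i (value ρ))

  ≤-isPartialOrder : IsPartialOrder _≡_ (_≤_ {n})
  ≤-isPartialOrder = record
    { isPreorder = record
      { isEquivalence = isEquivalence
      ; reflexive = λ { {π} refl → ≤-lookup {π} {π} λ i → ⊆-refl }
      ; trans = λ {π} {ρ} {σ} π≤ρ ρ≤σ → ≤-lookup {π} {σ} λ i →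
          ⊆-trans (lookup-⊆ {π} {ρ} π≤ρ i) (lookup-⊆ {ρ} {σ} ρ≤σ i)
      }
    ; antisym = λ {π} {ρ} π≤ρ ρ≤π → value-injective (Pointwise-≡⇒≡ (ext λ i →
        ⊆-antisym (lookup-⊆ {π} {ρ} π≤ρ i) (lookup-⊆ {ρ} {π} ρ≤π i)))
    }

  oneBlock : NC n
  oneBlock = replicate n full , [ ((λ i → subst (i ∈_) (sym (lookup-replicate i full)) ∈⊤)
                                  , All.lookup⁻ λ i → All.lookup⁻ λ j V≢W → contradiction (same i j) V≢W)
                                , (All.lookup⁻ λ i → All.lookup⁻ λ j V≢W → contradiction (same i j) V≢W) ]
    where
    same : ∀ i j → lookup (replicate n full) i ≡ lookup (replicate n full) j
    same i j = trans (lookup-replicate i full) (sym (lookup-replicate j full))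

  ≤-oneBlock : (π : NC n) → π ≤ oneBlock
  ≤-oneBlock π = ≤-lookup {π} {oneBlock} λ i →
    subst (lookup (value π) i ⊆_) (sym (lookup-replicate i full)) ⊆⊤

module H (n : ℕ) = Hasse {NC n} ≤-isPartialOrder _≟_ _≤?_ (allNC n) ∈-allNC oneBlock ≤-oneBlock

dH : ∀ {n} → NC n → NC n → ℕ
dH {n} = H.dist n

Cat : ℕ → ℚ
Cat n = (+ ((2 ℕ.* n) !) / (n ! ℕ.* (suc n) !)) {{n ℕ.!* suc n !≢0}}

-- 2ⁿ⁻¹ Catₙ, the factor whose inverse normalises the sum defining dₙ.
normalizer : ℕ → ℚ
normalizer n = + (2 ^ pred n) / 1 ℚ.* Cat n

normalizer-nonZero : ∀ n → ℚ.NonZero (normalizer n)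
normalizer-nonZero n = ℚ.pos⇒nonZero (normalizer n) {{ℚ.pos*pos⇒pos (+ (2 ^ pred n) / 1) {{p}} (Cat n) {{q}}}}
  where
  p = ℚ.normalize-pos (2 ^ pred n) 1 {{_}} {{ℕ.m^n≢0 2 (pred n)}}
  q = ℚ.normalize-pos ((2 ℕ.* n) !) (n ! ℕ.* (suc n) !) {{n ℕ.!* suc n !≢0}} {{(2 ℕ.* n) ℕ.!≢0}}

totalDistance : ℕ → ℕ
totalDistance n = sum (map (uncurry dH) (cartesianProduct (allInt n) (allNC n)))

d : (n : ℕ) .{{_ : NonZero n}} → ℚ
d n = (1/ normalizer n) {{normalizer-nonZero n}} ℚ.* (+ totalDistance n / 1)

-- Convergence of a rational sequence indexed by the positive integers; letting ε
-- range over the positive rationals is equivalent to positive reals.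
_⟶_ : ((n : ℕ) .{{_ : NonZero n}} → ℚ) → ℚ → Set
x ⟶ ℓ = ∀ ε → 0ℚ ℚ.< ε → ∃ λ N → ∀ n .{{_ : NonZero n}} → N ℕ.≤ n → ∣ x n ℚ.- ℓ ∣ ℚ.< ε

-- Merging the blocks of i and i + 1 keeps a partition non-crossing, so for an interval
-- partition π and a non-crossing ρ the join π ∨ ρ is again non-crossing. Along a cover
-- |σ| drops by one and |π ∨ σ| by at most one, so |σ| - 2|π ∨ σ| changes by ±1 per
-- edge of the Hasse diagram; with the path through π ∨ ρ this gives
-- d_H(π, ρ) = |π| + |ρ| - 2|π ∨ ρ|. Splitting off the first element at its successor
-- in its block turns ρ into a binary tree, and π (with one spare bit) into a Boolean
-- flag at each node. On these trees the distance, and whether the join connects the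
-- first element with the last, satisfy a linear recursion, so the generating functions are
-- linear over the Catalan series. Eliminating yields (8n + 4) dₙ₊₁ + (n + 2) dₙ = 6n²,
-- which forces dₙ = 2n/3 - 28/27 + O(1/n).

module Submission where

-- Eliminating the auxiliary series, over any cancellative commutative semiring

open import Algebra.Bundles using (CommutativeSemiring)
import Algebra.Solver.Ring.NaturalCoefficients.Default as Solver
open import Level using (0ℓ)

-- Interval partitions are special because the join with one is the same in `NC(n)` as among all
-- partitions. In general it is not, and one cover can cost several blocks: for n = 4 and π with
-- only larger block {1,3}, passing from the singletons to the partition with block {2,4} takes the
-- join from three blocks to one. A left subtree meets the remaining elements only at its two ends.
-- A link at either end costs a block of the join, unless the two links close a cycle through the
-- subtree. That is all its parent has to know about it, hence the one extra statistic `linked`. The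
-- spare bit replaces the n - 1 links by one flag per element, so subtrees have the same shape as
-- trees; it doubles both the number of pairs and the total distance. Since `C = 1 + 2zC²`, the
-- series `1 - 4zC` is a square root of `1 - 8z`. Its inverse `B` stands in for the radical, and
-- `z(1 + z)D` becomes a combination of `B` and 1 with polynomial coefficients. Putting an + b into
-- the final recurrence gives 9a = 6 and 14a + 9b = 0, whence 2/3 and -28/27.

module Elimination (R : CommutativeSemiring 0ℓ 0ℓ) where

  open CommutativeSemiring R
  open Solver R

  private
    2# 3# 4# : Carrier
    2# = 1# + 1#
    3# = 2# + 1#
    4# = 2# + 2#

  -- Every step below writes x - y as a combination of differences of the two
  -- sides of known equations; moving the negative terms across turns this into
  -- a semiring identity x + r ≈ y + l with l ≈ r.
  module _ (cancel : ∀ {a b} c → a + c ≈ b + c → a ≈ b) where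

    combine : ∀ {x y l r} → l ≈ r → x + r ≈ y + l → x ≈ y
    combine {x} {y} {l} {r} l≈r eq = cancel l (trans (+-congˡ l≈r) eq)

    module _ {z P Q Y D T : Carrier}
      (e₁ : P ≈ 2# * z * ((1# + P) * (1# + P)))
      (e₂ : Q ≈ z * (1# + Q) + 2# * z * (1# + P) * Q)
      (e₃ : Y ≈ z + 2# * z * Y + 2# * z * (1# + P) * Y)
      (e₄ : D + 2# * z * ((1# + Q) * P) ≈
            4# * z * (D * (1# + P)) + z * P + 3# * z * ((1# + P) * P) + 2# * z * (Y * P))
      (e₅ : T ≈ 2# * z * ((1# + P) * (1# + P)) + 4# * z * ((1# + P) * T))
      where

      private
        B : Carrier
        B = 1# + P + T

        -- Combinatorially, half of the nonempty trees have their last flag set. Algebraically,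
        -- multiplying `e₃` by `2C²` turns each `2zC²` into `P`, and the coefficient of `2Y` becomes
        -- `C² - P(1 + C) = 1`.
        s₃ : 2# * Y ≈ P
        s₃ = combine (+-cong (*-congˡ {2# * (C * C)} e₃) (*-congˡ {1# + 2# * Y * (1# + C)} (sym e₁)))
          (solve 3 (λ z p y →
              let one = con 1; two = one :+ one; c = one :+ p
                  c₃ = two :* (c :* c); c₁ = one :+ two :* y :* (one :+ c) in
              two :* y :+ (c₃ :* (z :+ two :* z :* y :+ two :* z :* c :* y) :+ c₁ :* p) :=
              p :+ (c₃ :* y :+ c₁ :* (two :* z :* (c :* c)))) refl z P Y)
          where C = 1# + P

        -- With `C = 1 + P`, `e₁` says `C(1 - 2zC) = 1`, so `e₂` times `C` reads `Q(1 - zC) = zC`.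
        -- The factor `α` is chosen because `(1 - zC)(1 + 2zC) = 1 + z`, again by `e₁`.
        s₂ : Q + z * Q ≈ z + 2# * z * P
        s₂ = combine (+-cong (*-congˡ {α * C} e₂) (*-congˡ {α * Q + z + z * Q} (sym e₁)))
          (solve 3 (λ z p q →
              let one = con 1; two = one :+ one; c = one :+ p; a = one :+ two :* z :* c
                  c₂ = a :* c; c₁ = a :* q :+ z :+ z :* q in
              q :+ z :* q :+ (c₂ :* (z :* (one :+ q) :+ two :* z :* c :* q) :+ c₁ :* p) :=
              z :+ two :* z :* p :+ (c₂ :* q :+ c₁ :* (two :* z :* (c :* c)))) refl z P Q)
          where
          C = 1# + P
          α = 1# + 2# * z * C

        -- The factor `1 + z` makes `s₂` applicable to the term with `Q`: it gives
        -- `(1 + z)(1 + Q) = 1 + 2zC`. With `2Y = P` the inhomogeneous part becomes a polynomial in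
        -- `z` and `P`.
        s₄ : (1# + z) * D ≈ 4# * z * (1# + P) * ((1# + z) * D) + 2# * z * P * (1# + 2# * P)
        s₄ = combine (+-cong (*-congˡ {1# + z} e₄) (+-cong (*-congˡ {2# * z * P} (sym s₂)) (*-congˡ {(1# + z) * (z * P)} s₃)))
          (solve 5 (λ z p q y d →
              let one = con 1; two = one :+ one; three = two :+ one; four = two :+ two; c = one :+ p
                  c₄ = one :+ z; c₂ = two :* z :* p; c₃ = (one :+ z) :* (z :* p) in
              (one :+ z) :* d :+ (c₄ :* (four :* z :* (d :* c) :+ z :* p :+ three :* z :* (c :* p) :+ two :* z :* (y :* p))
                :+ (c₂ :* (q :+ z :* q) :+ c₃ :* p)) :=
              four :* z :* c :* ((one :+ z) :* d) :+ two :* z :* p :* (one :+ two :* p)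
                :+ (c₄ :* (d :+ two :* z :* ((one :+ q) :* p))
                :+ (c₂ :* (z :+ two :* z :* p) :+ c₃ :* (two :* y)))) refl z P Q Y D)

        -- This makes `B` the inverse of `1 - 4zC`; in `s₆` it solves `s₄` for `(1 + z)D` without a
        -- division.
        s₅ : B ≈ 1# + 4# * z * ((1# + P) * B)
        s₅ = combine (+-cong e₅ e₁)
          (solve 3 (λ z p t →
              let one = con 1; two = one :+ one; four = two :+ two; c = one :+ p; b = one :+ p :+ t in
              b :+ ((two :* z :* (c :* c) :+ four :* z :* (c :* t)) :+ two :* z :* (c :* c)) :=
              one :+ four :* z :* (c :* b) :+ (t :+ p)) refl z P T)

        s₆ : (1# + z) * D ≈ 2# * z * P * (1# + 2# * P) * B
        s₆ = combine (+-cong (*-congˡ {B} s₄) (*-congˡ {(1# + z) * D} (sym s₅)))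
          (solve 4 (λ z p d b →
              let one = con 1; two = one :+ one; four = two :+ two; c = one :+ p in
              (one :+ z) :* d :+ (b :* (four :* z :* c :* ((one :+ z) :* d) :+ two :* z :* p :* (one :+ two :* p))
                :+ (one :+ z) :* d :* b) :=
              two :* z :* p :* (one :+ two :* p) :* b :+ (b :* ((one :+ z) :* d)
                :+ (one :+ z) :* d :* (one :+ four :* z :* (c :* b)))) refl z P D B)

      -- By `e₁`, `(1 - 4zC)² = 1 - 8z`; one of the two factors is cancelled against `B`.
      central-recurrence : B + 4# * z * (1# + P) ≈ 1# + (4# + 4#) * z * B
      central-recurrence = combine (+-cong s₅ (+-cong (*-congˡ {4# * z * (1# + P)} (sym s₅)) (*-congˡ {(4# + 4#) * z * B} e₁)))
        (solve 3 (λ z p b →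
            let one = con 1; two = one :+ one; four = two :+ two; c = one :+ p; r = one :+ four :* z :* (c :* b) in
            b :+ four :* z :* c :+ (r :+ (four :* z :* c :* b :+ (four :+ four) :* z :* b :* (two :* z :* (c :* c)))) :=
            one :+ (four :+ four) :* z :* b :+ (b :+ (four :* z :* c :* r :+ (four :+ four) :* z :* b :* p))) refl z P B)

      -- By `e₁`, `4z²P(1 + 2P) = 4zC - 4z - 12z²C + 4z²`, so in `2z` times `s₆` the series `C`
      -- occurs only linearly, and `4zCB = B - 1` removes it.
      distance-equation : 2# * z * ((1# + z) * D) + (4# + 3#) * z * B + 1# ≈ B + 4# * (z * z) * B + 3# * z
      distance-equation = combine (+-cong (*-congˡ {2# * z} s₆) (+-cong (sym s₅) (+-cong (*-congˡ {3# * z} s₅) (*-congˡ {4# * z * B} (sym e₁)))))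
        (solve 4 (λ z p d b →
            let one = con 1; two = one :+ one; three = two :+ one; four = two :+ two; c = one :+ p
                r = one :+ four :* z :* (c :* b) in
            two :* z :* ((one :+ z) :* d) :+ (four :+ three) :* z :* b :+ one
              :+ (two :* z :* (two :* z :* p :* (one :+ two :* p) :* b)
              :+ (b :+ (three :* z :* r :+ four :* z :* b :* p))) :=
            b :+ four :* (z :* z) :* b :+ three :* z
              :+ (two :* z :* ((one :+ z) :* d)
              :+ (r :+ (three :* z :* b :+ four :* z :* b :* (two :* z :* (c :* c)))))) refl z P D B)

open import Algebra.Structures.Biased using (isCommutativeSemiringˡ)
open import Data.Bool.Base using (Bool; true; false; if_then_else_; _∧_; not)
open import Data.Bool.Properties using (∧-identityʳ; ∧-assoc; ∧-comm)
open import Data.Empty using (⊥; ⊥-elim)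
open import Data.Fin.Base as Fin using (Fin; toℕ; fromℕ<)
import Data.Fin.Properties as Fin
open import Data.Fin.Subset using (Subset; _∈_)
open import Data.Fin.Subset.Properties using (⊆-antisym; x∈p∩q⁻)
open import Data.Integer.Base as ℤ using (ℤ)
import Data.Integer.Properties as ℤ
import Data.Integer.Solver as ℤSolver
open import Data.Irrelevant using ([_])
open import Data.List.Base using (List; []; _∷_; _++_; map; cartesianProduct; cartesianProductWith)
open import Data.List.Membership.Propositional using () renaming (_∈_ to _∈ˡ_)
open import Data.List.Membership.Propositional.Properties using
  ( ∈-map⁺; ∈-map⁻; ∈-filter⁺; ∈-filter⁻; ∈-++⁺ˡ; ∈-++⁺ʳ; ∈-++⁻
  ; ∈-cartesianProduct⁺; ∈-cartesianProduct⁻; ∈-cartesianProductWith⁺; ∈-cartesianProductWith⁻)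
open import Data.List.Membership.Propositional.Properties.WithK using (unique∧set⇒bag)
open import Data.List.Properties using (map-cong; map-cong-local; map-++; map-∘; ++-identityʳ)
open import Data.List.Relation.Binary.BagAndSetEquality using (∼bag⇒↭)
open import Data.List.Relation.Binary.Permutation.Propositional using (_↭_)
open import Data.List.Relation.Binary.Permutation.Propositional.Properties using (map⁺)
open import Data.List.Relation.Unary.All as AllL using () renaming ([] to []ᴬ; _∷_ to infixr 5 _∷ᴬ_)
import Data.List.Relation.Unary.All.Properties as AllL
open import Data.List.Relation.Unary.Any using () renaming (here to hereˡ; there to thereˡ)
open import Data.List.Relation.Unary.Unique.Propositional using (Unique) renaming ([] to []ᴾ; _∷_ to infixr 5 _∷ᴾ_)
import Data.List.Relation.Unary.Unique.Propositional.Properties as Unique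
open import Data.Nat.Base hiding (_/_)
open import Data.Nat.Coprimality using (Coprime)
open import Data.Nat.ListAction using (sum)
open import Data.Nat.ListAction.Properties using (sum-↭; sum-++)
open import Data.Nat.Properties hiding (≤-isPartialOrder)
open import Data.Nat.Solver using (module +-*-Solver)
open import Data.Product.Base as Product using (∃; ∃₂; _×_; _,_; proj₁; proj₂; uncurry)
open import Data.Rational.Base as ℚ using (ℚ; mkℚ; 1ℚ; 1/_; _/_; _-_; -_)
import Data.Rational.Properties as ℚ
import Data.Rational.Solver as ℚSolver
open import Data.Rational.Unnormalised.Base as ℚᵘ using (mkℚᵘ; *≡*; *<*)
import Data.Rational.Unnormalised.Properties as ℚᵘ
import Data.Refinement.Base as Ref
open Ref using (value)
open import Data.Sum.Base as Sum using (_⊎_; inj₁; inj₂)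
open import Data.Unit.Base using (tt)
open import Data.Vec.Base using ([]; _∷_; lookup; tabulate; here; there)
open import Data.Vec.Properties using (lookup∘tabulate; lookup⇒[]=; []=⇒lookup)
import Data.Vec.Relation.Unary.All.Properties as All
open import Defs hiding (_≤_; _≟_; _≤?_)
import Defs
open import Function.Base using (_∘_; id)
open import Function.Bundles using (mk⇔)
open import Relation.Binary.Definitions using (tri<; tri≈; tri>)
open import Relation.Binary.PropositionalEquality
  using (_≡_; _≢_; refl; sym; trans; cong; cong₂; subst; subst₂; module ≡-Reasoning)
open import Relation.Binary.Structures using (IsEquivalence; IsPartialOrder)
open import Relation.Nullary.Decidable using (Dec; yes; no; does; dec-true; dec-false; ¬?; decidable-stable; _×-dec_)
open import Relation.Nullary.Negation using (¬_; contradiction)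
import Relation.Unary as U

-- Partitions as labellings

bit : Bool → ℕ
bit b = if b then 1 else 0

count : (ℕ → Bool) → ℕ → ℕ
count P zero    = 0
count P (suc n) = count P n + bit (P n)

count-cong : ∀ {P Q} n → (∀ {i} → i < n → P i ≡ Q i) → count P n ≡ count Q n
count-cong zero    eq = refl
count-cong (suc n) eq = cong₂ _+_ (count-cong n (eq ∘ m<n⇒m<1+n)) (cong bit (eq (n<1+n n)))

count-mono : ∀ {P Q} n → (∀ {i} → P i ≡ true → Q i ≡ true) → count P n ≤ count Q n
count-mono zero imp = z≤n
count-mono {P} {Q} (suc n) imp with P n in eq
... | true rewrite imp eq = +-monoˡ-≤ 1 (count-mono n imp)
... | false = +-mono-≤ (count-mono n imp) z≤n

count-remove : ∀ {P Q q n} → q < n → P q ≡ true → Q q ≡ false →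
  (∀ {i} → i ≢ q → P i ≡ Q i) → count P n ≡ suc (count Q n)
count-remove {P} {Q} {q} {suc n} q<1+n Pq Qq eq with q ≟ n
... | yes refl rewrite Pq | Qq | +-identityʳ (count Q q) =
  trans (+-comm _ 1) (cong suc (count-cong q λ i<q → eq (<⇒≢ i<q)))
... | no q≢n = cong₂ _+_ (count-remove (≤∧≢⇒< (s≤s⁻¹ q<1+n) q≢n) Pq Qq eq)
  (cong bit (eq (q≢n ∘ sym)))

count-+ : ∀ P m k → count P (m + k) ≡ count P m + count (λ i → P (m + i)) k
count-+ P m zero rewrite +-identityʳ m = sym (+-identityʳ _)
count-+ P m (suc k) rewrite +-suc m k | count-+ P m k = +-assoc (count P m) _ _

search : ∀ {P : ℕ → Set} → U.Decidable P → ∀ n →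
  (∀ {i} → i < n → ¬ P i) ⊎ ∃ λ m → m < n × P m × (∀ {i} → i < m → ¬ P i)
search P? zero = inj₁ λ ()
search P? (suc n) with search P? n
... | inj₂ (m , m<n , Pm , least) = inj₂ (m , m<n⇒m<1+n m<n , Pm , least)
... | inj₁ none with P? n
...   | yes Pn = inj₂ (n , n<1+n n , Pn , none)
...   | no ¬Pn = inj₁ λ i<1+n → case (m≤n⇒m<n∨m≡n (s≤s⁻¹ i<1+n))
  where
  case : ∀ {i} → i < n ⊎ i ≡ n → ¬ _
  case (inj₁ i<n)  = none i<n
  case (inj₂ refl) = ¬Pn

-- A partition of {0,…,n-1} is encoded by the map sending each element to the
-- minimum of its block, extended by the identity to all of ℕ.
record IsLabelling (n : ℕ) (f : ℕ → ℕ) : Set where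
  field
    decreasing : ∀ i → f i ≤ i
    idempotent : ∀ i → f (f i) ≡ f i
    outside    : ∀ {i} → n ≤ i → f i ≡ i

open IsLabelling

NonCrossingLabelling : (ℕ → ℕ) → Set
NonCrossingLabelling f = ∀ {a b c d} → a < b → b < c → c < d → f a ≡ f c → f b ≡ f d → f a ≡ f b

infix 4 _⊑_

-- Refinement, tested on representatives: for a labelling `f` it says that `h` is constant on the
-- blocks of `f`. It makes sense for an arbitrary map `h`, and the universal properties of joins
-- quantify over such maps.
_⊑_ : (ℕ → ℕ) → (ℕ → ℕ) → Set
f ⊑ h = ∀ i → h (f i) ≡ h i

⊑-trans : ∀ {f g h} → f ⊑ g → g ⊑ h → f ⊑ h
⊑-trans {f} {g} {h} f⊑g g⊑h i =
  trans (sym (g⊑h (f i))) (trans (cong h (f⊑g i)) (g⊑h i))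

⊑-antisym : ∀ {m n f g} → IsLabelling m f → IsLabelling n g → f ⊑ g → g ⊑ f → ∀ i → f i ≡ g i
⊑-antisym F G f⊑g g⊑f i = ≤-antisym
  (subst (_≤ _) (g⊑f i) (decreasing F _))
  (subst (_≤ _) (f⊑g i) (decreasing G _))

-- Each block is counted at its minimum, its only fixed point.
blocks : (ℕ → ℕ) → ℕ → ℕ
blocks f = count λ i → does (f i ≟ i)

blocks-cong : ∀ {f g} n → (∀ i → f i ≡ g i) → blocks f n ≡ blocks g n
blocks-cong n eq = count-cong n λ {i} _ → cong (λ k → does (k ≟ i)) (eq i)

does⇒ : ∀ {A : Set} (a? : Dec A) → does a? ≡ true → A
does⇒ (yes a) refl = a

-- `f i` lies in the `g`-block of `i`, whose minimum is `i`; hence `i ≤ f i`.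
fixed-⊑ : ∀ {n f g} → IsLabelling n f → IsLabelling n g → f ⊑ g → ∀ {i} → g i ≡ i → f i ≡ i
fixed-⊑ {g = g} F G f⊑g {i} gi≡i = ≤-antisym (decreasing F i)
  (subst (_≤ _) (trans (f⊑g i) gi≡i) (decreasing G _))

blocks-anti : ∀ {n f g} → IsLabelling n f → IsLabelling n g → f ⊑ g → ∀ k → blocks g k ≤ blocks f k
blocks-anti {f = f} {g} F G f⊑g k = count-mono k λ {i} gi →
  dec-true (f i ≟ i) (fixed-⊑ F G f⊑g (does⇒ (g i ≟ i) gi))

pick : ∀ {A : Set} → Dec A → ℕ → ℕ → ℕ
pick (yes _) x y = x
pick (no _)  x y = y

-- For block minima `p` and `q` this absorbs the block of `q` into that of `p`; if `p ≤ q`, labels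
-- are again minima.
redirect : (ℕ → ℕ) → ℕ → ℕ → ℕ → ℕ
redirect f q p x = pick (f x ≟ q) p (f x)

redirect-hit : ∀ f {q} p {x} → f x ≡ q → redirect f q p x ≡ p
redirect-hit f {q} p {x} eq with f x ≟ q
... | yes _  = refl
... | no neq = contradiction eq neq

redirect-miss : ∀ f {q} p {x} → f x ≢ q → redirect f q p x ≡ f x
redirect-miss f {q} p {x} neq with f x ≟ q
... | yes eq = contradiction eq neq
... | no _   = refl

module _ {n f} (F : IsLabelling n f) where

  redirect-labelling : ∀ {p q} → f p ≡ p → p ≤ q → q < n → IsLabelling n (redirect f q p)
  redirect-labelling {p} {q} fp p≤q q<n = record
    { decreasing = dec ; idempotent = idem ; outside = out }
    where
    dec : ∀ i → redirect f q p i ≤ i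
    dec i with f i ≟ q
    ... | yes eq = ≤-trans p≤q (subst (_≤ i) eq (decreasing F i))
    ... | no _ = decreasing F i
    idem : ∀ i → redirect f q p (redirect f q p i) ≡ redirect f q p i
    idem i with f i ≟ q
    ... | no neq = trans (redirect-miss f p (neq ∘ trans (sym (idempotent F i)))) (idempotent F i)
    ... | yes _ with f p ≟ q
    ...   | yes _ = refl
    ...   | no _ = fp
    out : ∀ {i} → n ≤ i → redirect f q p i ≡ i
    out {i} n≤i = trans (redirect-miss f p λ eq →
      <⇒≱ q<n (subst (n ≤_) (trans (sym (outside F n≤i)) eq) n≤i)) (outside F n≤i)

  redirect-⊒ : ∀ {p q} → f ⊑ redirect f q p
  redirect-⊒ {p} {q} i = cong (λ y → pick (y ≟ q) p y) (idempotent F i)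

  redirect-⊑ : ∀ {p q h} → f ⊑ h → h p ≡ h q → redirect f q p ⊑ h
  redirect-⊑ {p} {q} {h} f⊑h hp≡hq i with f i ≟ q
  ... | yes eq = trans hp≡hq (trans (sym (cong h eq)) (f⊑h i))
  ... | no _ = f⊑h i

  -- The only minimum that disappears is `q`: any other element of its block is a minimum neither
  -- before nor after.
  redirect-blocks : ∀ {p q} → f p ≡ p → f q ≡ q → p ≢ q → q < n →
    blocks f n ≡ suc (blocks (redirect f q p) n)
  redirect-blocks {p} {q} fp fq p≢q q<n = count-remove q<n (dec-true (f q ≟ q) fq)
    (dec-false (_ ≟ q) (p≢q ∘ trans (sym (redirect-hit f p fq)))) same
    where
    same : ∀ {i} → i ≢ q → does (f i ≟ i) ≡ does (redirect f q p i ≟ i)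
    same {i} i≢q = case (f i ≟ q)
      where
      case : Dec (f i ≡ q) → does (f i ≟ i) ≡ does (redirect f q p i ≟ i)
      case (no neq) = cong (λ j → does (j ≟ i)) (sym (redirect-miss f p neq))
      case (yes eq) = trans (dec-false (f i ≟ i) λ fi≡i → i≢q (trans (sym fi≡i) eq))
        (sym (dec-false (_ ≟ i) λ gi≡i → p≢q (trans (sym fp)
          (trans (cong f (trans (sym (redirect-hit f p eq)) gi≡i)) eq))))

-- The smaller of the two labels survives, so labels remain minima. If both labels agree, the
-- redirection changes nothing.
merge : (ℕ → ℕ) → ℕ → ℕ → ℕ → ℕ
merge f i k with f i ≤? f k
... | yes _ = redirect f (f k) (f i)
... | no _  = redirect f (f i) (f k)

module _ {n f} (F : IsLabelling n f) {i k : ℕ} where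

  merge-labelling : i < n → k < n → IsLabelling n (merge f i k)
  merge-labelling i<n k<n with f i ≤? f k
  ... | yes le = redirect-labelling F (idempotent F i) le (≤-<-trans (decreasing F k) k<n)
  ... | no nle = redirect-labelling F (idempotent F k) (<⇒≤ (≰⇒> nle)) (≤-<-trans (decreasing F i) i<n)

  merge-⊒ : f ⊑ merge f i k
  merge-⊒ with f i ≤? f k
  ... | yes _ = redirect-⊒ F
  ... | no _  = redirect-⊒ F

  merge-⊑ : ∀ {h} → f ⊑ h → h i ≡ h k → merge f i k ⊑ h
  merge-⊑ {h} f⊑h eq with f i ≤? f k
  ... | yes _ = redirect-⊑ F {h = h} f⊑h (trans (f⊑h i) (trans eq (sym (f⊑h k))))
  ... | no _  = redirect-⊑ F {h = h} f⊑h (trans (f⊑h k) (trans (sym eq) (sym (f⊑h i))))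

  merge-joins : merge f i k i ≡ merge f i k k
  merge-joins with f i ≤? f k
  ... | yes _ = trans (either i) (sym (redirect-hit f (f i) {k} refl))
    where
    either : ∀ j → redirect f (f k) (f j) j ≡ f j
    either j with f j ≟ f k
    ... | yes _ = refl
    ... | no _ = refl
  ... | no _  = trans (redirect-hit f (f k) {i} refl) (sym either)
    where
    either : redirect f (f i) (f k) k ≡ f k
    either with f k ≟ f i
    ... | yes _ = refl
    ... | no _ = refl

  merge-blocks : i < n → k < n → f i ≢ f k → blocks f n ≡ suc (blocks (merge f i k) n)
  merge-blocks i<n k<n neq with f i ≤? f k
  ... | yes _ = redirect-blocks F (idempotent F i) (idempotent F k) neq (≤-<-trans (decreasing F k) k<n)
  ... | no _  = redirect-blocks F (idempotent F k) (idempotent F i) (neq ∘ sym) (≤-<-trans (decreasing F i) i<n)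

  merge-same : f i ≡ f k → ∀ j → merge f i k j ≡ f j
  merge-same eq j with f i ≤? f k
  ... | no nle = contradiction (≤-reflexive eq) nle
  ... | yes _ with f j ≟ f k
  ...   | yes eq′ = trans eq (sym eq′)
  ...   | no _ = refl

  merge-blocks-≤ : i < n → k < n → blocks f n ≤ suc (blocks (merge f i k) n)
  merge-blocks-≤ i<n k<n with f i ≟ f k
  ... | no neq = ≤-reflexive (merge-blocks i<n k<n neq)
  ... | yes eq = m≤n⇒m≤1+n (≤-reflexive (blocks-cong n (sym ∘ merge-same eq)))

-- Joins with an interval partition, one link at a time

Respects : ℕ → (ℕ → Bool) → (ℕ → ℕ) → Set
Respects k S h = ∀ {i} → i < k → S i ≡ true → h i ≡ h (suc i)

-- The interval partition enters only through its links: a set flag `S i` ties `i` to `suc i`. The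
-- next lemmas show that the result is the least upper bound, even among arbitrary maps that respect
-- the links.
join : ℕ → (ℕ → Bool) → (ℕ → ℕ) → ℕ → ℕ
join zero    S f = f
join (suc k) S f = if S k then merge (join k S f) k (suc k) else join k S f

join-labelling : ∀ {n f} → IsLabelling n f → ∀ S k → k < n → IsLabelling n (join k S f)
join-labelling F S zero k<n = F
join-labelling F S (suc k) k<n with S k
... | true = merge-labelling (join-labelling F S k (<-trans (n<1+n k) k<n)) (<-trans (n<1+n k) k<n) k<n
... | false = join-labelling F S k (<-trans (n<1+n k) k<n)

join-⊒ : ∀ {n f} → IsLabelling n f → ∀ S k → k < n → f ⊑ join k S f
join-⊒ F S zero k<n = idempotent F
join-⊒ {f = f} F S (suc k) k<n with S k
... | true = ⊑-trans {f} {join k S f} {merge (join k S f) k (suc k)} (join-⊒ F S k k′<n)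
  (merge-⊒ (join-labelling F S k k′<n))
  where k′<n = <-trans (n<1+n k) k<n
... | false = join-⊒ F S k (<-trans (n<1+n k) k<n)

⊑⇒≡ : ∀ {f h} → f ⊑ h → ∀ {i j} → f i ≡ f j → h i ≡ h j
⊑⇒≡ {h = h} f⊑h {i} {j} eq = trans (sym (f⊑h i)) (trans (cong h eq) (f⊑h j))

join-respects : ∀ {n f} → IsLabelling n f → ∀ S k → k < n → Respects k S (join k S f)
join-respects {f = f} F S (suc k) k<n {i} i<1+k Si with m≤n⇒m<n∨m≡n (s≤s⁻¹ i<1+k) | S k in Sk
... | inj₂ refl | true  = merge-joins (join-labelling F S k (<-trans (n<1+n k) k<n))
... | inj₂ refl | false = contradiction (trans (sym Si) Sk) λ ()
... | inj₁ i<k  | false = join-respects F S k (<-trans (n<1+n k) k<n) i<k Si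
... | inj₁ i<k  | true  = ⊑⇒≡ {join k S f} {merge (join k S f) k (suc k)}
  (merge-⊒ (join-labelling F S k k′<n)) (join-respects F S k k′<n i<k Si)
  where k′<n = <-trans (n<1+n k) k<n

join-⊑ : ∀ {n f} → IsLabelling n f → ∀ S k → k < n → ∀ {h} → f ⊑ h → Respects k S h → join k S f ⊑ h
join-⊑ F S zero k<n f⊑h resp = f⊑h
join-⊑ F S (suc k) k<n {h} f⊑h resp with S k in Sk
... | true = merge-⊑ (join-labelling F S k k′<n) {h = h} (join-⊑ F S k k′<n {h} f⊑h (resp ∘ m<n⇒m<1+n)) (resp (n<1+n k) Sk)
  where k′<n = <-trans (n<1+n k) k<n
... | false = join-⊑ F S k (<-trans (n<1+n k) k<n) {h} f⊑h (resp ∘ m<n⇒m<1+n)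

Adjacent : ℕ → ℕ → Set
Adjacent v w = ∀ {x} → x ≢ v → x ≢ w → (x < v × x < w) ⊎ (v < x × w < x)

adjacent-sym : ∀ {v w} → Adjacent v w → Adjacent w v
adjacent-sym sides x≢w x≢v = Sum.map Product.swap Product.swap (sides x≢v x≢w)

adjacent-suc : ∀ k → Adjacent k (suc k)
adjacent-suc k {x} x≢k x≢1+k with <-cmp x k
... | tri< x<k _ _ = inj₁ (x<k , m<n⇒m<1+n x<k)
... | tri≈ _ x≡k _ = contradiction x≡k x≢k
... | tri> _ _ k<x = inj₂ (k<x , ≤∧≢⇒< k<x (x≢1+k ∘ sym))

-- Adjacent elements are separated by no third element, so merging their blocks
-- creates no crossing.
module _ {f} (ncf : NonCrossingLabelling f) {v w : ℕ} (sides : Adjacent v w) where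

  private
    side : ∀ {x} → f x ≢ f v → f x ≢ f w → (x < v × x < w) ⊎ (v < x × w < x)
    side x≁v x≁w = sides (λ { refl → x≁v refl }) (λ { refl → x≁w refl })

  -- Each of `b` and `d` lies on one side of both `v` and `w`. Every placement is a crossing for
  -- `f`: `w < b < c < d` if `b` is on the right, `b < c < d < w` if both are on the left,
  -- `a < b < v < d` if only `d` is on the right.
  no-crossing-outer : ∀ {a b c d} → a < b → b < c → c < d → f a ≡ f v → f c ≡ f w →
    f b ≡ f d → f b ≢ f v → f b ≢ f w → ⊥
  no-crossing-outer a<b b<c c<d av cw bd b≁v b≁w with side b≁v b≁w
  ... | inj₂ (_ , w<b) = b≁w (sym (ncf w<b b<c c<d (sym cw) bd))
  ... | inj₁ (b<v , _) with side (b≁v ∘ trans bd) (b≁w ∘ trans bd)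
  ...   | inj₁ (_ , d<w) = b≁w (trans (ncf b<c c<d d<w bd cw) cw)
  ...   | inj₂ (v<d , _) = b≁v (sym (trans (sym av) (ncf a<b b<v v<d av bd)))

  -- The mirror image: the crossing is `v < a < b < c`, `a < b < c < v` or `a < w < c < d`,
  -- according to the sides of `a` and `c`.
  no-crossing-inner : ∀ {a b c d} → a < b → b < c → c < d → f a ≡ f c →
    f b ≡ f v → f d ≡ f w → f a ≢ f v → f a ≢ f w → ⊥
  no-crossing-inner a<b b<c c<d ac bv dw a≁v a≁w with side a≁v a≁w
  ... | inj₂ (v<a , _) = a≁v (sym (ncf v<a a<b b<c (sym bv) ac))
  ... | inj₁ (_ , a<w) with side (a≁v ∘ trans ac) (a≁w ∘ trans ac)
  ...   | inj₁ (c<v , _) = a≁v (trans (ncf a<b b<c c<v ac bv) bv)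
  ...   | inj₂ (_ , w<c) = a≁w (ncf a<w w<c c<d ac (sym dw))

-- The cases record which of the four points lay in the absorbed block. If a pair in the merged
-- block comes from a single old block, `ncf` settles the case; if it has one point in each old
-- block, one of the two preceding lemmas does, with `v` and `w` exchanged when the points come in
-- the other order.
redirect-noncrossing : ∀ {f v w} → NonCrossingLabelling f →
  Adjacent v w → NonCrossingLabelling (redirect f (f v) (f w))
redirect-noncrossing {f} {v} {w} ncf sides {a} {b} {c} {d} a<b b<c c<d
  with f a ≟ f v | f b ≟ f v | f c ≟ f v | f d ≟ f v
... | yes _  | yes _  | _      | _      = λ _ _ → refl
... | yes _  | no _   | _      | yes _  = λ _ bw → sym bw
... | yes av | no b≁v | yes cv | no d≁v = λ _ bd → ⊥-elim (b≁v (trans (sym (ncf a<b b<c c<d (trans av (sym cv)) bd)) av))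
... | yes av | no b≁v | no c≁v | no d≁v = λ wc bd → outer (sym wc) bd
  where
  outer : f c ≡ f w → f b ≡ f d → f w ≡ f b
  outer cw bd with f b ≟ f w
  ... | yes bw = sym bw
  ... | no b≁w = ⊥-elim (no-crossing-outer ncf sides a<b b<c c<d av cw bd b≁v b≁w)
... | no _   | yes _  | yes _  | _      = λ aw _ → aw
... | no a≁v | yes bv | no _   | yes dv = λ ac _ → ⊥-elim (a≁v (trans (ncf a<b b<c c<d ac (trans bv (sym dv))) bv))
... | no a≁v | yes bv | no c≁v | no d≁v = λ ac wd → inner ac (sym wd)
  where
  inner : f a ≡ f c → f d ≡ f w → f a ≡ f w
  inner ac dw with f a ≟ f w
  ... | yes aw = aw
  ... | no a≁w = ⊥-elim (no-crossing-inner ncf sides a<b b<c c<d ac bv dw a≁v a≁w)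
... | no _   | no _   | yes _  | yes _  = λ aw bw → trans aw (sym bw)
... | no a≁v | no b≁v | yes cv | no d≁v = λ aw bd → outer aw bd
  where
  outer : f a ≡ f w → f b ≡ f d → f a ≡ f b
  outer aw bd with f b ≟ f w
  ... | yes bw = trans aw (sym bw)
  ... | no b≁w = ⊥-elim (no-crossing-outer ncf (adjacent-sym {v} {w} sides) a<b b<c c<d aw cv bd b≁w b≁v)
... | no a≁v | no b≁v | no c≁v | yes dv = λ ac bw → inner ac bw
  where
  inner : f a ≡ f c → f b ≡ f w → f a ≡ f b
  inner ac bw with f a ≟ f w
  ... | yes aw = trans aw (sym bw)
  ... | no a≁w = ⊥-elim (no-crossing-inner ncf (adjacent-sym {v} {w} sides) a<b b<c c<d ac bw dv a≁w a≁v)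
... | no _   | no _   | no _   | no _   = λ ac bd → ncf a<b b<c c<d ac bd

merge-suc-noncrossing : ∀ {f} → NonCrossingLabelling f → ∀ k → NonCrossingLabelling (merge f k (suc k))
merge-suc-noncrossing {f} ncf k with f k ≤? f (suc k)
... | yes _ = redirect-noncrossing ncf (adjacent-sym {k} {suc k} (adjacent-suc k))
... | no _  = redirect-noncrossing ncf (adjacent-suc k)

join-noncrossing : ∀ {f} → NonCrossingLabelling f → ∀ S k → NonCrossingLabelling (join k S f)
join-noncrossing ncf S zero = ncf
join-noncrossing {f} ncf S (suc k) with S k
... | true = merge-suc-noncrossing {join k S f} (join-noncrossing ncf S k) k
... | false = join-noncrossing ncf S k

-- One merge on the way from a partition to a coarser one

module _ {n f g} (F : IsLabelling n f) (G : IsLabelling n g) (f⊑g : f ⊑ g)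
  {j} (fj≢gj : f j ≢ g j) (agree : ∀ {i} → i < j → f i ≡ g i) where

  private
    -- If `f j < j`, then `f` and `g` agree at `f j`, so `f j ≡ f (f j) ≡ g (f j) ≡ g j`.
    fj≡j : f j ≡ j
    fj≡j with m≤n⇒m<n∨m≡n (decreasing F j)
    ... | inj₂ eq = eq
    ... | inj₁ lt = contradiction (trans (sym (idempotent F j)) (trans (agree lt) (f⊑g j))) fj≢gj

    gj<j : g j < j
    gj<j = ≤∧≢⇒< (decreasing G j) λ eq → fj≢gj (trans fj≡j (sym eq))

    fgj≡gj : f (g j) ≡ g j
    fgj≡gj = trans (agree gj<j) (idempotent G j)

    j<n : j < n
    j<n with j <? n
    ... | yes lt = lt
    ... | no nlt = contradiction (trans (outside F (≮⇒≥ nlt)) (sym (outside G (≮⇒≥ nlt)))) fj≢gj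

  -- At the first difference, `j` starts a block of `f` that `g` unites with the block of the
  -- smaller element `g j`. Choosing the least such `j` keeps this single merge non-crossing, so a
  -- partition strictly below another one always has a neighbour with one block less inside the
  -- interval between them.
  refinement : ℕ → ℕ
  refinement = redirect f j (g j)

  refinement-labelling : IsLabelling n refinement
  refinement-labelling = redirect-labelling F fgj≡gj (<⇒≤ gj<j) j<n

  refinement-⊒ : f ⊑ refinement
  refinement-⊒ = redirect-⊒ F

  refinement-⊑ : refinement ⊑ g
  refinement-⊑ = redirect-⊑ F {h = g} f⊑g (idempotent G j)

  refinement-blocks : blocks f n ≡ suc (blocks refinement n)
  refinement-blocks = redirect-blocks F fgj≡gj fj≡j (<⇒≢ gj<j) j<n

  -- A new crossing needs a foreign pair that separates the block of `j` from that of `g j`. If its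
  -- relevant point lies before `j`, then `f` and `g` agree there, and `g` being non-crossing puts
  -- the point into the block of `g j`. Otherwise `j` or `g j` precedes it and is the outermost
  -- point of a crossing for `f`.
  refinement-noncrossing : NonCrossingLabelling f → NonCrossingLabelling g →
    NonCrossingLabelling refinement
  refinement-noncrossing ncf ncg {a} {b} {c} {d} a<b b<c c<d
    with f a ≟ j | f b ≟ j | f c ≟ j | f d ≟ j
  ... | yes _  | yes _  | _      | _      = λ _ _ → refl
  ... | yes _  | no _   | _      | yes _  = λ _ bp → sym bp
  ... | yes aj | no b≁j | yes cj | no _   = λ _ bd →
    ⊥-elim (b≁j (trans (sym (ncf a<b b<c c<d (trans aj (sym cj)) bd)) aj))
  ... | yes aj | no _   | no _   | no _   = λ pc bd →
    trans (sym fgj≡gj) (ncf (<-≤-trans gj<j (≤-trans (subst (_≤ a) aj (decreasing F a)) (<⇒≤ a<b))) b<c c<d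
      (trans fgj≡gj pc) bd)
  ... | no _   | yes _  | yes _  | _      = λ ap _ → ap
  ... | no a≁j | yes bj | no _   | yes dj = λ ac _ →
    ⊥-elim (a≁j (trans (ncf a<b b<c c<d ac (trans bj (sym dj))) bj))
  ... | no a≁j | yes bj | no _   | no _   = λ ac pd → go ac pd (<-cmp a j)
    where
    gb≡gj : g b ≡ g j
    gb≡gj = trans (sym (f⊑g b)) (cong g bj)
    go : f a ≡ f c → g j ≡ f d → _ → f a ≡ g j
    go ac pd (tri< a<j _ _) = trans (agree a<j) (trans (ncg a<b b<c c<d (⊑⇒≡ {f} {g} f⊑g ac)
      (trans gb≡gj (trans (sym (idempotent G j)) (trans (cong g pd) (f⊑g d))))) gb≡gj)
    go ac pd (tri≈ _ refl _) = contradiction fj≡j a≁j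
    go ac pd (tri> _ _ j<a) = contradiction (trans (sym (ncf j<a a<b b<c (trans fj≡j (sym bj)) ac)) fj≡j) a≁j
  ... | no _   | no _   | yes _  | yes _  = λ ap bp → trans ap (sym bp)
  ... | no _   | no b≁j | yes cj | no _   = λ ap bd → trans ap (sym (go ap bd (<-cmp b j)))
    where
    go : f a ≡ g j → f b ≡ f d → _ → f b ≡ g j
    go ap bd (tri< b<j _ _) = trans (agree b<j) (trans (sym (ncg a<b b<c c<d
      (trans ga≡gj (trans (sym (cong g cj)) (f⊑g c))) (⊑⇒≡ {f} {g} f⊑g bd))) ga≡gj)
      where
      ga≡gj : g a ≡ g j
      ga≡gj = trans (sym (f⊑g a)) (trans (cong g ap) (idempotent G j))
    go ap bd (tri≈ _ refl _) = contradiction fj≡j b≁j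
    go ap bd (tri> _ _ j<b) = contradiction (trans (sym (ncf j<b b<c c<d (trans fj≡j (sym cj)) bd)) fj≡j) b≁j
  ... | no a≁j | no _   | no _   | yes dj = λ ac bp → trans (go ac bp (<-cmp a j)) (sym bp)
    where
    go : f a ≡ f c → f b ≡ g j → _ → f a ≡ g j
    go ac bp (tri< a<j _ _) = trans (agree a<j) (trans (ncg a<b b<c c<d (⊑⇒≡ {f} {g} f⊑g ac) gb≡gd) gb≡gj)
      where
      gb≡gj : g b ≡ g j
      gb≡gj = trans (sym (f⊑g b)) (trans (cong g bp) (idempotent G j))
      gb≡gd : g b ≡ g d
      gb≡gd = trans gb≡gj (trans (sym (cong g dj)) (f⊑g d))
    go ac bp (tri≈ _ refl _) = contradiction fj≡j a≁j
    go ac bp (tri> _ _ j<a) = trans (sym (ncf (<-trans gj<j j<a) a<b b<c (trans fgj≡gj (sym bp)) ac)) fgj≡gj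
  ... | no _   | no _   | no _   | no _   = λ ac bd → ncf a<b b<c c<d ac bd

first-difference : ∀ {n f g} → IsLabelling n f → IsLabelling n g →
  (∀ i → f i ≡ g i) ⊎ ∃ λ j → f j ≢ g j × (∀ {i} → i < j → f i ≡ g i)
first-difference {n} {f} {g} F G with search (λ i → ¬? (f i ≟ g i)) n
... | inj₂ (j , _ , neq , least) = inj₂ (j , neq , λ {i} i<j → decidable-stable (f i ≟ g i) (least i<j))
... | inj₁ none = inj₁ same
  where
  same : ∀ i → f i ≡ g i
  same i with i <? n | f i ≟ g i
  ... | _      | yes eq = eq
  ... | yes lt | no neq = contradiction neq (none lt)
  ... | no nlt | no _   = trans (outside F (≮⇒≥ nlt)) (sym (outside G (≮⇒≥ nlt)))

module _ {n} (S : ℕ → Bool) {k} (k<n : k < n) where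

  join-anti : ∀ {f g} → IsLabelling n f → IsLabelling n g → f ⊑ g →
    blocks (join k S g) n ≤ blocks (join k S f) n
  join-anti {f} {g} F G f⊑g = blocks-anti (join-labelling F S k k<n) (join-labelling G S k k<n)
    (join-⊑ F S k k<n {join k S g} (⊑-trans {f} {g} {join k S g} f⊑g (join-⊒ G S k k<n)) (join-respects G S k k<n)) n

  -- Merging j with g j in join k S f gives a partition above join k S refinement.
  join-refinement : ∀ {f g} (F : IsLabelling n f) (G : IsLabelling n g) (f⊑g : f ⊑ g) {j}
    (neq : f j ≢ g j) (agree : ∀ {i} → i < j → f i ≡ g i) → j < n →
    blocks (join k S f) n ≤ suc (blocks (join k S (refinement F G f⊑g neq agree)) n)
  join-refinement {f} {g} F G f⊑g {j} neq agree j<n = ≤-trans (merge-blocks-≤ J j<n gj<n)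
    (s≤s (blocks-anti (join-labelling R S k k<n) J′
      (join-⊑ R S k k<n {m} (redirect-⊑ F {h = m} (⊑-trans {f} {join k S f} {m} (join-⊒ F S k k<n) m⊒)
        (sym (merge-joins J)))
        λ i<k Si → ⊑⇒≡ {join k S f} {m} m⊒ (join-respects F S k k<n i<k Si)) n))
    where
    R = refinement-labelling F G f⊑g neq agree
    J = join-labelling F S k k<n
    gj<n = ≤-<-trans (decreasing G j) j<n
    m = merge (join k S f) j (g j)
    J′ = merge-labelling J j<n gj<n
    m⊒ : join k S f ⊑ m
    m⊒ = merge-⊒ J

-- Distances in the Hasse diagram

first : ∀ {n} → Subset n → ℕ
first []          = 0
first (true ∷ _)  = 0
first (false ∷ V) = suc (first V)

first-≤ : ∀ {n} {V : Subset n} {i} → i ∈ V → first V ≤ toℕ i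
first-≤ here = z≤n
first-≤ {V = true ∷ _} (there i∈V) = z≤n
first-≤ {V = false ∷ _} (there i∈V) = s≤s (first-≤ i∈V)

first-∈ : ∀ {n} {V : Subset n} {i} → i ∈ V → ∃ λ k → toℕ k ≡ first V × k ∈ V
first-∈ {V = true ∷ _} _ = Fin.zero , refl , here
first-∈ {V = false ∷ _} (there i∈V) with first-∈ i∈V
... | k , eq , k∈V = Fin.suc k , cong suc eq , there k∈V

label : ∀ {n} → NC n → ℕ → ℕ
label {n} π i with i <? n
... | yes i<n = first (lookup (value π) (fromℕ< i<n))
... | no _    = i

label-outside : ∀ {n} (π : NC n) {i} → n ≤ i → label π i ≡ i
label-outside {n} π {i} n≤i with i <? n
... | yes i<n = contradiction i<n (≤⇒≯ n≤i)
... | no _    = refl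

label-toℕ : ∀ {n} (π : NC n) i → label π (toℕ i) ≡ first (lookup (value π) i)
label-toℕ {n} π i with toℕ i <? n
... | yes i<n = cong (first ∘ lookup (value π)) (Fin.fromℕ<-toℕ i i<n)
... | no i≮n  = contradiction (Fin.toℕ<n i) i≮n

data Position (n : ℕ) : ℕ → Set where
  within : (i : Fin n) → Position n (toℕ i)
  beyond : ∀ {i} → n ≤ i → Position n i

position : ∀ n i → Position n i
position n i with i <? n
... | yes i<n = subst (Position n) (Fin.toℕ-fromℕ< i<n) (within (fromℕ< i<n))
... | no i≮n  = beyond (≮⇒≥ i≮n)

module _ {n} (π : NC n) where

  ∈⇒label : ∀ {i j} → j ∈ lookup (value π) i → label π (toℕ i) ≡ label π (toℕ j)
  ∈⇒label {i} {j} j∈ = trans (label-toℕ π i)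
    (trans (cong first (block-unique π i j∈)) (sym (label-toℕ π j)))

  label⇒∈ : ∀ {i j} → label π (toℕ i) ≡ label π (toℕ j) → j ∈ lookup (value π) i
  label⇒∈ {i} {j} eq with first-∈ (∈-block π i) | first-∈ (∈-block π j)
  ... | k , k≡ , k∈ | l , l≡ , l∈ = subst (j ∈_) (sym same) (∈-block π j)
    where
    k≡l : k ≡ l
    k≡l = Fin.toℕ-injective (trans k≡ (trans (sym (label-toℕ π i)) (trans eq (trans (label-toℕ π j) (sym l≡)))))
    same : lookup (value π) i ≡ lookup (value π) j
    same = trans (block-unique π i k∈) (trans (cong (lookup (value π)) k≡l) (sym (block-unique π j l∈)))

  label-∈ : ∀ i → ∃ λ k → toℕ k ≡ label π (toℕ i) × k ∈ lookup (value π) i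
  label-∈ i with first-∈ (∈-block π i)
  ... | k , k≡ , k∈ = k , trans k≡ (sym (label-toℕ π i)) , k∈

  label-labelling : IsLabelling n (label π)
  label-labelling = record { decreasing = dec ; idempotent = idem ; outside = label-outside π }
    where
    dec : ∀ i → label π i ≤ i
    dec i with position n i
    ... | within i   = subst (_≤ toℕ i) (sym (label-toℕ π i)) (first-≤ (∈-block π i))
    ... | beyond n≤i = ≤-reflexive (label-outside π n≤i)
    idem : ∀ i → label π (label π i) ≡ label π i
    idem i with position n i
    ... | beyond n≤i = cong (label π) (label-outside π n≤i)
    ... | within i with label-∈ i
    ...   | k , k≡ , k∈ = trans (cong (label π) (sym k≡)) (sym (∈⇒label k∈))

  label-noncrossing : NonCrossingLabelling (label π)
  label-noncrossing {a} {b} {c} {d} a<b b<c c<d ac bd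
    with position n a | position n b | position n c | position n d
  ... | _ | _ | _ | beyond n≤d = contradiction (≤-trans (≤-reflexive (trans (sym (label-outside π n≤d)) (sym bd)))
    (decreasing label-labelling b)) (<⇒≱ (<-trans b<c c<d))
  ... | beyond n≤a | _ | _ | within d = contradiction (<-≤-trans (Fin.toℕ<n d) n≤a) (<-asym (<-trans a<b (<-trans b<c c<d)))
  ... | within a | beyond n≤b | _ | within d = contradiction (<-≤-trans (Fin.toℕ<n d) n≤b) (<-asym (<-trans b<c c<d))
  ... | within a | within b | beyond n≤c | within d = contradiction (<-≤-trans (Fin.toℕ<n d) n≤c) (<-asym c<d)
  ... | within a | within b | within c | within d with lookup (value π) a ≟ˢ lookup (value π) b
  ...   | yes eq = trans (label-toℕ π a) (trans (cong first eq) (sym (label-toℕ π b)))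
  ...   | no neq = ⊥-elim (All.lookup⁺ (All.lookup⁺ (proj₂ (isNC π)) a) b neq a b c d a<b b<c c<d
    (∈-block π a) (label⇒∈ ac) (∈-block π b) (label⇒∈ bd))

≤⇒⊑ : ∀ {n} (π ρ : NC n) → π Defs.≤ ρ → label π ⊑ label ρ
≤⇒⊑ {n} π ρ π≤ρ i with position n i
... | beyond n≤i = cong (label ρ) (label-outside π n≤i)
... | within i with label-∈ π i
...   | k , k≡ , k∈ = trans (cong (label ρ) (sym k≡)) (sym (∈⇒label ρ (lookup-⊆ {π = π} {ρ} π≤ρ i k∈)))

⊑⇒≤ : ∀ {n} (π ρ : NC n) → label π ⊑ label ρ → π Defs.≤ ρ
⊑⇒≤ π ρ π⊑ρ = ≤-lookup {π = π} {ρ} λ i j∈ → label⇒∈ ρ (⊑⇒≡ {label π} {label ρ} π⊑ρ (∈⇒label π j∈))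

≗⇒⊑ : ∀ {n f g} → IsLabelling n f → (∀ i → f i ≡ g i) → f ⊑ g
≗⇒⊑ F eq i = trans (sym (eq _)) (trans (idempotent F i) (eq i))

label-injective : ∀ {n} (π ρ : NC n) → (∀ i → label π i ≡ label ρ i) → π ≡ ρ
label-injective π ρ eq = IsPartialOrder.antisym ≤-isPartialOrder
  (⊑⇒≤ π ρ (≗⇒⊑ (label-labelling π) eq)) (⊑⇒≤ ρ π (≗⇒⊑ (label-labelling ρ) (sym ∘ eq)))

module _ {n f} (F : IsLabelling n f) (ncf : NonCrossingLabelling f) where

  private
    π : Blocks n
    π = tabulate λ i → tabulate λ j → does (f (toℕ i) ≟ f (toℕ j))

    lookup-π : ∀ i j → lookup (lookup π i) j ≡ does (f (toℕ i) ≟ f (toℕ j))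
    lookup-π i j = trans (cong (λ V → lookup V j) (lookup∘tabulate _ i)) (lookup∘tabulate _ j)

    ∈⇒≡ : ∀ {i j} → j ∈ lookup π i → f (toℕ i) ≡ f (toℕ j)
    ∈⇒≡ {i} {j} j∈ = does⇒ (_ ≟ _) (trans (sym (lookup-π i j)) ([]=⇒lookup j∈))

    ≡⇒∈ : ∀ {i j} → f (toℕ i) ≡ f (toℕ j) → j ∈ lookup π i
    ≡⇒∈ {i} {j} eq = lookup⇒[]= j _ (trans (lookup-π i j) (dec-true (_ ≟ _) eq))

    ≡⇒block : ∀ {i j} → f (toℕ i) ≡ f (toℕ j) → lookup π i ≡ lookup π j
    ≡⇒block {i} {j} eq = trans (lookup∘tabulate _ i)
      (trans (cong (λ k → tabulate λ j → does (k ≟ f (toℕ j))) eq) (sym (lookup∘tabulate _ j)))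

  fromLabelling : NC n
  fromLabelling = π Ref., [ ((λ i → ≡⇒∈ refl)
      , All.lookup⁻ λ i → All.lookup⁻ λ j V≢W (k , k∈) →
          V≢W (≡⇒block (trans (∈⇒≡ (proj₁ (x∈p∩q⁻ _ _ k∈))) (sym (∈⇒≡ (proj₂ (x∈p∩q⁻ _ _ k∈)))))))
    , (All.lookup⁻ λ i → All.lookup⁻ λ j V≢W a b c d a<b b<c c<d a∈ c∈ b∈ d∈ →
          V≢W (≡⇒block (trans (∈⇒≡ a∈) (trans (ncf a<b b<c c<d (trans (sym (∈⇒≡ a∈)) (∈⇒≡ c∈))
            (trans (sym (∈⇒≡ b∈)) (∈⇒≡ d∈))) (sym (∈⇒≡ b∈)))))) ]

  -- `f i` belongs to the class of `i`, and every `k` in that class satisfies `f i ≡ f k ≤ k`.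
  label-fromLabelling : ∀ i → label fromLabelling i ≡ f i
  label-fromLabelling i with position n i
  ... | beyond n≤i = trans (label-outside fromLabelling n≤i) (sym (outside F n≤i))
  ... | within i with label-∈ fromLabelling i
  ...   | k , k≡ , k∈ = ≤-antisym
    (subst₂ _≤_ (sym (label-toℕ fromLabelling i)) (Fin.toℕ-fromℕ< fi<n)
      (first-≤ (≡⇒∈ {i} {fromℕ< fi<n} (trans (sym (idempotent F _)) (cong f (sym (Fin.toℕ-fromℕ< fi<n)))))))
    (subst₂ _≤_ (sym (∈⇒≡ {i} k∈)) k≡ (decreasing F (toℕ k)))
    where
    fi<n : f (toℕ i) < n
    fi<n = ≤-<-trans (decreasing F _) (Fin.toℕ<n i)

module Distance {n : ℕ} where

  open H n using (_⋖_; Edge; Walk; []; _∷_; distance)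

  ∣_∣ : NC n → ℕ
  ∣ π ∣ = blocks (label π) n

  -- A step upwards inside the interval from σ to τ. When τ covers σ the step must end at τ
  -- (`cover-refinement`), so every edge of the Hasse diagram inherits `merges` and `join-≤`.
  record Refinement (σ τ : NC n) : Set where
    field
      mid     : NC n
      lower   : σ Defs.≤ mid
      upper   : mid Defs.≤ τ
      merges  : ∣ σ ∣ ≡ suc ∣ mid ∣
      join-≤  : ∀ S {k} → k < n → blocks (join k S (label σ)) n ≤ suc (blocks (join k S (label mid)) n)

  refine : ∀ {σ τ} → σ Defs.≤ τ → σ ≢ τ → Refinement σ τ
  refine {σ} {τ} σ≤τ σ≢τ with first-difference (label-labelling σ) (label-labelling τ)
  ... | inj₁ same = contradiction (label-injective σ τ same) σ≢τ
  ... | inj₂ (j , neq , agree) = record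
    { mid    = ρ
    ; lower  = ⊑⇒≤ σ ρ (⊑-trans {label σ} {r} {label ρ} (refinement-⊒ F G σ⊑τ neq agree) (≗⇒⊑ R (sym ∘ ρ≗r)))
    ; upper  = ⊑⇒≤ ρ τ (⊑-trans {label ρ} {r} {label τ} (≗⇒⊑ (label-labelling ρ) ρ≗r) (refinement-⊑ F G σ⊑τ neq agree))
    ; merges = trans (refinement-blocks F G σ⊑τ neq agree) (cong suc (blocks-cong n (sym ∘ ρ≗r)))
    ; join-≤ = λ S k<n → ≤-trans (join-refinement S k<n F G σ⊑τ neq agree j<n)
        (s≤s (join-anti S k<n (label-labelling ρ) R (≗⇒⊑ (label-labelling ρ) ρ≗r)))
    }
    where
    F = label-labelling σ
    G = label-labelling τ
    σ⊑τ = ≤⇒⊑ σ τ σ≤τ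
    r = refinement F G σ⊑τ neq agree
    R = refinement-labelling F G σ⊑τ neq agree
    ncr = refinement-noncrossing F G σ⊑τ neq agree (label-noncrossing σ) (label-noncrossing τ)
    ρ = fromLabelling R ncr
    ρ≗r = label-fromLabelling R ncr
    j<n : j < n
    j<n with position n j
    ... | within i   = Fin.toℕ<n i
    ... | beyond n≤j = contradiction (trans (label-outside σ n≤j) (sym (label-outside τ n≤j))) neq

  open Refinement

  ∣∣-anti : ∀ {σ τ} → σ Defs.≤ τ → ∣ τ ∣ ≤ ∣ σ ∣
  ∣∣-anti {σ} {τ} σ≤τ = blocks-anti (label-labelling σ) (label-labelling τ) (≤⇒⊑ σ τ σ≤τ) n

  ∣∣-strict : ∀ {σ τ} → σ Defs.≤ τ → σ ≢ τ → ∣ τ ∣ < ∣ σ ∣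
  ∣∣-strict σ≤τ σ≢τ = ≤-trans (s≤s (∣∣-anti (upper R))) (≤-reflexive (sym (merges R)))
    where R = refine σ≤τ σ≢τ

  -- Block counts strictly drop along the order, so nothing fits between two partitions whose counts
  -- are consecutive.
  refinement-cover : ∀ {σ τ} (R : Refinement σ τ) → σ ⋖ mid R
  refinement-cover R = (lower R , λ eq → 1+n≢n (trans (sym (merges R)) (cong ∣_∣ eq)))
    , λ (z , (σ≤z , σ≢z) , (z≤m , z≢m)) →
        <⇒≱ (∣∣-strict z≤m z≢m) (s≤s⁻¹ (≤-trans (∣∣-strict σ≤z σ≢z) (≤-reflexive (merges R))))

  cover-refinement : ∀ {σ τ} → σ ⋖ τ → ∃ λ (R : Refinement σ τ) → mid R ≡ τ
  cover-refinement {σ} {τ} ((σ≤τ , σ≢τ) , gap) = R , decidable-stable (mid R Defs.≟ τ)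
    λ m≢τ → gap (mid R , proj₁ (refinement-cover R) , (upper R , m≢τ))
    where R = refine σ≤τ σ≢τ

  snoc : ∀ {k x y z} → Walk k x y → Edge y z → Walk (suc k) x z
  snoc []      e = e ∷ []
  snoc (f ∷ w) e = f ∷ snoc w e

  reverse : ∀ {k x y} → Walk k x y → Walk k y x
  reverse []      = []
  reverse (e ∷ w) = snoc (reverse w) (Sum.swap e)

  append : ∀ {j k x y z} → Walk j x y → Walk k y z → Walk (j + k) x z
  append []      v = v
  append (e ∷ w) v = e ∷ append w v

  ascend : ∀ k {σ τ} → σ Defs.≤ τ → ∣ σ ∣ ≡ k + ∣ τ ∣ → Walk k σ τ
  ascend zero {σ} {τ} σ≤τ eq with σ Defs.≟ τ
  ... | yes refl = []
  ... | no σ≢τ   = contradiction (∣∣-strict σ≤τ σ≢τ) (<-irrefl (sym eq))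
  ascend (suc k) {σ} {τ} σ≤τ eq = inj₁ (refinement-cover R)
    ∷ ascend k (upper R) (suc-injective (trans (sym (merges R)) eq))
    where R = refine {σ} {τ} σ≤τ λ { refl → m≢1+n+m _ eq }

  module _ (S : ℕ → Bool) {k} (k<n : k < n) where

    private
      J : NC n → ℕ
      J σ = blocks (join k S (label σ)) n

    -- The potential `∣ σ ∣ - 2 J σ` grows by at most one per edge, written without subtraction.
    -- Going up, `∣ σ ∣` falls by one and `J σ` by at most one; going down, `∣ σ ∣` rises by one and
    -- `J σ` does not fall.
    walk-bound : ∀ {j x y} → Walk j x y → ∣ y ∣ + 2 * J x ≤ j + (∣ x ∣ + 2 * J y)
    walk-bound [] = ≤-refl
    walk-bound {suc j} {x} {y} (_∷_ {y = z} (inj₁ x⋖z) w) with cover-refinement x⋖z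
    ... | R , refl = begin
      ∣ y ∣ + 2 * J x             ≤⟨ +-monoʳ-≤ ∣ y ∣ (*-monoʳ-≤ 2 (join-≤ R S k<n)) ⟩
      ∣ y ∣ + 2 * suc (J z)       ≡⟨ solve 2 (λ a b → a :+ con 2 :* (con 1 :+ b) := con 2 :+ (a :+ con 2 :* b)) refl ∣ y ∣ (J z) ⟩
      2 + (∣ y ∣ + 2 * J z)       ≤⟨ +-monoʳ-≤ 2 (walk-bound w) ⟩
      2 + (j + (∣ z ∣ + 2 * J y)) ≡⟨ solve 3 (λ a b c → con 2 :+ (a :+ (b :+ c)) := con 1 :+ a :+ ((con 1 :+ b) :+ c)) refl j ∣ z ∣ (2 * J y) ⟩
      suc j + (suc ∣ z ∣ + 2 * J y) ≡⟨ cong (λ b → suc j + (b + 2 * J y)) (sym (merges R)) ⟩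
      suc j + (∣ x ∣ + 2 * J y)   ∎
      where open ≤-Reasoning
            open +-*-Solver
    walk-bound {suc j} {x} {y} (_∷_ {y = z} (inj₂ z⋖x) w) with cover-refinement z⋖x
    ... | R , refl = begin
      ∣ y ∣ + 2 * J x             ≤⟨ +-monoʳ-≤ ∣ y ∣ (*-monoʳ-≤ 2 (join-anti S k<n
                                       (label-labelling z) (label-labelling x) (≤⇒⊑ z x (lower R)))) ⟩
      ∣ y ∣ + 2 * J z             ≤⟨ walk-bound w ⟩
      j + (∣ z ∣ + 2 * J y)       ≡⟨ cong (λ b → j + (b + 2 * J y)) (merges R) ⟩
      j + suc (∣ x ∣ + 2 * J y)   ≡⟨ +-suc j _ ⟩
      suc j + (∣ x ∣ + 2 * J y)   ∎
      where open ≤-Reasoning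

    -- The hypotheses make `S` the links of π. For the lower bound, joining π with itself loses no
    -- block, so the potential of `walk-bound` is at most `- ∣ π ∣` at π, while at ρ it is
    -- `∣ ρ ∣ - 2 J ρ`.
    dist-join : ∀ π ρ → Respects k S (label π) →
      (∀ {h} → Respects k S h → label π ⊑ h) →
      dH π ρ + 2 * J ρ ≡ ∣ π ∣ + ∣ ρ ∣
    dist-join π ρ resp least = ≤-antisym upper-bound lower-bound
      where
      F = label-labelling ρ
      L = join-labelling F S k k<n
      σ = fromLabelling L (join-noncrossing (label-noncrossing ρ) S k)
      σ≗ : ∀ i → label σ i ≡ join k S (label ρ) i
      σ≗ = label-fromLabelling L (join-noncrossing (label-noncrossing ρ) S k)
      ∣σ∣ : ∣ σ ∣ ≡ J ρ
      ∣σ∣ = blocks-cong n σ≗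
      join⊑σ : join k S (label ρ) ⊑ label σ
      join⊑σ = ≗⇒⊑ L (sym ∘ σ≗)
      ρ≤σ : ρ Defs.≤ σ
      ρ≤σ = ⊑⇒≤ ρ σ (⊑-trans {label ρ} {join k S (label ρ)} {label σ} (join-⊒ F S k k<n) join⊑σ)
      π≤σ : π Defs.≤ σ
      π≤σ = ⊑⇒≤ π σ (⊑-trans {label π} {join k S (label ρ)} {label σ} (least (join-respects F S k k<n)) join⊑σ)
      p = ∣ π ∣ ∸ ∣ σ ∣
      q = ∣ ρ ∣ ∸ ∣ σ ∣
      p+ : ∣ π ∣ ≡ p + ∣ σ ∣
      p+ = sym (m∸n+n≡m (∣∣-anti π≤σ))
      q+ : ∣ ρ ∣ ≡ q + ∣ σ ∣
      q+ = sym (m∸n+n≡m (∣∣-anti ρ≤σ))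
      walk : Walk (p + q) π ρ
      walk = append (ascend p π≤σ p+) (reverse (ascend q ρ≤σ q+))
      D = distance π ρ
      upper-bound : dH π ρ + 2 * J ρ ≤ ∣ π ∣ + ∣ ρ ∣
      upper-bound = begin
        dH π ρ + 2 * J ρ           ≤⟨ +-monoˡ-≤ (2 * J ρ) (≮⇒≥ λ lt → proj₂ (proj₂ D) lt walk) ⟩
        p + q + 2 * J ρ            ≡⟨ cong (λ b → p + q + 2 * b) (sym ∣σ∣) ⟩
        p + q + 2 * ∣ σ ∣          ≡⟨ solve 3 (λ a b c → a :+ b :+ con 2 :* c := a :+ c :+ (b :+ c)) refl p q ∣ σ ∣ ⟩
        (p + ∣ σ ∣) + (q + ∣ σ ∣)  ≡⟨ cong₂ _+_ (sym p+) (sym q+) ⟩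
        ∣ π ∣ + ∣ ρ ∣              ∎
        where open ≤-Reasoning
              open +-*-Solver
      ∣π∣≤Jπ : ∣ π ∣ ≤ J π
      ∣π∣≤Jπ = blocks-anti (join-labelling (label-labelling π) S k k<n) (label-labelling π)
        (join-⊑ (label-labelling π) S k k<n {label π} (idempotent (label-labelling π)) resp) n
      lower-bound : ∣ π ∣ + ∣ ρ ∣ ≤ dH π ρ + 2 * J ρ
      lower-bound = +-cancelʳ-≤ ∣ π ∣ _ _ (begin
        ∣ π ∣ + ∣ ρ ∣ + ∣ π ∣        ≡⟨ solve 2 (λ a b → a :+ b :+ a := b :+ con 2 :* a) refl ∣ π ∣ ∣ ρ ∣ ⟩
        ∣ ρ ∣ + 2 * ∣ π ∣            ≤⟨ +-monoʳ-≤ ∣ ρ ∣ (*-monoʳ-≤ 2 ∣π∣≤Jπ) ⟩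
        ∣ ρ ∣ + 2 * J π              ≤⟨ walk-bound (proj₁ (proj₂ D)) ⟩
        dH π ρ + (∣ π ∣ + 2 * J ρ)   ≡⟨ solve 3 (λ a b c → a :+ (b :+ c) := a :+ c :+ b) refl (dH π ρ) ∣ π ∣ (2 * J ρ) ⟩
        dH π ρ + 2 * J ρ + ∣ π ∣     ∎)
        where open ≤-Reasoning
              open +-*-Solver

-- Flagged binary trees

data Split (m : ℕ) : ℕ → Set where
  left  : ∀ {i} → i < m → Split m i
  right : ∀ j → Split m (m + j)

split : ∀ m i → Split m i
split m i with i <? m
... | yes i<m = left i<m
... | no i≮m  = subst (Split m) (m+[n∸m]≡n (≮⇒≥ i≮m)) (right (i ∸ m))

above : (ℕ → ℕ) → ℕ → ℕ
above f zero    = zero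
above f (suc i) = suc (f i)

-- Translation of labels of the right part. Its position `j` moves to `suc (m + j)`, but the block
-- of its first element receives 0 as new minimum.
graft : ℕ → ℕ → ℕ
graft m zero    = zero
graft m (suc j) = suc (m + suc j)

glue : ℕ → (ℕ → ℕ) → (ℕ → ℕ) → ℕ → ℕ
glue m f g zero = zero
glue m f g (suc i) with i <? m
... | yes _ = suc (f i)
... | no _  = graft m (g (i ∸ m))

glue-left : ∀ {m} f g {i} → i < m → glue m f g (suc i) ≡ suc (f i)
glue-left {m} f g {i} i<m with i <? m
... | yes _  = refl
... | no i≮m = contradiction i<m i≮m

glue-right : ∀ m f g j → glue m f g (suc (m + j)) ≡ graft m (g j)
glue-right m f g j with m + j <? m
... | yes m+j<m = contradiction (m≤m+n m j) (<⇒≱ m+j<m)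
... | no _      = cong (graft m ∘ g) (m+n∸m≡n m j)

graft-injective : ∀ m {i j} → graft m i ≡ graft m j → i ≡ j
graft-injective m {zero}  {zero}  _  = refl
graft-injective m {suc i} {suc j} eq = +-cancelˡ-≡ m _ _ (suc-injective eq)

graft-≢ : ∀ m j {i} → i < m → suc i ≢ graft m j
graft-≢ m (suc j) i<m eq = <⇒≱ i<m (≤-trans (m≤m+n m (suc j)) (≤-reflexive (sym (suc-injective eq))))

graft-≤ : ∀ m j → graft m j ≤ suc (m + j)
graft-≤ m zero    = z≤n
graft-≤ m (suc j) = ≤-refl

minimum-0 : ∀ {n f} → IsLabelling n f → f 0 ≡ 0
minimum-0 F = n≤0⇒n≡0 (decreasing F 0)

glue-graft : ∀ m f {k g} → IsLabelling k g → ∀ j → glue m f g (graft m j) ≡ graft m (g j)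
glue-graft m f G zero    = cong (graft m) (sym (minimum-0 G))
glue-graft m f {g = g} G (suc j) = glue-right m f g (suc j)

above-labelling : ∀ {m f} → IsLabelling m f → IsLabelling (suc m) (above f)
above-labelling {m} {f} F = record { decreasing = dec ; idempotent = idem ; outside = out }
  where
  dec : ∀ i → above f i ≤ i
  dec zero    = z≤n
  dec (suc i) = s≤s (decreasing F i)
  idem : ∀ i → above f (above f i) ≡ above f i
  idem zero    = refl
  idem (suc i) = cong suc (idempotent F i)
  out : ∀ {i} → suc m ≤ i → above f i ≡ i
  out (s≤s m≤i) = cong suc (outside F m≤i)

glue-labelling : ∀ {m k f g} → 0 < k → IsLabelling m f → IsLabelling k g →
  IsLabelling (suc (m + k)) (glue m f g)
glue-labelling {m} {k} {f} {g} 0<k F G = record { decreasing = dec ; idempotent = idem ; outside = out }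
  where
  dec : ∀ i → glue m f g i ≤ i
  dec zero = z≤n
  dec (suc i) with split m i
  ... | left i<m = ≤-trans (≤-reflexive (glue-left f g i<m)) (s≤s (decreasing F i))
  ... | right j  = ≤-trans (≤-reflexive (glue-right m f g j))
    (≤-trans (graft-≤ m (g j)) (s≤s (+-monoʳ-≤ m (decreasing G j))))
  idem : ∀ i → glue m f g (glue m f g i) ≡ glue m f g i
  idem zero = refl
  idem (suc i) with split m i
  ... | left i<m = trans (cong (glue m f g) (glue-left f g i<m))
    (trans (glue-left f g (≤-<-trans (decreasing F i) i<m))
      (trans (cong suc (idempotent F i)) (sym (glue-left f g i<m))))
  ... | right j = trans (cong (glue m f g) (glue-right m f g j))
    (trans (glue-graft m f G (g j)) (trans (cong (graft m) (idempotent G j)) (sym (glue-right m f g j))))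
  out : ∀ {i} → suc (m + k) ≤ i → glue m f g i ≡ i
  out {suc i} (s≤s m+k≤i) with split m i
  ... | left i<m = contradiction (≤-trans (m≤m+n m k) m+k≤i) (<⇒≱ i<m)
  ... | right j = trans (glue-right m f g j) (trans (cong (graft m) (outside G k≤j)) (pos j (<-≤-trans 0<k k≤j)))
    where
    k≤j = +-cancelˡ-≤ m k j m+k≤i
    pos : ∀ j → 0 < j → graft m j ≡ suc (m + j)
    pos (suc j) _ = refl

above-noncrossing : ∀ {f} → NonCrossingLabelling f → NonCrossingLabelling (above f)
above-noncrossing ncf {zero}  {suc b} {suc c} {suc d} _ _ _ ()
above-noncrossing ncf {suc a} {suc b} {suc c} {suc d} (s≤s a<b) (s≤s b<c) (s≤s c<d) ac bd =
  cong suc (ncf a<b b<c c<d (suc-injective ac) (suc-injective bd))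

-- The left part fills the positions from 1 to `m` and shares no block with the rest, so a crossing
-- lies in one part. The element 0 behaves like the first element of the right part.
glue-noncrossing : ∀ {m k f g} → IsLabelling m f → IsLabelling k g →
  NonCrossingLabelling f → NonCrossingLabelling g → NonCrossingLabelling (glue m f g)
glue-noncrossing {m} {k} {f} {g} F G ncf ncg = nc
  where
  h = glue m f g

  rr : ∀ {i j} → h (suc (m + i)) ≡ h (suc (m + j)) → g i ≡ g j
  rr {i} {j} eq = graft-injective m (trans (sym (glue-right m f g i)) (trans eq (glue-right m f g j)))

  ll : ∀ {i j} → i < m → j < m → h (suc i) ≡ h (suc j) → f i ≡ f j
  ll i<m j<m eq = suc-injective (trans (sym (glue-left f g i<m)) (trans eq (glue-left f g j<m)))

  lr : ∀ {i j} → i < m → h (suc i) ≢ h (suc (m + j))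
  lr {i} {j} i<m eq = graft-≢ m (g j) (≤-<-trans (decreasing F i) i<m)
    (trans (sym (glue-left f g i<m)) (trans eq (glue-right m f g j)))

  r< : ∀ {i j} → suc (m + i) < suc (m + j) → i < j
  r< (s≤s lt) = +-cancelˡ-< m _ _ lt

  from-0 : ∀ {b c d} → 0 < b → b < c → c < d → 0 ≡ h c → h b ≡ h d → 0 ≡ h b
  from-0 {suc b} {suc c} {suc d} _ b<c c<d 0c bd with split m b | split m c | split m d
  ... | _         | left c<m | _ = contradiction (trans 0c (glue-left f g c<m)) λ ()
  ... | _         | right c  | left d<m = contradiction (<-trans (s≤s⁻¹ c<d) d<m) (≤⇒≯ (m≤m+n m c))
  ... | left b<m  | right c  | right d = contradiction bd (lr b<m)
  ... | right zero    | right c | right d = sym (trans (glue-right m f g 0) (cong (graft m) (minimum-0 G)))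
  ... | right (suc b) | right c | right d = sym (trans (glue-right m f g (suc b)) (cong (graft m)
    (trans (sym (ncg z<s (r< b<c) (r< c<d) (trans (minimum-0 G) (graft-injective m (trans 0c (glue-right m f g c)))) (rr bd)))
      (minimum-0 G))))

  nc : NonCrossingLabelling h
  nc {zero} a<b b<c c<d ac bd = from-0 a<b b<c c<d ac bd
  nc {suc a} {suc b} {suc c} {suc d} a<b b<c c<d ac bd with split m a | split m b | split m c | split m d
  ... | left a<m | _        | right c  | _ = contradiction ac (lr a<m)
  ... | left a<m | right b  | left c<m | _ = contradiction (<-trans (s≤s⁻¹ b<c) c<m) (≤⇒≯ (m≤m+n m b))
  ... | left a<m | left b<m | left c<m | right d = contradiction bd (lr b<m)
  ... | left a<m | left b<m | left c<m | left d<m = trans (glue-left f g a<m)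
    (trans (cong suc (ncf (s≤s⁻¹ a<b) (s≤s⁻¹ b<c) (s≤s⁻¹ c<d) (ll a<m c<m ac) (ll b<m d<m bd)))
      (sym (glue-left f g b<m)))
  ... | right a  | left b<m | _        | _ = contradiction (<-trans (s≤s⁻¹ a<b) b<m) (≤⇒≯ (m≤m+n m a))
  ... | right a  | right b  | left c<m | _ = contradiction (<-trans (s≤s⁻¹ b<c) c<m) (≤⇒≯ (m≤m+n m b))
  ... | right a  | right b  | right c  | left d<m = contradiction (<-trans (s≤s⁻¹ c<d) d<m) (≤⇒≯ (m≤m+n m c))
  ... | right a  | right b  | right c  | right d = trans (glue-right m f g a)
    (trans (cong (graft m) (ncg (r< a<b) (r< b<c) (r< c<d) (rr ac) (rr bd))) (sym (glue-right m f g b)))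

above-⊑ : ∀ {f f′} → f ⊑ f′ → above f ⊑ above f′
above-⊑ f⊑f′ zero    = refl
above-⊑ f⊑f′ (suc i) = cong suc (f⊑f′ i)

glue-⊑ : ∀ {m k f g f′ g′} → IsLabelling m f → IsLabelling k g′ → f ⊑ f′ → g ⊑ g′ →
  glue m f g ⊑ glue m f′ g′
glue-⊑ F G′ f⊑f′ g⊑g′ zero = refl
glue-⊑ {m} {k} {f} {g} {f′} {g′} F G′ f⊑f′ g⊑g′ (suc i) with split m i
... | left i<m = trans (cong (glue m f′ g′) (glue-left f g i<m))
  (trans (glue-left f′ g′ (≤-<-trans (decreasing F i) i<m))
    (trans (cong suc (f⊑f′ i)) (sym (glue-left f′ g′ i<m))))
... | right j = trans (cong (glue m f′ g′) (glue-right m f g j))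
  (trans (glue-graft m f′ G′ (g j)) (trans (cong (graft m) (g⊑g′ j)) (sym (glue-right m f′ g′ j))))

blocks-suc : ∀ h n → h 0 ≡ 0 → blocks h (suc n) ≡ suc (count (λ i → does (h (suc i) ≟ suc i)) n)
blocks-suc h n h0 = trans (count-+ _ 1 n) (cong (λ b → bit b + count (λ i → does (h (suc i) ≟ suc i)) n) (dec-true (h 0 ≟ 0) h0))

blocks-above : ∀ f m → blocks (above f) (suc m) ≡ suc (blocks f m)
blocks-above f m = blocks-suc (above f) m refl

does-cong : ∀ {A B : Set} (a? : Dec A) (b? : Dec B) → (A → B) → (B → A) → does a? ≡ does b?
does-cong (yes a) b? to from = sym (dec-true b? (to a))
does-cong (no ¬a) b? to from = sym (dec-false b? (¬a ∘ from))

-- 0 takes over from the first element of the right part as minimum of its block, so no block is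
-- gained.
blocks-glue : ∀ m f {k g} → IsLabelling (suc k) g →
  blocks (glue m f g) (suc (m + suc k)) ≡ blocks f m + blocks g (suc k)
blocks-glue m f {k} {g} G = trans (blocks-suc (glue m f g) (m + suc k) refl)
  (trans (cong suc (trans (count-+ _ m (suc k)) (cong₂ _+_ left-part right-part))) (trans (sym (+-suc _ _))
    (cong (blocks f m +_) (sym (blocks-suc g k (minimum-0 G))))))
  where
  left-part : count (λ i → does (glue m f g (suc i) ≟ suc i)) m ≡ blocks f m
  left-part = count-cong m λ {i} i<m → cong (λ v → does (v ≟ suc i)) (glue-left f g i<m)
  right-part : count (λ j → does (glue m f g (suc (m + j)) ≟ suc (m + j))) (suc k) ≡
    count (λ j → does (g (suc j) ≟ suc j)) k
  right-part = trans (count-+ _ 1 k) (cong₂ _+_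
    (cong bit (dec-false (_ ≟ suc (m + 0)) λ eq → 0≢1+n (trans (cong (graft m) (sym (minimum-0 G)))
      (trans (sym (glue-right m f g 0)) eq))))
    (count-cong k λ {j} _ → trans (cong (λ v → does (v ≟ suc (m + suc j))) (glue-right m f g (suc j)))
      (does-cong (graft m (g (suc j)) ≟ graft m (suc j)) (g (suc j) ≟ suc j) (graft-injective m) (cong (graft m)))))

data Tree : Set where
  nil  : Tree
  node : Bool → Tree → Tree → Tree

size : Tree → ℕ
size nil          = 0
size (node x l r) = suc (size l + size r)

size-leaf : ∀ x l → size (node x l nil) ≡ suc (size l)
size-leaf x l = cong suc (+-identityʳ (size l))

flags : Tree → ℕ → Bool
flags nil          i       = false
flags (node x l r) zero    = x
flags (node x l r) (suc i) with i <? size l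
... | yes _ = flags l i
... | no _  = flags r (i ∸ size l)

flags-left : ∀ x l r {i} → i < size l → flags (node x l r) (suc i) ≡ flags l i
flags-left x l r {i} i<m with i <? size l
... | yes _  = refl
... | no i≮m = contradiction i<m i≮m

flags-right : ∀ x l r j → flags (node x l r) (suc (size l + j)) ≡ flags r j
flags-right x l r j with size l + j <? size l
... | yes m+j<m = contradiction (m≤m+n (size l) j) (<⇒≱ m+j<m)
... | no _      = cong (flags r) (m+n∸m≡n (size l) j)

-- The binary tree node x l r stands for a partition of 0, followed by the
-- elements of l, followed by those of r, with 0 in the block of the first element
-- of r.
enc : Tree → ℕ → ℕ
enc nil                       = id
enc (node x l nil)            = above (enc l)
enc (node x l r@(node _ _ _)) = glue (size l) (enc l) (enc r)

enc-labelling : ∀ t → IsLabelling (size t) (enc t)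
enc-labelling nil = record { decreasing = λ _ → ≤-refl ; idempotent = λ _ → refl ; outside = λ _ → refl }
enc-labelling (node x l nil) = subst (λ n → IsLabelling n (above (enc l))) (sym (size-leaf x l))
  (above-labelling (enc-labelling l))
enc-labelling (node x l r@(node _ _ _)) = glue-labelling z<s (enc-labelling l) (enc-labelling r)

enc-noncrossing : ∀ t → NonCrossingLabelling (enc t)
enc-noncrossing nil a<b b<c c<d refl bd = contradiction (<-trans a<b b<c) (<-irrefl refl)
enc-noncrossing (node x l nil) = above-noncrossing (enc-noncrossing l)
enc-noncrossing (node x l r@(node _ _ _)) =
  glue-noncrossing (enc-labelling l) (enc-labelling r) (enc-noncrossing l) (enc-noncrossing r)

-- The tree of a non-crossing partition

Decoding : ℕ → (ℕ → Bool) → (ℕ → ℕ) → Set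
Decoding n S f = ∃ λ t → size t ≡ n × (∀ i → enc t i ≡ f i) × (∀ {i} → i < n → flags t i ≡ S i)

module _ {n} (S : ℕ → Bool) {f} (F : IsLabelling (suc n) f) (ncf : NonCrossingLabelling f) where

  private
    f0 : f 0 ≡ 0
    f0 = minimum-0 F

  module _ (alone : ∀ {i} → i < n → f (suc i) ≢ 0) where

    private
      g : ℕ → ℕ
      g i = pred (f (suc i))

    rest-≡ : ∀ i → f (suc i) ≡ suc (g i)
    rest-≡ i with i <? n
    ... | no i≮n  = trans (outside F (s≤s (≮⇒≥ i≮n))) (cong suc (sym (cong pred (outside F (s≤s (≮⇒≥ i≮n))))))
    ... | yes i<n = sym (suc-pred (f (suc i)) ⦃ ≢-nonZero (alone i<n) ⦄)

    rest-labelling : IsLabelling n g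
    rest-labelling = record
      { decreasing = λ i → s≤s⁻¹ (≤-trans (≤-reflexive (sym (rest-≡ i))) (decreasing F (suc i)))
      ; idempotent = λ i → suc-injective (trans (sym (rest-≡ (g i))) (trans (cong f (sym (rest-≡ i)))
          (trans (idempotent F (suc i)) (rest-≡ i))))
      ; outside = λ n≤i → cong pred (outside F (s≤s n≤i))
      }

    rest-noncrossing : NonCrossingLabelling g
    rest-noncrossing {a} {b} {c} {d} a<b b<c c<d ac bd = suc-injective (trans (sym (rest-≡ a))
      (trans (ncf (s≤s a<b) (s≤s b<c) (s≤s c<d)
        (trans (rest-≡ a) (trans (cong suc ac) (sym (rest-≡ c))))
        (trans (rest-≡ b) (trans (cong suc bd) (sym (rest-≡ d))))) (rest-≡ b)))

    decode-alone : Decoding n (S ∘ suc) g → Decoding (suc n) S f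
    decode-alone (l , refl , l≗ , lS) = node (S 0) l nil , size-leaf (S 0) l , enc≗ , flags≗
      where
      enc≗ : ∀ i → above (enc l) i ≡ f i
      enc≗ zero    = sym f0
      enc≗ (suc i) = trans (cong suc (l≗ i)) (sym (rest-≡ i))
      flags≗ : ∀ {i} → i < suc (size l) → flags (node (S 0) l nil) i ≡ S i
      flags≗ {zero}  _         = refl
      flags≗ {suc i} (s≤s i<n) = trans (flags-left (S 0) l nil i<n) (lS i<n)

  module _ {m} (m<n : m < n) (fm : f (suc m) ≡ 0) (next : ∀ {i} → i < m → f (suc i) ≢ 0) where

    private
      k : ℕ
      k = n ∸ m

      0<k : 0 < k
      0<k = m<n⇒0<n∸m m<n

      m+k : m + k ≡ n
      m+k = m+[n∸m]≡n (<⇒≤ m<n)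

      g h : ℕ → ℕ
      g i = pick (i <? m) (pred (f (suc i))) i
      h j = f (suc (m + j)) ∸ suc m

      g-≡ : ∀ {i} → i < m → f (suc i) ≡ suc (g i)
      g-≡ {i} i<m with i <? m
      ... | no i≮m = contradiction i<m i≮m
      ... | yes _  = sym (suc-pred (f (suc i)) ⦃ ≢-nonZero (next i<m) ⦄)

      g-out : ∀ {i} → m ≤ i → g i ≡ i
      g-out {i} m≤i with i <? m
      ... | no _    = refl
      ... | yes i<m = contradiction i<m (≤⇒≯ m≤i)

      -- Here non-crossing is used: 0 and `suc m` share a block and enclose the left part, so a
      -- later element with minimum `suc i` in that part would make a crossing.
      not-left : ∀ {i j} → f (suc (m + j)) ≡ suc i → ¬ i < m
      not-left {i} {zero} eq i<m = 0≢1+n (trans (sym fm) (trans (cong (f ∘ suc) (sym (+-identityʳ m))) eq))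
      not-left {i} {suc j} eq i<m = 0≢1+n (trans (sym f0) (trans (ncf z<s (s≤s i<m) (s≤s (m<m+n m z<s))
        (trans f0 (sym fm)) (trans fi (sym eq))) fi))
        where
        fi : f (suc i) ≡ suc i
        fi = trans (cong f (sym eq)) (trans (idempotent F _) eq)

      -- The label is 0 or beyond `suc m`: the left part is excluded by `not-left`, and `suc m`,
      -- being labelled 0, is no minimum.
      h-≡ : ∀ j → f (suc (m + j)) ≡ graft m (h j)
      h-≡ j with f (suc (m + j)) in eq
      ... | zero = refl
      ... | suc i with split m i
      ...   | left i<m = contradiction i<m (not-left {j = j} eq)
      ...   | right (suc q) rewrite m+n∸m≡n m (suc q) = refl
      ...   | right zero = contradiction (trans (sym (trans (cong f (sym eq)) (trans (idempotent F _) eq)))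
        (trans (cong (f ∘ suc) (+-identityʳ m)) fm)) λ ()

      g-≤ : ∀ {i} → i < m → g i ≤ i
      g-≤ {i} i<m = s≤s⁻¹ (≤-trans (≤-reflexive (sym (g-≡ i<m))) (decreasing F (suc i)))

      g-labelling : IsLabelling m g
      g-labelling = record { decreasing = dec ; idempotent = idem ; outside = g-out }
        where
        dec : ∀ i → g i ≤ i
        dec i with i <? m
        ... | no _    = ≤-refl
        ... | yes i<m = ≤-trans (∸-monoˡ-≤ 1 (decreasing F (suc i))) ≤-refl
        idem : ∀ i → g (g i) ≡ g i
        idem i = case (i <? m)
          where
          case : Dec (i < m) → g (g i) ≡ g i
          case (no i≮m) = cong g (g-out (≮⇒≥ i≮m))
          case (yes i<m) = suc-injective (trans (sym (g-≡ (≤-<-trans (g-≤ i<m) i<m)))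
            (trans (cong f (sym (g-≡ i<m))) (trans (idempotent F (suc i)) (g-≡ i<m))))

      g-noncrossing : NonCrossingLabelling g
      g-noncrossing {a} {b} {c} {d} a<b b<c c<d ac bd = case (d <? m)
        where
        case : Dec (d < m) → g a ≡ g b
        case (no d≮m) = contradiction (≤-trans (≤-reflexive (trans (sym (g-out (≮⇒≥ d≮m))) (sym bd)))
          (decreasing g-labelling b)) (<⇒≱ (<-trans b<c c<d))
        case (yes d<m) = suc-injective (trans (sym (g-≡ a<m))
          (trans (ncf (s≤s a<b) (s≤s b<c) (s≤s c<d)
            (trans (g-≡ a<m) (trans (cong suc ac) (sym (g-≡ c<m))))
            (trans (g-≡ b<m) (trans (cong suc bd) (sym (g-≡ d<m))))) (g-≡ b<m)))
          where
          c<m = <-trans c<d d<m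
          b<m = <-trans b<c c<m
          a<m = <-trans a<b b<m

      h-labelling : IsLabelling k h
      h-labelling = record { decreasing = dec ; idempotent = idem ; outside = out }
        where
        dec : ∀ j → h j ≤ j
        dec j = ≤-trans (∸-monoˡ-≤ (suc m) (decreasing F (suc (m + j)))) (≤-reflexive (m+n∸m≡n m j))
        f-graft : ∀ j → f (graft m j) ≡ f (suc (m + j))
        f-graft zero    = trans f0 (sym (trans (cong (f ∘ suc) (+-identityʳ m)) fm))
        f-graft (suc j) = refl
        idem : ∀ j → h (h j) ≡ h j
        idem j = graft-injective m (trans (sym (h-≡ (h j))) (trans (sym (f-graft (h j)))
          (trans (cong f (sym (h-≡ j))) (trans (idempotent F _) (h-≡ j)))))
        out : ∀ {j} → k ≤ j → h j ≡ j
        out {j} k≤j = trans (cong (_∸ suc m) (outside F (s≤s (≤-trans (≤-reflexive (sym m+k)) (+-monoʳ-≤ m k≤j)))))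
          (m+n∸m≡n m j)

      h-noncrossing : NonCrossingLabelling h
      h-noncrossing {a} {b} {c} {d} a<b b<c c<d ac bd = graft-injective m (trans (sym (h-≡ a))
        (trans (ncf (s≤s (+-monoʳ-< m a<b)) (s≤s (+-monoʳ-< m b<c)) (s≤s (+-monoʳ-< m c<d))
          (trans (h-≡ a) (trans (cong (graft m) ac) (sym (h-≡ c))))
          (trans (h-≡ b) (trans (cong (graft m) bd) (sym (h-≡ d))))) (h-≡ b)))

    decode-next : (∀ {m S f} → m < n → IsLabelling m f → NonCrossingLabelling f → Decoding m S f) →
      (∀ {k S f} → k < suc n → IsLabelling k f → NonCrossingLabelling f → Decoding k S f) →
      Decoding (suc n) S f
    decode-next decL decR
      with decL {S = S ∘ suc} m<n g-labelling g-noncrossing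
         | decR {S = λ j → S (suc (m + j))} (s≤s (m∸n≤m n m)) h-labelling h-noncrossing
    ... | _ | nil , 0≡k , _ = contradiction 0<k (<-irrefl 0≡k)
    ... | l , refl , l≗ , lS | r@(node _ _ _) , r≡k , r≗ , rS =
      node (S 0) l r , cong suc (trans (cong (size l +_) r≡k) m+k) , enc≗ , flags≗
      where
      enc≗ : ∀ i → glue (size l) (enc l) (enc r) i ≡ f i
      enc≗ zero = sym f0
      enc≗ (suc i) with split (size l) i
      ... | left i<m = trans (glue-left (enc l) (enc r) i<m) (trans (cong suc (l≗ i)) (sym (g-≡ i<m)))
      ... | right j = trans (glue-right (size l) (enc l) (enc r) j) (trans (cong (graft (size l)) (r≗ j)) (sym (h-≡ j)))
      flags≗ : ∀ {i} → i < suc n → flags (node (S 0) l r) i ≡ S i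
      flags≗ {zero} _ = refl
      flags≗ {suc i} (s≤s i<n) with split (size l) i
      ... | left i<m = trans (flags-left (S 0) l r i<m) (lS i<m)
      ... | right j = trans (flags-right (S 0) l r j) (rS (+-cancelˡ-< (size l) _ _ (<-≤-trans i<n (≤-reflexive (sym m+k)))))

-- `N` is fuel: the sizes of the two parts are computed by the search and are not structurally
-- smaller.
decode : ∀ N {n} S {f} → n < N → IsLabelling n f → NonCrossingLabelling f → Decoding n S f
decode (suc N) {zero}  S _ F ncf = nil , refl , (λ i → sym (outside F z≤n)) , λ ()
decode (suc N) {suc n} S {f} (s≤s n<N) F ncf with search (λ i → f (suc i) ≟ 0) n
... | inj₁ alone = decode-alone S F ncf alone
  (decode N (S ∘ suc) n<N (rest-labelling S F ncf alone) (rest-noncrossing S F ncf alone))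
... | inj₂ (m , m<n , fm , next) = decode-next S F ncf m<n fm next
  (λ {_} {S} m<n G → decode N S (<-trans m<n n<N) G)
  (λ {_} {S} k<1+n G → decode N S (<-≤-trans k<1+n n<N) G)

glue-next : ∀ m f {k g} → IsLabelling k g → glue m f g (suc m) ≡ 0
glue-next m f {g = g} G = trans (cong (glue m f g ∘ suc) (sym (+-identityʳ m)))
  (trans (glue-right m f g 0) (cong (graft m) (minimum-0 G)))

-- `suc m` is the least positive position with label 0, so the glued map determines `m`.
glue-offset : ∀ {m m′ f f′ k k′ g g′} → IsLabelling k g → IsLabelling k′ g′ →
  (∀ i → glue m f g i ≡ glue m′ f′ g′ i) → m ≡ m′
glue-offset {m} {m′} {f} {f′} {g = g} {g′} G G′ eq with <-cmp m m′
... | tri≈ _ m≡m′ _ = m≡m′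
... | tri< lt _ _ = contradiction (trans (sym (glue-left f′ g′ lt)) (trans (sym (eq (suc m))) (glue-next m f G))) 1+n≢0
... | tri> _ _ gt = contradiction (trans (sym (glue-left f g gt)) (trans (eq (suc m′)) (glue-next m′ f′ G′))) 1+n≢0

enc-injective : ∀ t t′ → size t ≡ size t′ → (∀ i → enc t i ≡ enc t′ i) →
  (∀ {i} → i < size t → flags t i ≡ flags t′ i) → t ≡ t′
enc-injective nil nil _ _ _ = refl
enc-injective (node x l nil) (node x′ l′ nil) sz eq fl = cong₂ (λ x l → node x l nil) (fl z<s)
  (enc-injective l l′ sz′ (λ i → suc-injective (eq (suc i))) λ {i} i<m → trans (sym (flags-left x l nil i<m))
    (trans (fl (s≤s (≤-trans i<m (m≤m+n _ 0)))) (flags-left x′ l′ nil (<-≤-trans i<m (≤-reflexive sz′)))))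
  where
  sz′ : size l ≡ size l′
  sz′ = suc-injective (trans (sym (size-leaf x l)) (trans sz (size-leaf x′ l′)))
enc-injective (node x l nil) (node x′ l′ r′@(node _ _ _)) sz eq fl =
  contradiction (trans (eq (suc (size l′))) (glue-next (size l′) (enc l′) (enc-labelling r′))) 1+n≢0
enc-injective (node x l r@(node _ _ _)) (node x′ l′ nil) sz eq fl =
  contradiction (trans (sym (eq (suc (size l)))) (glue-next (size l) (enc l) (enc-labelling r))) 1+n≢0
enc-injective (node x l r@(node _ _ _)) (node x′ l′ r′@(node _ _ _)) sz eq fl = same (enc-injective r r′) (fl z<s) (enc-injective l l′ m≡ left-eq (λ i<m → trans (sym (flags-left x l r i<m))
    (trans (fl (s≤s (≤-trans i<m (m≤m+n _ _)))) (flags-left x′ l′ r′ (<-≤-trans i<m (≤-reflexive m≡))))))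
  where
  m≡ : size l ≡ size l′
  m≡ = glue-offset (enc-labelling r) (enc-labelling r′) eq
  left-eq : ∀ i → enc l i ≡ enc l′ i
  left-eq i with i <? size l
  ... | yes i<m = suc-injective (trans (sym (glue-left (enc l) (enc r) i<m)) (trans (eq (suc i))
    (glue-left (enc l′) (enc r′) (<-≤-trans i<m (≤-reflexive m≡)))))
  ... | no i≮m = trans (outside (enc-labelling l) (≮⇒≥ i≮m))
    (sym (outside (enc-labelling l′) (≤-trans (≤-reflexive (sym m≡)) (≮⇒≥ i≮m))))
  same : (size r ≡ size r′ → (∀ i → enc r i ≡ enc r′ i) → (∀ {i} → i < size r → flags r i ≡ flags r′ i) → r ≡ r′) →
    x ≡ x′ → l ≡ l′ → node x l r ≡ node x′ l′ r′
  same rec refl refl = cong (node x l) (rec (+-cancelˡ-≡ (size l) _ _ (suc-injective sz))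
      (λ j → graft-injective (size l) (trans (sym (glue-right (size l) (enc l) (enc r) j))
        (trans (eq (suc (size l + j))) (glue-right (size l) (enc l) (enc r′) j))))
      (λ {j} j<k → trans (sym (flags-right x l r j)) (trans (fl (s≤s (+-monoʳ-< (size l) j<k))) (flags-right x l r′ j))))

-- The join computed along the tree

stitch : Bool → (ℕ → ℕ) → ℕ → ℕ → ℕ
stitch b h i = if b then merge h i (suc i) else h

module _ {n h} (H : IsLabelling n h) where

  stitch-labelling : ∀ b {i} → suc i < n → IsLabelling n (stitch b h i)
  stitch-labelling false 1+i<n = H
  stitch-labelling true {i} 1+i<n = merge-labelling H (<-trans (n<1+n i) 1+i<n) 1+i<n

  stitch-⊒ : ∀ b {i} → h ⊑ stitch b h i
  stitch-⊒ false = idempotent H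
  stitch-⊒ true = merge-⊒ H

  stitch-⊑ : ∀ b {i g} → h ⊑ g → (b ≡ true → g i ≡ g (suc i)) → stitch b h i ⊑ g
  stitch-⊑ false h⊑g eq = h⊑g
  stitch-⊑ true {g = g} h⊑g eq = merge-⊑ H {h = g} h⊑g (eq refl)

  stitch-joins : ∀ b {i} → b ≡ true → stitch b h i i ≡ stitch b h i (suc i)
  stitch-joins true _ = merge-joins H

  stitch-blocks : ∀ b {i} → suc i < n →
    blocks (stitch b h i) n + bit b ≡ blocks h n + bit (b ∧ does (h i ≟ h (suc i)))
  stitch-blocks false _ = refl
  stitch-blocks true {i} 1+i<n = case (h i ≟ h (suc i))
    where
    case : Dec (h i ≡ h (suc i)) → blocks (merge h i (suc i)) n + 1 ≡ blocks h n + bit (does (h i ≟ h (suc i)))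
    case (yes eq) = cong₂ _+_ (blocks-cong n (merge-same H eq)) (cong bit (sym (dec-true (h i ≟ h (suc i)) eq)))
    case (no neq) = trans (+-comm _ 1) (trans (sym (merge-blocks H (<-trans (n<1+n i) 1+i<n) 1+i<n neq))
      (trans (sym (+-identityʳ _)) (cong (blocks h n +_) (cong bit (sym (dec-false (h i ≟ h (suc i)) neq))))))

  -- Only labels equal to `h i` or `h (suc i)` change, and these are at most `suc i`.
  stitch-far : ∀ b {i j} → suc i < h j → stitch b h i j ≡ h j
  stitch-far false _ = refl
  stitch-far true {i} {j} far with h i ≤? h (suc i)
  ... | yes _ = redirect-miss h (h i) λ eq → <⇒≢ (≤-<-trans (decreasing H (suc i)) far) (sym eq)
  ... | no _  = redirect-miss h (h (suc i)) λ eq →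
    <⇒≢ (≤-<-trans (decreasing H i) (<-trans (n<1+n i) far)) (sym eq)

  -- When 1 is the minimum of its block, stitching at 0 moves exactly that block to 0.
  stitch-1 : ∀ b {j v} → h 1 ≡ 1 → h j ≡ suc v → does (stitch b h 0 j ≟ 0) ≡ b ∧ does (v ≟ 0)
  stitch-1 false {j} {v} h1 hj = dec-false (h j ≟ 0) λ eq → 0≢1+n (trans (sym eq) hj)
  stitch-1 true {j} {v} h1 hj with h 0 ≤? h 1
  ... | no nle = contradiction (subst (_≤ h 1) (sym (minimum-0 H)) z≤n) nle
  ... | yes _ = case (v ≟ 0)
    where
    case : Dec (v ≡ 0) → does (redirect h (h 1) (h 0) j ≟ 0) ≡ does (v ≟ 0)
    case (yes refl) = dec-true (_ ≟ 0) (trans (redirect-hit h (h 0) (trans hj (sym h1))) (minimum-0 H))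
    case (no v≢0) = trans (dec-false (_ ≟ 0) λ eq → 0≢1+n (trans (sym eq)
      (trans (redirect-miss h (h 0) λ eq′ → v≢0 (suc-injective (trans (sym hj) (trans eq′ h1)))) hj)))
      (sym (dec-false (v ≟ 0) v≢0))

joinedLeaf : Bool → Tree → (ℕ → ℕ) → ℕ → ℕ
joinedLeaf x nil            h = id
joinedLeaf x (node _ _ _)   h = stitch x (above h) 0

-- The join of the partition enc t with the interval partition cut out by flags t.
joined : Tree → ℕ → ℕ
joined nil                       = id
joined (node x l nil)            = joinedLeaf x l (joined l)
joined (node x l r@(node _ _ _)) =
  stitch (flags (node x l r) (size l)) (stitch x (glue (size l) (joined l) (joined r)) 0) (size l)

-- A universal property, so that the recursive `joined` can be identified with the iterated `join`.
-- The bound `suc i < size t` keeps the spare flag of the last element from linking anything.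
record IsJoin (t : Tree) (h : ℕ → ℕ) : Set where
  field
    labelling : IsLabelling (size t) h
    contains  : enc t ⊑ h
    respects  : ∀ {i} → suc i < size t → flags t i ≡ true → h i ≡ h (suc i)
    least     : ∀ {g} → enc t ⊑ g → (∀ {i} → suc i < size t → flags t i ≡ true → g i ≡ g (suc i)) → h ⊑ g

open IsJoin

id-isJoin : ∀ t → size t ≤ 1 → enc t ⊑ id → IsJoin t id
id-isJoin t ≤1 sub = record
  { labelling = record { decreasing = λ _ → ≤-refl ; idempotent = λ _ → refl ; outside = λ _ → refl }
  ; contains = sub
  ; respects = λ lt → contradiction (≤-trans lt ≤1) λ { (s≤s ()) }
  ; least = λ _ _ _ → refl
  }

leaf-isJoin : ∀ x l {h} → 0 < size l → IsJoin l h → IsJoin (node x l nil) (stitch x (above h) 0)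
leaf-isJoin x l {h} 0<m J = record
  { labelling = subst (λ n → IsLabelling n (stitch x (above h) 0)) (sym (size-leaf x l))
      (stitch-labelling A x (s≤s 0<m))
  ; contains = ⊑-trans {above (enc l)} {above h} {s} (above-⊑ {f = enc l} {h} (contains J)) up
  ; respects = λ {i} lt → resp i (subst (suc i <_) (size-leaf x l) lt)
  ; least = λ {g} sub resp → stitch-⊑ A x {g = g}
      (λ { zero → refl
         ; (suc i) → least J {g ∘ suc} (sub ∘ suc)
             (λ {i} lt fl → resp (s≤s (<-≤-trans lt (m≤m+n _ 0))) (trans (flags-left x l nil (<-trans (n<1+n i) lt)) fl)) i })
      (λ x≡ → resp (s≤s (<-≤-trans 0<m (m≤m+n _ 0))) x≡)
  }
  where
  A = above-labelling (labelling J)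
  s = stitch x (above h) 0
  up : above h ⊑ s
  up = stitch-⊒ A x {0}
  resp : ∀ i → suc i < suc (size l) → flags (node x l nil) i ≡ true → s i ≡ s (suc i)
  resp zero    _        fl = stitch-joins A x fl
  resp (suc i) (s≤s lt) fl = ⊑⇒≡ {above h} {s} up (cong suc (respects J lt
    (trans (sym (flags-left x l nil (<-trans (n<1+n i) lt))) fl)))

-- The links of the tree are those inside `l`, those inside `r`, the one at 0, and the one at `m`
-- from the last element of `l` to the first of `r` (the link at 0 again if `l` is empty). Gluing
-- takes care of the first two kinds, the stitches of the others.
node-isJoin : ∀ x l r {f g} → 0 < size r → enc (node x l r) ≡ glue (size l) (enc l) (enc r) →
  IsJoin l f → IsJoin r g →
  IsJoin (node x l r) (stitch (flags (node x l r) (size l)) (stitch x (glue (size l) f g) 0) (size l))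
node-isJoin x l r {f} {g} 0<k enc≡ L R = record
  { labelling = stitch-labelling H₁ y 1+m<n
  ; contains = subst (_⊑ h₂) (sym enc≡) (⊑-trans {glue m (enc l) (enc r)} {h₀} {h₂}
      (glue-⊑ (enc-labelling l) (labelling R) (contains L) (contains R)) up)
  ; respects = λ {i} → resp i
  ; least = λ {q} sub resp → stitch-⊑ H₁ y {g = q} (stitch-⊑ H₀ x {g = q} (low q (subst (_⊑ q) enc≡ sub) resp)
      (resp 1<n)) (resp 1+m<n)
  }
  where
  m = size l
  k = size r
  t = node x l r
  y = flags t m
  h₀ = glue m f g
  h₁ = stitch x h₀ 0
  h₂ = stitch y h₁ m
  1<n : 1 < suc (m + k)
  1<n = s≤s (<-≤-trans 0<k (m≤n+m k m))
  1+m<n : suc m < suc (m + k)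
  1+m<n = s≤s (m<m+n m 0<k)
  H₀ = glue-labelling 0<k (labelling L) (labelling R)
  H₁ = stitch-labelling H₀ x 1<n
  up₁ : h₀ ⊑ h₁
  up₁ = stitch-⊒ H₀ x {0}
  up₂ : h₁ ⊑ h₂
  up₂ = stitch-⊒ H₁ y {m}
  up : h₀ ⊑ h₂
  up = ⊑-trans {h₀} {h₁} {h₂} up₁ up₂
  resp : ∀ i → suc i < suc (m + k) → flags t i ≡ true → h₂ i ≡ h₂ (suc i)
  resp zero _ fl = ⊑⇒≡ {h₁} {h₂} up₂ (stitch-joins H₀ x fl)
  resp (suc i) (s≤s lt) fl with split m i
  ... | right j = ⊑⇒≡ {h₀} {h₂} up (trans (glue-right m f g j) (trans (cong (graft m)
    (respects R (+-cancelˡ-< m _ _ (subst (_< m + k) (sym (+-suc m j)) lt)) (trans (sym (flags-right x l r j)) fl)))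
    (trans (sym (glue-right m f g (suc j))) (cong (h₀ ∘ suc) (+-suc m j)))))
  ... | left i<m with m≤n⇒m<n∨m≡n i<m
  ...   | inj₁ 1+i<m = ⊑⇒≡ {h₀} {h₂} up (trans (glue-left f g i<m) (trans (cong suc
    (respects L 1+i<m (trans (sym (flags-left x l r i<m)) fl))) (sym (glue-left f g 1+i<m))))
  ...   | inj₂ 1+i≡m = subst (λ i → h₂ i ≡ h₂ (suc i)) (sym 1+i≡m)
    (stitch-joins H₁ y (trans (cong (flags t) (sym 1+i≡m)) fl))
  low : ∀ q → glue m (enc l) (enc r) ⊑ q →
    (∀ {i} → suc i < suc (m + k) → flags t i ≡ true → q i ≡ q (suc i)) → h₀ ⊑ q
  low q sub resp zero = refl
  low q sub resp (suc i) with split m i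
  ... | left i<m = trans (cong q (glue-left f g i<m)) (least L {q ∘ suc} sub-l
    (λ {i} lt fl → resp (s≤s (<-≤-trans lt (m≤m+n m k))) (trans (flags-left x l r (<-trans (n<1+n i) lt)) fl)) i)
    where
    sub-l : enc l ⊑ q ∘ suc
    sub-l i with i <? m
    ... | no i≮m  = cong (q ∘ suc) (outside (enc-labelling l) (≮⇒≥ i≮m))
    ... | yes i<m = trans (cong q (sym (glue-left (enc l) (enc r) i<m))) (sub (suc i))
  ... | right j = trans (cong q (glue-right m f g j)) (trans (q-graft (g j)) (least R {λ j → q (suc (m + j))} sub-r
    (λ {j} lt fl → trans (resp (s≤s (subst (_< m + k) (+-suc m j) (+-monoʳ-< m lt))) (trans (flags-right x l r j) fl))
      (cong (q ∘ suc) (sym (+-suc m j)))) j))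
    where
    q-graft : ∀ j → q (graft m j) ≡ q (suc (m + j))
    q-graft (suc j) = refl
    q-graft zero = trans (cong q (sym (glue-next m (enc l) (enc-labelling r))))
      (trans (sub (suc m)) (cong (q ∘ suc) (sym (+-identityʳ m))))
    sub-r : enc r ⊑ λ j → q (suc (m + j))
    sub-r j = trans (sym (q-graft (enc r j))) (trans (cong q (sym (glue-right m (enc l) (enc r) j))) (sub (suc (m + j))))

joined-isJoin : ∀ t → IsJoin t (joined t)
joined-isJoin nil = id-isJoin nil z≤n λ _ → refl
joined-isJoin (node x nil nil) = id-isJoin (node x nil nil) ≤-refl λ { zero → refl ; (suc i) → refl }
joined-isJoin (node x l@(node _ _ _) nil) = leaf-isJoin x l z<s (joined-isJoin l)
joined-isJoin (node x l r@(node _ _ _)) = node-isJoin x l r z<s refl (joined-isJoin l) (joined-isJoin r)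

isJoin-unique : ∀ {t f g} → IsJoin t f → IsJoin t g → ∀ i → f i ≡ g i
isJoin-unique {f = f} {g} F G = ⊑-antisym (labelling F) (labelling G)
  (least F {g} (contains G) (respects G)) (least G {f} (contains F) (respects F))

join-isJoin : ∀ t {k} → size t ≡ suc k → ∀ {S f} → (∀ i → enc t i ≡ f i) →
  (∀ {i} → i < size t → flags t i ≡ S i) → IsLabelling (suc k) f → IsJoin t (join k S f)
join-isJoin t {k} t≡ {S} {f} enc≗ flags≗ F = record
  { labelling = subst (λ n → IsLabelling n (join k S f)) (sym t≡) (join-labelling F S k (n<1+n k))
  ; contains = λ i → trans (cong (join k S f) (enc≗ i)) (join-⊒ F S k (n<1+n k) i)
  ; respects = λ {i} lt fl → join-respects F S k (n<1+n k) (s≤s⁻¹ (<-≤-trans lt (≤-reflexive t≡)))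
      (trans (sym (flags≗ (<-trans (n<1+n i) lt))) fl)
  ; least = λ {g} sub resp → join-⊑ F S k (n<1+n k) {g} (λ i → trans (cong g (sym (enc≗ i))) (sub i))
      λ i<k Si → resp (<-≤-trans (s≤s i<k) (≤-reflexive (sym t≡)))
        (trans (flags≗ (<-≤-trans (m<n⇒m<1+n i<k) (≤-reflexive (sym t≡)))) Si)
  }

lastOr : Bool → Tree → Bool
lastOr b nil          = b
lastOr b (node x l r) = lastOr (lastOr x l) r

-- Whether the last flag is set and the join connects the first and the last element
-- (linked-joined). For nil the value is a convention that lets joinBlocks-node
-- cover an empty left subtree.
linked : Tree → Bool
linked nil                       = true
linked (node x l nil)            = x ∧ linked l
linked (node x l r@(node _ _ _)) = linked r

flags-last : ∀ b t {n} → size t ≡ suc n → flags t n ≡ lastOr b t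
flags-last b (node x nil nil) refl = refl
flags-last b (node x l@(node _ _ _) nil) refl =
  trans (cong (flags (node x l nil)) (+-identityʳ (size l)))
    (trans (flags-left x l nil ≤-refl) (flags-last x l refl))
flags-last b (node x l r@(node _ _ _)) refl = trans (cong (flags (node x l r)) (+-suc (size l) _))
  (trans (flags-right x l r _) (flags-last (lastOr x l) r refl))

last-stitch : ∀ x l {n h j} → size l ≡ suc n → IsLabelling j h → h 1 ≡ suc (joined l 0) → h (suc n) ≡ suc (joined l n) →
  linked l ≡ lastOr false l ∧ does (joined l n ≟ 0) →
  x ∧ linked l ≡ lastOr false l ∧ does (stitch x h 0 (suc n) ≟ 0)
last-stitch x l {n} {h} l≡ H h1 hn eq = begin
  x ∧ linked l                                    ≡⟨ cong (x ∧_) eq ⟩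
  x ∧ (y ∧ e)                                     ≡⟨ ∧-assoc x y e ⟨
  (x ∧ y) ∧ e                                     ≡⟨ cong (_∧ e) (∧-comm x y) ⟩
  (y ∧ x) ∧ e                                     ≡⟨ ∧-assoc y x e ⟩
  y ∧ (x ∧ e)                                     ≡⟨ cong (y ∧_) (sym (stitch-1 H x
                                                       (trans h1 (cong suc (minimum-0 (labelling (joined-isJoin l))))) hn)) ⟩
  y ∧ does (stitch x h 0 (suc n) ≟ 0)             ∎
  where
  open ≡-Reasoning
  y = lastOr false l
  e = does (joined l n ≟ 0)

-- With a nonempty `r`, 0 lies in the block of the first element of `r`, and the stitches at 0 and
-- `size l` leave every label beyond `suc (size l)` alone; so the last element is connected to 0
-- exactly if `r` alone connects its ends. With `r` empty, 0 reaches `l` only through the flag `x`.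
linked-joined : ∀ t {n} → size t ≡ suc n → linked t ≡ lastOr false t ∧ does (joined t n ≟ 0)
linked-joined (node x nil nil) refl = refl
linked-joined (node x l@(node _ _ _) nil) refl = trans
  (last-stitch x l refl (above-labelling (labelling (joined-isJoin l))) refl refl (linked-joined l refl))
  (cong (λ i → lastOr false l ∧ does (stitch x (above (joined l)) 0 i ≟ 0)) (sym (+-identityʳ (size l))))
linked-joined (node x l r@(node _ p q)) refl = trans (linked-joined r refl)
  (cong (lastOr (lastOr x l) r ∧_) (sym (trans (cong (λ i → does (joined (node x l r) i ≟ 0)) (+-suc (size l) k))
    (case (g k) (glue-right m f g k)))))
  where
  m = size l
  k = size p + size q
  f = joined l
  g = joined r
  h₀ = glue m f g
  h₁ = stitch x h₀ 0
  y = flags (node x l r) m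
  H₀ = glue-labelling z<s (labelling (joined-isJoin l)) (labelling (joined-isJoin r))
  H₁ = stitch-labelling H₀ x (s≤s (<-≤-trans z<s (m≤n+m _ m)))
  case : ∀ v → h₀ (suc (m + k)) ≡ graft m v → does (stitch y h₁ m (suc (m + k)) ≟ 0) ≡ does (v ≟ 0)
  case zero eq = dec-true (_ ≟ 0) (begin
    h₂ (suc (m + k))      ≡⟨ contains₂ (suc (m + k)) ⟨
    h₂ (h₀ (suc (m + k))) ≡⟨ cong h₂ eq ⟩
    h₂ 0                  ≡⟨ minimum-0 (labelling (joined-isJoin (node x l r))) ⟩
    0                     ∎)
    where
    open ≡-Reasoning
    h₂ = stitch y h₁ m
    contains₂ : h₀ ⊑ h₂
    contains₂ = ⊑-trans {h₀} {h₁} {h₂} (stitch-⊒ H₀ x {0}) (stitch-⊒ H₁ y {m})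
  case (suc v) eq = dec-false (_ ≟ 0) λ eq₂ → 0≢1+n (trans (sym eq₂) (trans (stitch-far H₁ y
    (subst (suc m <_) (sym (trans h₁≡ eq)) far)) (trans h₁≡ eq)))
    where
    far : suc m < suc (m + suc v)
    far = s≤s (m<m+n m z<s)
    h₁≡ : h₁ (suc (m + k)) ≡ h₀ (suc (m + k))
    h₁≡ = stitch-far H₀ x (subst (1 <_) (sym eq) (s≤s (<-≤-trans z<s (m≤n+m (suc v) m))))

-- Block counts and the distance as a tree recursion

joinBlocks encBlocks gaps : Tree → ℕ
joinBlocks t = blocks (joined t) (size t)
encBlocks t = blocks (enc t) (size t)
gaps t = count (not ∘ flags t) (size t)

joinBlocks-leaf : ∀ x l → 0 < size l → joinBlocks (node x l nil) + bit x ≡ suc (joinBlocks l)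
joinBlocks-leaf x l@(node _ _ _) _ = begin
  blocks s (size (node x l nil)) + bit x ≡⟨ cong (λ n → blocks s n + bit x) (size-leaf x l) ⟩
  blocks s (suc (size l)) + bit x        ≡⟨ stitch-blocks H x (s≤s z<s) ⟩
  blocks h (suc (size l)) + bit (x ∧ false) ≡⟨ cong₂ _+_ (blocks-above (joined l) (size l)) (cong bit (∧-comm x false)) ⟩
  suc (joinBlocks l) + 0                 ≡⟨ +-identityʳ _ ⟩
  suc (joinBlocks l)                     ∎
  where
  open ≡-Reasoning
  h = above (joined l)
  H = above-labelling (labelling (joined-isJoin l))
  s = stitch x h 0

-- The first flag attaches the start of `l` to the block of 0, the last flag of `l` attaches its
-- end. Each attachment loses a block, except that the second loses none when the first has already
-- brought the end along, that is, when `x ∧ linked l` holds.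
joinBlocks-node : ∀ x l r → 0 < size r →
  joinBlocks (node x l r) + (bit x + bit (lastOr false l)) ≡ joinBlocks l + joinBlocks r + bit (x ∧ linked l)
joinBlocks-node x l r@(node _ p q) _ = begin
  blocks h₂ n + (bit x + bit z)           ≡⟨ cong (blocks h₂ n +_) (+-comm (bit x) (bit z)) ⟩
  blocks h₂ n + (bit z + bit x)           ≡⟨ +-assoc (blocks h₂ n) (bit z) (bit x) ⟨
  blocks h₂ n + bit z + bit x             ≡⟨ final l refl ⟩
  blocks h₀ n + bit (x ∧ linked l)        ≡⟨ cong (_+ bit (x ∧ linked l)) (blocks-glue m f (labelling (joined-isJoin r))) ⟩
  joinBlocks l + joinBlocks r + bit (x ∧ linked l) ∎
  where
  open ≡-Reasoning
  m = size l
  n = size (node x l r)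
  f = joined l
  g = joined r
  h₀ = glue m f g
  h₁ = stitch x h₀ 0
  y = flags (node x l r) m
  z = lastOr false l
  h₂ = stitch y h₁ m
  G = labelling (joined-isJoin r)
  1<n : 1 < n
  1<n = s≤s (<-≤-trans z<s (m≤n+m _ m))
  H₀ = glue-labelling z<s (labelling (joined-isJoin l)) G
  H₁ = stitch-labelling H₀ x 1<n

  h₁-next : h₁ (suc m) ≡ 0
  h₁-next = trans (sym (stitch-⊒ H₀ x {0} (suc m))) (trans (cong h₁ (glue-next m f G)) (minimum-0 H₁))

  first-step : blocks h₁ n + bit x ≡ blocks h₀ n + bit (x ∧ does (0 ≟ h₀ 1))
  first-step = stitch-blocks H₀ x 1<n

  second-step : blocks h₂ n + bit y ≡ blocks h₁ n + bit (y ∧ does (h₁ m ≟ 0))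
  second-step = trans (stitch-blocks H₁ y (s≤s (m<m+n m z<s)))
    (cong (λ v → blocks h₁ n + bit (y ∧ does (h₁ m ≟ v))) h₁-next)

  final : ∀ l′ → l ≡ l′ → blocks h₂ n + bit z + bit x ≡ blocks h₀ n + bit (x ∧ linked l)
  -- Both stitches act on the link at 0, which the gluing already contains, so neither loses a
  -- block. The value `linked nil = true` expresses this.
  final nil refl = begin
    blocks h₂ n + 0 + bit x       ≡⟨ cong (_+ bit x) (+-identityʳ _) ⟩
    blocks h₂ n + bit x           ≡⟨ second-step ⟩
    blocks h₁ n + bit (x ∧ does (h₁ 0 ≟ 0))
      ≡⟨ cong (λ b → blocks h₁ n + bit b) (trans (cong (x ∧_) (dec-true (h₁ 0 ≟ 0) (minimum-0 H₁))) (∧-identityʳ x)) ⟩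
    blocks h₁ n + bit x           ≡⟨ first-step ⟩
    blocks h₀ n + bit (x ∧ does (0 ≟ h₀ 1)) ≡⟨ cong (λ v → blocks h₀ n + bit (x ∧ does (0 ≟ v))) (glue-next 0 f G) ⟩
    blocks h₀ n + bit (x ∧ true)  ∎
  final (node w a b) refl = begin
    blocks h₂ n + bit z + bit x   ≡⟨ cong (λ c → blocks h₂ n + bit c + bit x) (sym y≡z) ⟩
    blocks h₂ n + bit y + bit x   ≡⟨ cong (_+ bit x) second-step ⟩
    blocks h₁ n + bit (y ∧ does (h₁ m ≟ 0)) + bit x
      ≡⟨ cong (λ c → blocks h₁ n + bit c + bit x) (trans (cong (_∧ does (h₁ m ≟ 0)) y≡z) (sym
           (last-stitch x l refl H₀ (glue-left {size l} f g z<s) (glue-left {size l} f g ≤-refl) (linked-joined l refl)))) ⟩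
    blocks h₁ n + bit (x ∧ linked l) + bit x  ≡⟨ +-assoc (blocks h₁ n) _ _ ⟩
    blocks h₁ n + (bit (x ∧ linked l) + bit x) ≡⟨ cong (blocks h₁ n +_) (+-comm (bit (x ∧ linked l)) (bit x)) ⟩
    blocks h₁ n + (bit x + bit (x ∧ linked l)) ≡⟨ +-assoc (blocks h₁ n) _ _ ⟨
    blocks h₁ n + bit x + bit (x ∧ linked l) ≡⟨ cong (_+ bit (x ∧ linked l)) (trans first-step
      (trans (cong (λ v → blocks h₀ n + bit (x ∧ does (0 ≟ v))) (glue-left {size l} f g z<s))
        (trans (cong (λ c → blocks h₀ n + bit c) (∧-comm x false)) (+-identityʳ _)))) ⟩
    blocks h₀ n + bit (x ∧ linked l) ∎
    where
    y≡z : y ≡ z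
    y≡z = trans (flags-left x l r ≤-refl) (flags-last false l refl)

encBlocks-leaf : ∀ x l → encBlocks (node x l nil) ≡ suc (encBlocks l)
encBlocks-leaf x l = trans (cong (blocks (above (enc l))) (size-leaf x l)) (blocks-above (enc l) (size l))

encBlocks-node : ∀ x l r → 0 < size r → encBlocks (node x l r) ≡ encBlocks l + encBlocks r
encBlocks-node x l r@(node _ _ _) _ = blocks-glue (size l) (enc l) (enc-labelling r)

gaps-node : ∀ x l r → gaps (node x l r) ≡ bit (not x) + (gaps l + gaps r)
gaps-node x l r = trans (count-+ _ 1 (size l + size r)) (cong (bit (not x) +_)
  (trans (count-+ _ (size l) (size r)) (cong₂ _+_
    (count-cong (size l) λ i<m → cong not (flags-left x l r i<m))
    (count-cong (size r) λ {j} _ → cong not (flags-right x l r j)))))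

-- If `l` is empty too, `x` is the spare bit and costs nothing.
leafStep : Bool → Tree → ℕ
leafStep x nil          = 0
leafStep x (node _ _ _) = bit x

-- Cost of the root flag: an absent link adds a block to π, a link removes one from the join and so
-- counts 2, and a link that closes a cycle removes none.
nodeStep : Bool → Bool → ℕ
nodeStep false _     = 1
nodeStep true  false = 2
nodeStep true  true  = 0

-- |π| + |ρ| - 2 |π ∨ ρ| for ρ = enc t and π cut out by flags t.
δ : Tree → ℕ
δ nil                       = 0
δ (node x l nil)            = δ l + leafStep x l
δ (node x l r@(node _ _ _)) = δ l + δ r + (nodeStep x (linked l) + bit (lastOr false l))

bit-not : ∀ x → bit (not x) + bit x ≡ 1
bit-not false = refl
bit-not true = refl

nodeStep-≡ : ∀ x a → nodeStep x a + 2 * bit (x ∧ a) ≡ bit (not x) + 2 * bit x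
nodeStep-≡ false _ = refl
nodeStep-≡ true false = refl
nodeStep-≡ true true = refl

-- The first two summands on the right count the blocks of π. In a node the last flag of `l`, spare
-- inside `l`, becomes a genuine link: if set, it lowers the count for π by one and that of the join
-- by one, which explains the net summand `bit (lastOr false l)` of `δ`.
δ-joinBlocks : ∀ t → δ t + 2 * joinBlocks t ≡ (gaps t + bit (lastOr false t)) + encBlocks t
δ-joinBlocks nil = refl
δ-joinBlocks (node false nil nil) = refl
δ-joinBlocks (node true nil nil) = refl
δ-joinBlocks (node x l@(node _ _ _) nil) = +-cancelʳ-≡ (2 * bit x) _ _ (begin
  δ l + bit x + 2 * J + 2 * bit x
    ≡⟨ solve 3 (λ d b j → d :+ b :+ con 2 :* j :+ con 2 :* b := d :+ b :+ con 2 :* (j :+ b)) refl (δ l) (bit x) J ⟩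
  δ l + bit x + 2 * (J + bit x)
    ≡⟨ cong (λ j → δ l + bit x + 2 * j) (joinBlocks-leaf x l z<s) ⟩
  δ l + bit x + 2 * suc (joinBlocks l)
    ≡⟨ solve 3 (λ d b j → d :+ b :+ con 2 :* (con 1 :+ j) := (d :+ con 2 :* j) :+ b :+ con 2) refl (δ l) (bit x) (joinBlocks l) ⟩
  (δ l + 2 * joinBlocks l) + bit x + 2
    ≡⟨ cong₂ (λ s b → s + bit x + 2 * b) (δ-joinBlocks l) (sym (bit-not x)) ⟩
  (gaps l + y + encBlocks l) + bit x + 2 * (bit (not x) + bit x)
    ≡⟨ solve 5 (λ g y e b nb → (g :+ y :+ e) :+ b :+ con 2 :* (nb :+ b) := (nb :+ (g :+ con 0)) :+ y :+ ((nb :+ b) :+ e) :+ con 2 :* b)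
         refl (gaps l) y (encBlocks l) (bit x) (bit (not x)) ⟩
  (bit (not x) + (gaps l + 0)) + y + ((bit (not x) + bit x) + encBlocks l) + 2 * bit x
    ≡⟨ cong₂ (λ g e → g + y + e + 2 * bit x) (sym (gaps-node x l nil))
         (trans (cong (_+ encBlocks l) (bit-not x)) (sym (encBlocks-leaf x l))) ⟩
  gaps t + y + encBlocks t + 2 * bit x ∎)
  where
  open ≡-Reasoning
  open +-*-Solver
  t = node x l nil
  J = joinBlocks t
  y = bit (lastOr false l)
δ-joinBlocks (node x l r@(node _ _ _)) = +-cancelʳ-≡ (2 * (bit x + y) + 2 * a) _ _ (begin
  δ l + δ r + (s + y) + 2 * J + (2 * (bit x + y) + 2 * a)
    ≡⟨ solve 7 (λ dl dr s y j b a → dl :+ dr :+ (s :+ y) :+ con 2 :* j :+ (con 2 :* (b :+ y) :+ con 2 :* a) :=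
         dl :+ dr :+ (s :+ con 2 :* a :+ y) :+ con 2 :* (j :+ (b :+ y))) refl (δ l) (δ r) s y J (bit x) a ⟩
  δ l + δ r + (s + 2 * a + y) + 2 * (J + (bit x + y))
    ≡⟨ cong₂ (λ s j → δ l + δ r + (s + y) + 2 * j) (nodeStep-≡ x (linked l)) (joinBlocks-node x l r z<s) ⟩
  δ l + δ r + (nb + 2 * bit x + y) + 2 * (joinBlocks l + joinBlocks r + a)
    ≡⟨ solve 8 (λ dl dr nb b y jl jr a → dl :+ dr :+ (nb :+ con 2 :* b :+ y) :+ con 2 :* (jl :+ jr :+ a) :=
         (dl :+ con 2 :* jl) :+ (dr :+ con 2 :* jr) :+ (nb :+ con 2 :* b :+ y :+ con 2 :* a)) refl
         (δ l) (δ r) nb (bit x) y (joinBlocks l) (joinBlocks r) a ⟩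
  (δ l + 2 * joinBlocks l) + (δ r + 2 * joinBlocks r) + (nb + 2 * bit x + y + 2 * a)
    ≡⟨ cong₂ (λ p q → p + q + (nb + 2 * bit x + y + 2 * a)) (δ-joinBlocks l) (δ-joinBlocks r) ⟩
  (gaps l + y + encBlocks l) + (gaps r + yr + encBlocks r) + (nb + 2 * bit x + y + 2 * a)
    ≡⟨ solve 9 (λ gl y el gr yr er nb b a → (gl :+ y :+ el) :+ (gr :+ yr :+ er) :+ (nb :+ con 2 :* b :+ y :+ con 2 :* a) :=
         (nb :+ (gl :+ gr)) :+ yr :+ (el :+ er) :+ (con 2 :* (b :+ y) :+ con 2 :* a)) refl
         (gaps l) y (encBlocks l) (gaps r) yr (encBlocks r) nb (bit x) a ⟩
  (nb + (gaps l + gaps r)) + yr + (encBlocks l + encBlocks r) + (2 * (bit x + y) + 2 * a)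
    ≡⟨ cong₂ (λ g e → g + yr + e + (2 * (bit x + y) + 2 * a)) (sym (gaps-node x l r)) (sym (encBlocks-node x l r z<s)) ⟩
  gaps t + yr + encBlocks t + (2 * (bit x + y) + 2 * a) ∎)
  where
  open ≡-Reasoning
  open +-*-Solver
  t = node x l r
  J = joinBlocks t
  y = bit (lastOr false l)
  yr = bit (lastOr false r)
  a = bit (x ∧ linked l)
  s = nodeStep x (linked l)
  nb = bit (not x)

-- Pairs of partitions and flagged trees

∈-interval⁺ : ∀ {n} {p q i : Fin n} → p Fin.≤ i → i Fin.≤ q → i ∈ interval p q
∈-interval⁺ {p = p} {q} {i} p≤i i≤q = lookup⇒[]= i _ (trans (lookup∘tabulate _ i)
  (dec-true (p Fin.≤? i ×-dec i Fin.≤? q) (p≤i , i≤q)))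

∈-interval⁻ : ∀ {n} {p q i : Fin n} → i ∈ interval p q → p Fin.≤ i × i Fin.≤ q
∈-interval⁻ {p = p} {q} {i} i∈ = does⇒ (p Fin.≤? i ×-dec i Fin.≤? q)
  (trans (sym (lookup∘tabulate _ i)) ([]=⇒lookup i∈))

Convex : (ℕ → ℕ) → Set
Convex f = ∀ {a b c} → a ≤ b → b ≤ c → f a ≡ f c → f b ≡ f a

interval⇒convex : ∀ {n} (π : NC n) → IsInterval π → Convex (label π)
interval⇒convex {n} π int {a} {b} {c} a≤b b≤c ac with position n a | position n b | position n c
... | _ | _ | beyond n≤c = convex-end (≤-antisym (≤-trans a≤b b≤c) (subst₂ _≤_ (trans ac (label-outside π n≤c)) refl
    (decreasing (label-labelling π) a)))
  where
  convex-end : a ≡ c → label π b ≡ label π a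
  convex-end refl = cong (label π) (≤-antisym b≤c a≤b)
... | beyond n≤a | _ | within c = contradiction (Fin.toℕ<n c) (≤⇒≯ (≤-trans n≤a (≤-trans a≤b b≤c)))
... | within a | beyond n≤b | within c = contradiction (Fin.toℕ<n c) (≤⇒≯ (≤-trans n≤b b≤c))
... | within a | within b | within c with All.lookup⁺ int a
...   | p , q , p≤q , V≡ = sym (∈⇒label π (subst (b ∈_) (sym V≡) (∈-interval⁺ {p = p} {q} {b}
  (≤-trans (proj₁ (∈-interval⁻ {p = p} {q} {a} (subst (a ∈_) V≡ (∈-block π a)))) a≤b)
  (≤-trans b≤c (proj₂ (∈-interval⁻ {p = p} {q} {c} (subst (c ∈_) V≡ (label⇒∈ π {a} {c} ac))))))))

-- The search follows the block of `i` until the label first changes; by convexity the label never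
-- returns.
last-in-block : ∀ {n} (π : NC n) → Convex (label π) → (i : Fin n) →
  ∃ λ q → toℕ i ≤ toℕ q × label π (toℕ q) ≡ label π (toℕ i) ×
    (∀ {j} → label π j ≡ label π (toℕ i) → j ≤ toℕ q)
last-in-block {n} π conv i with search (λ e → ¬? (label π (suc (toℕ i + e)) ≟ label π (toℕ i))) n
... | inj₁ none = contradiction (≤-trans (≤-reflexive (trans (sym (label-outside π n≤)) same))
    (decreasing (label-labelling π) (toℕ i))) (<⇒≱ (≤-<-trans (m≤m+n (toℕ i) (pred n)) (n<1+n _)))
  where
  0<n : 0 < n
  0<n = ≤-<-trans z≤n (Fin.toℕ<n i)
  pred-n : suc (pred n) ≡ n
  pred-n = suc-pred n ⦃ >-nonZero 0<n ⦄
  n≤ : n ≤ suc (toℕ i + pred n)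
  n≤ = ≤-trans (≤-reflexive (sym pred-n)) (s≤s (m≤n+m (pred n) (toℕ i)))
  same : label π (suc (toℕ i + pred n)) ≡ label π (toℕ i)
  same = decidable-stable (_ ≟ _) (none (≤-reflexive pred-n))
... | inj₂ (e , e<n , differs , before) = at (position n (toℕ i + e)) refl
  where
  same : ∀ e → (∀ {j} → j < e → ¬ ¬ label π (suc (toℕ i + j)) ≡ label π (toℕ i)) → label π (toℕ i + e) ≡ label π (toℕ i)
  same zero    _ = cong (label π) (+-identityʳ (toℕ i))
  same (suc e) b = trans (cong (label π) (+-suc (toℕ i) e)) (decidable-stable (_ ≟ _) (b (n<1+n e)))
  at : ∀ {j} → Position n j → j ≡ toℕ i + e → ∃ λ q → toℕ i ≤ toℕ q × label π (toℕ q) ≡ label π (toℕ i) ×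
    (∀ {j} → label π j ≡ label π (toℕ i) → j ≤ toℕ q)
  at (beyond n≤j) refl = contradiction (≤-<-trans (≤-reflexive (trans (sym (label-outside π n≤j)) (same e before)))
    (≤-<-trans (decreasing (label-labelling π) (toℕ i)) (Fin.toℕ<n i))) (≤⇒≯ n≤j)
  at (within q) q≡ = q , ≤-trans (m≤m+n (toℕ i) e) (≤-reflexive (sym q≡)) , trans (cong (label π) q≡) (same e before) ,
    λ {j} j~i → ≮⇒≥ λ q<j → differs (trans (cong (label π ∘ suc) (sym q≡))
      (conv (≤-trans (m≤m+n (toℕ i) e) (≤-trans (≤-reflexive (sym q≡)) (n≤1+n _))) q<j (sym j~i)))

convex⇒interval : ∀ {n} (π : NC n) → Convex (label π) → IsInterval π
convex⇒interval {n} π conv = All.lookup⁻ block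
  where
  block : ∀ i → ∃₂ λ p q → p Fin.≤ q × lookup (value π) i ≡ interval p q
  block i with label-∈ π i | last-in-block π conv i
  ... | p , p≡ , p∈ | q , i≤q , q~i , last = p , q , ≤-trans p≤i i≤q , ⊆-antisym
      (λ {j} j∈ → ∈-interval⁺ {p = p} {q} {j}
        (≤-trans (≤-reflexive (trans p≡ (∈⇒label π j∈))) (decreasing (label-labelling π) (toℕ j)))
        (last (sym (∈⇒label π j∈))))
      (λ {j} j∈ → label⇒∈ π (sym (trans (conv (proj₁ (∈-interval⁻ {p = p} {q} {j} j∈)) (proj₂ (∈-interval⁻ {p = p} {q} {j} j∈))
        (trans p~i (sym q~i))) p~i)))
    where
    p~i : label π (toℕ p) ≡ label π (toℕ i)
    p~i = sym (∈⇒label π p∈)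
    p≤i : toℕ p ≤ toℕ i
    p≤i = ≤-trans (≤-reflexive p≡) (decreasing (label-labelling π) (toℕ i))

-- The labelling of the interval partition whose links are the set flags.
runs : (ℕ → Bool) → ℕ → ℕ
runs S zero    = zero
runs S (suc i) = if S i then runs S i else suc i

runs-cong : ∀ {S S′} i → (∀ {j} → j < i → S j ≡ S′ j) → runs S i ≡ runs S′ i
runs-cong zero    eq = refl
runs-cong {S} {S′} (suc i) eq rewrite eq (n<1+n i) | runs-cong {S} {S′} i (eq ∘ m<n⇒m<1+n) = refl

runs-≤ : ∀ S i → runs S i ≤ i
runs-≤ S zero = z≤n
runs-≤ S (suc i) with S i
... | true  = m≤n⇒m≤1+n (runs-≤ S i)
... | false = ≤-refl

runs-mono : ∀ S {i j} → i ≤ j → runs S i ≤ runs S j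
runs-mono S {i} {zero} z≤n = ≤-refl
runs-mono S {i} {suc j} i≤1+j with m≤n⇒m<n∨m≡n i≤1+j
... | inj₂ refl = ≤-refl
... | inj₁ i<1+j with S j
...   | true  = runs-mono S (s≤s⁻¹ i<1+j)
...   | false = ≤-trans (runs-≤ S i) (<⇒≤ i<1+j)

runs-labelling : ∀ {k} S → (∀ {i} → k ≤ i → S i ≡ false) → IsLabelling (suc k) (runs S)
runs-labelling {k} S off = record { decreasing = runs-≤ S ; idempotent = idem ; outside = out }
  where
  idem : ∀ i → runs S (runs S i) ≡ runs S i
  idem zero = refl
  idem (suc i) with S i in Si
  ... | true  = idem i
  ... | false rewrite Si = refl
  out : ∀ {i} → suc k ≤ i → runs S i ≡ i
  out {suc i} (s≤s k≤i) rewrite off k≤i = refl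

runs-convex : ∀ S → Convex (runs S)
runs-convex S a≤b b≤c ac = ≤-antisym (≤-trans (runs-mono S b≤c) (≤-reflexive (sym ac))) (runs-mono S a≤b)

convex⇒noncrossing : ∀ {f} → Convex f → NonCrossingLabelling f
convex⇒noncrossing conv a<b b<c c<d ac bd = sym (conv (<⇒≤ a<b) (<⇒≤ b<c) ac)

module _ {k : ℕ} where

  links : NC (suc k) → ℕ → Bool
  links π i = does (label π i ≟ label π (suc i))

  -- b is a free flag behind the last element, so that every element carries one.
  allLinks : Bool → NC (suc k) → ℕ → Bool
  allLinks b π i = if does (i <? k) then links π i else b

  allLinks-within : ∀ b π {i} → i < k → allLinks b π i ≡ links π i
  allLinks-within b π {i} i<k = cong (λ c → if c then links π i else b) (dec-true (i <? k) i<k)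

  allLinks-last : ∀ b π → allLinks b π k ≡ b
  allLinks-last b π = cong (λ c → if c then links π k else b) (dec-false (k <? k) (<-irrefl refl))

  -- If `suc i` is not a minimum, then `i` lies between it and its minimum, and convexity puts `i`
  -- into the same block.
  label-step : ∀ (π : NC (suc k)) → Convex (label π) → ∀ i →
    label π (suc i) ≡ (if links π i then label π i else suc i)
  label-step π conv i = case (label π i ≟ label π (suc i))
    where
    choose : Bool → ℕ
    choose c = if c then label π i else suc i
    case : Dec (label π i ≡ label π (suc i)) → label π (suc i) ≡ choose (links π i)
    case (yes eq) = trans (sym eq) (cong choose (sym (dec-true (label π i ≟ label π (suc i)) eq)))
    case (no neq) = trans (isolated (m≤n⇒m<n∨m≡n (decreasing (label-labelling π) (suc i))))
      (cong choose (sym (dec-false (label π i ≟ label π (suc i)) neq)))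
      where
      isolated : label π (suc i) < suc i ⊎ label π (suc i) ≡ suc i → label π (suc i) ≡ suc i
      isolated (inj₂ eq) = eq
      isolated (inj₁ lt) = contradiction (trans (conv (s≤s⁻¹ lt) (n≤1+n i) (idempotent (label-labelling π) (suc i)))
        (idempotent (label-labelling π) (suc i))) neq

  label-runs : ∀ (π : NC (suc k)) → Convex (label π) → ∀ i → label π i ≡ runs (links π) i
  label-runs π conv zero    = minimum-0 (label-labelling π)
  label-runs π conv (suc i) = trans (label-step π conv i)
    (cong (λ v → if links π i then v else suc i) (label-runs π conv i))

  abstract
    decoding : ∀ b π (ρ : NC (suc k)) → Decoding (suc k) (allLinks b π) (label ρ)
    decoding b π ρ = decode (suc (suc k)) (allLinks b π) ≤-refl (label-labelling ρ) (label-noncrossing ρ)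

  toTree : Bool × NC (suc k) × NC (suc k) → Tree
  toTree (b , π , ρ) = proj₁ (decoding b π ρ)

  toTree-size : ∀ x → size (toTree x) ≡ suc k
  toTree-size (b , π , ρ) = proj₁ (proj₂ (decoding b π ρ))

  -- `enc` gives back ρ, the last flag gives back the spare bit, and the other flags give the links
  -- of π. Links determine a partition only if it is an interval partition, hence the two
  -- hypotheses.
  toTree-injective : ∀ {b π ρ b′ π′ ρ′} → IsInterval π → IsInterval π′ →
    toTree (b , π , ρ) ≡ toTree (b′ , π′ , ρ′) → (b , π , ρ) ≡ (b′ , π′ , ρ′)
  toTree-injective {b} {π} {ρ} {b′} {π′} {ρ′} int int′ eq = cong₂ _,_ b≡ (cong₂ _,_ π≡ ρ≡)
    where
    D = decoding b π ρ
    D′ = decoding b′ π′ ρ′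
    ρ≡ : ρ ≡ ρ′
    ρ≡ = label-injective ρ ρ′ λ i → trans (sym (proj₁ (proj₂ (proj₂ D)) i))
      (trans (cong (λ t → enc t i) eq) (proj₁ (proj₂ (proj₂ D′)) i))
    S≡ : ∀ {i} → i < suc k → allLinks b π i ≡ allLinks b′ π′ i
    S≡ {i} i<n = trans (sym (proj₂ (proj₂ (proj₂ D)) i<n))
      (trans (cong (λ t → flags t i) eq) (proj₂ (proj₂ (proj₂ D′)) i<n))
    b≡ : b ≡ b′
    b≡ = trans (sym (allLinks-last b π)) (trans (S≡ ≤-refl) (allLinks-last b′ π′))
    π≡ : π ≡ π′
    π≡ = label-injective π π′ same
      where
      same : ∀ i → label π i ≡ label π′ i
      same i = at (i <? suc k)
        where
        at : Dec (i < suc k) → label π i ≡ label π′ i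
        at (no i≮n) = trans (label-outside π (≮⇒≥ i≮n)) (sym (label-outside π′ (≮⇒≥ i≮n)))
        at (yes i<n) = trans (label-runs π (interval⇒convex π int) i) (trans (runs-cong i λ j<i →
          trans (sym (allLinks-within b π (<-≤-trans j<i (s≤s⁻¹ i<n)))) (trans (S≡ (<-trans j<i i<n))
            (allLinks-within b′ π′ (<-≤-trans j<i (s≤s⁻¹ i<n)))))
          (sym (label-runs π′ (interval⇒convex π′ int′) i)))

  fromTree : ∀ t → size t ≡ suc k → ∃ λ (x : Bool × NC (suc k) × NC (suc k)) → IsInterval (proj₁ (proj₂ x)) × toTree x ≡ t
  fromTree t t≡ = (b , π , ρ) , convex⇒interval π conv-π ,
    enc-injective (proj₁ D) t (trans (proj₁ (proj₂ D)) (sym t≡))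
      (λ i → trans (proj₁ (proj₂ (proj₂ D)) i) (label-fromLabelling E (enc-noncrossing t) i))
      (λ {i} i<n → trans (proj₂ (proj₂ (proj₂ D)) (<-≤-trans i<n (≤-reflexive (proj₁ (proj₂ D)))))
        (S≡ i (<-≤-trans i<n (≤-reflexive (proj₁ (proj₂ D))))))
    where
    -- The flag at `k` is the spare bit. As a link it would tie `k` to a position outside the
    -- partition, so it is cut off here and returned as `b`.
    S : ℕ → Bool
    S i = if does (i <? k) then flags t i else false
    S-off : ∀ {i} → k ≤ i → S i ≡ false
    S-off {i} k≤i = cong (λ c → if c then flags t i else false) (dec-false (i <? k) (≤⇒≯ k≤i))
    S-on : ∀ {i} → i < k → S i ≡ flags t i
    S-on {i} i<k = cong (λ c → if c then flags t i else false) (dec-true (i <? k) i<k)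
    E : IsLabelling (suc k) (enc t)
    E = subst (λ n → IsLabelling n (enc t)) t≡ (enc-labelling t)
    R = runs-labelling S S-off
    b = flags t k
    π = fromLabelling R (convex⇒noncrossing (runs-convex S))
    ρ = fromLabelling E (enc-noncrossing t)
    D = decoding b π ρ
    π≗ = label-fromLabelling R (convex⇒noncrossing (runs-convex S))
    conv-π : Convex (label π)
    conv-π {a} {m} {c} a≤m m≤c ac = trans (π≗ m) (trans (runs-convex S a≤m m≤c
      (trans (sym (π≗ a)) (trans ac (π≗ c)))) (sym (π≗ a)))
    links-runs : ∀ i → does (runs S i ≟ runs S (suc i)) ≡ S i
    links-runs i with S i in Si
    ... | true  = dec-true (runs S i ≟ runs S i) refl
    ... | false = dec-false (runs S i ≟ suc i) λ eq → <⇒≢ (s≤s (runs-≤ S i)) eq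
    S≡ : ∀ i → i < suc k → allLinks b π i ≡ flags t i
    S≡ i i<n with m≤n⇒m<n∨m≡n (s≤s⁻¹ i<n)
    ... | inj₂ refl = allLinks-last b π
    ... | inj₁ i<k = trans (allLinks-within b π i<k) (trans (cong₂ (λ u v → does (u ≟ v)) (π≗ i) (π≗ (suc i)))
      (trans (links-runs i) (S-on i<k)))

  open Distance {suc k} using (dist-join)

  -- The iterated `join` of `dist-join` and the recursive `joined` of the tree have the same
  -- universal property, so their block counts agree.
  dH-δ : ∀ b π ρ → IsInterval π → dH π ρ ≡ δ (toTree (b , π , ρ))
  dH-δ b π ρ int = +-cancelʳ-≡ (2 * joinBlocks t) _ _ (begin
    dH π ρ + 2 * joinBlocks t                     ≡⟨ cong (λ j → dH π ρ + 2 * j) joins ⟩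
    dH π ρ + 2 * blocks (join k S (label ρ)) n    ≡⟨ dist-join S (n<1+n k) π ρ resp least-π ⟩
    blocks (label π) n + blocks (label ρ) n       ≡⟨ cong₂ _+_ π-blocks ρ-blocks ⟩
    gaps t + bit (lastOr false t) + encBlocks t   ≡⟨ δ-joinBlocks t ⟨
    δ t + 2 * joinBlocks t                        ∎)
    where
    open ≡-Reasoning
    n = suc k
    S = allLinks b π
    D = decoding b π ρ
    t = proj₁ D
    t≡ = proj₁ (proj₂ D)
    enc≗ = proj₁ (proj₂ (proj₂ D))
    flags≗ : ∀ {i} → i < size t → flags t i ≡ S i
    flags≗ i<n = proj₂ (proj₂ (proj₂ D)) (<-≤-trans i<n (≤-reflexive t≡))
    conv = interval⇒convex π int
    F = label-labelling π
    joins : joinBlocks t ≡ blocks (join k S (label ρ)) n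
    joins = trans (blocks-cong (size t) (isJoin-unique (joined-isJoin t) (join-isJoin t t≡ enc≗ flags≗ (label-labelling ρ))))
      (cong (blocks (join k S (label ρ))) t≡)
    ρ-blocks : blocks (label ρ) n ≡ encBlocks t
    ρ-blocks = trans (blocks-cong n (sym ∘ enc≗)) (cong (blocks (enc t)) (sym t≡))
    step : ∀ {i} → i < k → does (label π (suc i) ≟ suc i) ≡ not (flags t i)
    step {i} i<k = trans (cong (λ v → does (v ≟ suc i)) (label-step π conv i))
      (trans (fixed (links π i)) (cong not (sym (trans (flags≗ (<-≤-trans (m<n⇒m<1+n i<k) (≤-reflexive (sym t≡))))
        (allLinks-within b π i<k)))))
      where
      fixed : ∀ c → does ((if c then label π i else suc i) ≟ suc i) ≡ not c
      fixed true  = dec-false (label π i ≟ suc i) (<⇒≢ (s≤s (decreasing F i)))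
      fixed false = dec-true (suc i ≟ suc i) refl
    -- Besides the block of 0, one block of π starts behind every unset flag before `k`. The 1 for
    -- the block of 0 is split as `bit (not y) + bit y` for the spare flag `y`, which completes the
    -- count of gaps to all positions.
    π-blocks : blocks (label π) n ≡ gaps t + bit (lastOr false t)
    π-blocks = begin
      blocks (label π) n                                         ≡⟨ blocks-suc (label π) k (minimum-0 F) ⟩
      suc (count (λ i → does (label π (suc i) ≟ suc i)) k)       ≡⟨ cong suc (count-cong k step) ⟩
      suc (count (not ∘ flags t) k)                              ≡⟨ +-comm 1 _ ⟩
      count (not ∘ flags t) k + 1                                ≡⟨ cong (count (not ∘ flags t) k +_) (bit-not (flags t k)) ⟨
      count (not ∘ flags t) k + (bit (not (flags t k)) + bit (flags t k)) ≡⟨ +-assoc (count (not ∘ flags t) k) _ _ ⟨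
      count (not ∘ flags t) (suc k) + bit (flags t k)
        ≡⟨ cong₂ _+_ (cong (count (not ∘ flags t)) (sym t≡)) (cong bit (flags-last false t t≡)) ⟩
      gaps t + bit (lastOr false t)                              ∎
    resp : Respects k S (label π)
    resp {i} i<k Si = does⇒ (label π i ≟ label π (suc i)) (trans (sym (allLinks-within b π i<k)) Si)
    least-π : ∀ {h} → Respects k S h → label π ⊑ h
    least-π {h} resp-h i = at (i <? n)
      where
      at : Dec (i < n) → h (label π i) ≡ h i
      go : ∀ i → i ≤ k → h (runs (links π) i) ≡ h i
      go zero _ = refl
      go (suc i) i<k with links π i in eq
      ... | true  = trans (go i (<⇒≤ i<k)) (resp-h i<k (trans (allLinks-within b π i<k) eq))
      ... | false = refl
      at (no i≮n)  = cong h (label-outside π (≮⇒≥ i≮n))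
      at (yes i<n) = trans (cong h (label-runs π conv i)) (go i (s≤s⁻¹ i<n))

-- Enumeration of the flagged trees

pairs : (ℕ → List Tree) → (ℕ → List Tree) → ℕ → List (Tree × Tree)
pairs L R zero    = cartesianProduct (L 0) (R 0)
pairs L R (suc n) = cartesianProduct (L 0) (R (suc n)) ++ pairs (L ∘ suc) R n

pairs-cong : ∀ {L L′ R R′} n → (∀ {m} → m ≤ n → L m ≡ L′ m) → (∀ {m} → m ≤ n → R m ≡ R′ m) →
  pairs L R n ≡ pairs L′ R′ n
pairs-cong zero    eqL eqR = cong₂ cartesianProduct (eqL z≤n) (eqR z≤n)
pairs-cong (suc n) eqL eqR = cong₂ _++_ (cong₂ cartesianProduct (eqL z≤n) (eqR ≤-refl))
  (pairs-cong n (eqL ∘ s≤s) (eqR ∘ m≤n⇒m≤1+n))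

∈-pairs⁺ : ∀ {L R} m {k a b} → a ∈ˡ L m → b ∈ˡ R k → (a , b) ∈ˡ pairs L R (m + k)
∈-pairs⁺ zero {zero} a∈ b∈  = ∈-cartesianProduct⁺ a∈ b∈
∈-pairs⁺ zero {suc k} a∈ b∈ = ∈-++⁺ˡ (∈-cartesianProduct⁺ a∈ b∈)
∈-pairs⁺ {L} {R} (suc m) {k} a∈ b∈ = ∈-++⁺ʳ (cartesianProduct (L 0) (R (suc (m + k)))) (∈-pairs⁺ m a∈ b∈)

∈-pairs⁻ : ∀ {L R} n {a b} → (a , b) ∈ˡ pairs L R n → ∃₂ λ m k → m + k ≡ n × a ∈ˡ L m × b ∈ˡ R k
∈-pairs⁻ {L} {R} zero ab∈ = 0 , 0 , refl , ∈-cartesianProduct⁻ (L 0) (R 0) ab∈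
∈-pairs⁻ {L} {R} (suc n) ab∈ with ∈-++⁻ (cartesianProduct (L 0) (R (suc n))) ab∈
... | inj₁ ab∈′ = 0 , suc n , refl , ∈-cartesianProduct⁻ (L 0) (R (suc n)) ab∈′
... | inj₂ ab∈′ with ∈-pairs⁻ n ab∈′
...   | m , k , eq , a∈ , b∈ = suc m , k , cong suc eq , a∈ , b∈

-- `c` records how far `L` has been shifted. The first piece is disjoint from the later ones because
-- its left trees have size `c` and theirs are larger.
pairs-unique : ∀ {L R} c n → (∀ m → Unique (L m)) → (∀ m → Unique (R m)) →
  (∀ {m t} → t ∈ˡ L m → size t ≡ c + m) → Unique (pairs L R n)
pairs-unique c zero    uL uR sz = Unique.cartesianProduct⁺ (uL 0) (uR 0)
pairs-unique {L} {R} c (suc n) uL uR sz = Unique.++⁺ (Unique.cartesianProduct⁺ (uL 0) (uR (suc n)))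
  (pairs-unique (suc c) n (uL ∘ suc) uR λ {m} t∈ → trans (sz t∈) (+-suc c m))
  λ { {a , b} (p , q) → m+1+n≢m c (trans (sym (sz (proj₁ (proj₂ (proj₂ (proj₂ (∈-pairs⁻ {L ∘ suc} {R} n q)))))))
    (trans (sz (proj₁ (∈-cartesianProduct⁻ (L 0) (R (suc n)) p))) (+-identityʳ c))) }

nodes : List (Tree × Tree) → List Tree
nodes = cartesianProductWith (λ x (l , r) → node x l r) (false ∷ true ∷ [])

-- `N` bounds the recursion depth; as soon as `n ≤ N` the list is independent of it
-- (`treesUpTo-stable`).
treesUpTo : ℕ → ℕ → List Tree
treesUpTo N       zero    = nil ∷ []
treesUpTo zero    (suc n) = []
treesUpTo (suc N) (suc n) = nodes (pairs (treesUpTo N) (treesUpTo N) n)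

treesUpTo-stable : ∀ {M N} n → n ≤ M → n ≤ N → treesUpTo M n ≡ treesUpTo N n
treesUpTo-stable zero _ _ = refl
treesUpTo-stable (suc n) (s≤s n≤M) (s≤s n≤N) = cong nodes (pairs-cong n
  (λ m≤n → treesUpTo-stable _ (≤-trans m≤n n≤M) (≤-trans m≤n n≤N))
  (λ m≤n → treesUpTo-stable _ (≤-trans m≤n n≤M) (≤-trans m≤n n≤N)))

trees : ℕ → List Tree
trees n = treesUpTo n n

trees-suc : ∀ n → trees (suc n) ≡ nodes (pairs trees trees n)
trees-suc n = cong nodes (pairs-cong n (λ m≤n → treesUpTo-stable _ m≤n ≤-refl) (λ m≤n → treesUpTo-stable _ m≤n ≤-refl))

∈-trees : ∀ t → t ∈ˡ trees (size t)
∈-trees nil = hereˡ refl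
∈-trees (node x l r) = subst (node x l r ∈ˡ_) (sym (trees-suc (size l + size r)))
  (∈-cartesianProductWith⁺ (λ x (l , r) → node x l r) (flag x) (∈-pairs⁺ (size l) (∈-trees l) (∈-trees r)))
  where
  flag : ∀ x → x ∈ˡ (false ∷ true ∷ [])
  flag false = hereˡ refl
  flag true  = thereˡ (hereˡ refl)

treesUpTo-size : ∀ N n {t} → t ∈ˡ treesUpTo N n → size t ≡ n
treesUpTo-size N zero (hereˡ refl) = refl
treesUpTo-size (suc N) (suc n) t∈
  with ∈-cartesianProductWith⁻ (λ x (l , r) → node x l r) (false ∷ true ∷ []) (pairs (treesUpTo N) (treesUpTo N) n) t∈
... | x , (l , r) , _ , lr∈ , refl with ∈-pairs⁻ n lr∈
...   | m , k , refl , l∈ , r∈ = cong suc (cong₂ _+_ (treesUpTo-size N m l∈) (treesUpTo-size N k r∈))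

treesUpTo-unique : ∀ N n → Unique (treesUpTo N n)
treesUpTo-unique N zero = []ᴬ ∷ᴾ []ᴾ
treesUpTo-unique zero (suc n) = []ᴾ
treesUpTo-unique (suc N) (suc n) = Unique.cartesianProductWith⁺ (λ x (l , r) → node x l r) (λ { refl → refl , refl })
  (((λ ()) ∷ᴬ []ᴬ) ∷ᴾ []ᴬ ∷ᴾ []ᴾ)
  (pairs-unique 0 n (treesUpTo-unique N) (treesUpTo-unique N) λ {m} → treesUpTo-size N m)

unique-map : ∀ {A B : Set} (f : A → B) {xs} → (∀ {x y} → x ∈ˡ xs → y ∈ˡ xs → f x ≡ f y → x ≡ y) →
  Unique xs → Unique (map f xs)
unique-map f inj []ᴾ = []ᴾ
unique-map f inj (x∉ ∷ᴾ u) = AllL.map⁺ (AllL.tabulate λ y∈ eq →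
    AllL.lookup x∉ y∈ (inj (hereˡ refl) (thereˡ y∈) eq))
  ∷ᴾ unique-map f (λ x∈ y∈ → inj (thereˡ x∈) (thereˡ y∈)) u

map-↭ : ∀ {A B : Set} (f : A → B) {xs ys} → Unique xs → Unique ys →
  (∀ {x y} → x ∈ˡ xs → y ∈ˡ xs → f x ≡ f y → x ≡ y) →
  (∀ {x} → x ∈ˡ xs → f x ∈ˡ ys) → (∀ {y} → y ∈ˡ ys → ∃ λ x → x ∈ˡ xs × f x ≡ y) →
  map f xs ↭ ys
map-↭ f {xs} {ys} uxs uys inj into onto = ∼bag⇒↭ (unique∧set⇒bag (unique-map f inj uxs) uys (mk⇔ to from))
  where
  to : ∀ {y} → y ∈ˡ map f xs → y ∈ˡ ys
  to y∈ with ∈-map⁻ f y∈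
  ... | _ , x∈ , refl = into x∈
  from : ∀ {y} → y ∈ˡ ys → y ∈ˡ map f xs
  from y∈ with onto y∈
  ... | _ , x∈ , refl = ∈-map⁺ f x∈

flagValues : List Bool
flagValues = false ∷ true ∷ []

∈-flagValues : ∀ b → b ∈ˡ flagValues
∈-flagValues false = hereˡ refl
∈-flagValues true  = thereˡ (hereˡ refl)

flagValues-unique : Unique flagValues
flagValues-unique = ((λ ()) ∷ᴬ []ᴬ) ∷ᴾ []ᴬ ∷ᴾ []ᴾ

sum-flagged : ∀ {A : Set} (f : A → ℕ) xs → sum (map (f ∘ proj₂) (cartesianProduct flagValues xs)) ≡ 2 * sum (map f xs)
sum-flagged f xs = begin
  sum (map g (map (false ,_) xs ++ map (true ,_) xs ++ []))
    ≡⟨ cong (λ ys → sum (map g (map (false ,_) xs ++ ys))) (++-identityʳ (map (true ,_) xs)) ⟩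
  sum (map g (map (false ,_) xs ++ map (true ,_) xs))
    ≡⟨ cong sum (map-++ g (map (false ,_) xs) (map (true ,_) xs)) ⟩
  sum (map g (map (false ,_) xs) ++ map g (map (true ,_) xs))
    ≡⟨ sum-++ (map g (map (false ,_) xs)) (map g (map (true ,_) xs)) ⟩
  sum (map g (map (false ,_) xs)) + sum (map g (map (true ,_) xs))
    ≡⟨ cong₂ (λ ys zs → sum ys + sum zs) (map-∘ xs) (map-∘ xs) ⟨
  sum (map f xs) + sum (map f xs)
    ≡⟨ cong (sum (map f xs) +_) (+-identityʳ (sum (map f xs))) ⟨
  2 * sum (map f xs) ∎
  where
  open ≡-Reasoning
  g = f ∘ proj₂

module _ {k : ℕ} (ints ncs : List (NC (suc k)))
  (ints-sound : ∀ {π} → π ∈ˡ ints → IsInterval π) (ints-complete : ∀ π → IsInterval π → π ∈ˡ ints)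
  (ncs-complete : ∀ ρ → ρ ∈ˡ ncs) (ints-unique : Unique ints) (ncs-unique : Unique ncs) where

  private
    triples : List (Bool × NC (suc k) × NC (suc k))
    triples = cartesianProduct flagValues (cartesianProduct ints ncs)

    triple-interval : ∀ {b π ρ} → (b , π , ρ) ∈ˡ triples → IsInterval π
    triple-interval x∈ = ints-sound (proj₁ (∈-cartesianProduct⁻ ints ncs
      (proj₂ (∈-cartesianProduct⁻ flagValues (cartesianProduct ints ncs) x∈))))

  toTree-↭ : map toTree triples ↭ trees (suc k)
  toTree-↭ = map-↭ toTree
    (Unique.cartesianProduct⁺ flagValues-unique (Unique.cartesianProduct⁺ ints-unique ncs-unique))
    (treesUpTo-unique (suc k) (suc k))
    (λ x∈ y∈ → toTree-injective (triple-interval x∈) (triple-interval y∈))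
    (λ {x} _ → subst (λ m → toTree x ∈ˡ trees m) (toTree-size x) (∈-trees (toTree x)))
    from
    where
    from : ∀ {t} → t ∈ˡ trees (suc k) → ∃ λ x → x ∈ˡ triples × toTree x ≡ t
    from {t} t∈ = listed (fromTree t (treesUpTo-size (suc k) (suc k) t∈))
      where
      listed : (∃ λ (x : Bool × NC (suc k) × NC (suc k)) → IsInterval (proj₁ (proj₂ x)) × toTree x ≡ t) →
        ∃ λ x → x ∈ˡ triples × toTree x ≡ t
      listed ((b , π , ρ) , int , eq) = (b , π , ρ) , ∈-cartesianProduct⁺ (∈-flagValues b)
        (∈-cartesianProduct⁺ (ints-complete π int) (ncs-complete ρ)) , eq

  -- Every pair (π, ρ) yields two trees, one per value of the spare bit, and `δ` is the same on
  -- both.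
  sum-dH : sum (map δ (trees (suc k))) ≡ 2 * sum (map (uncurry dH) (cartesianProduct ints ncs))
  sum-dH = begin
    sum (map δ (trees (suc k)))              ≡⟨ sum-↭ (map⁺ δ toTree-↭) ⟨
    sum (map δ (map toTree triples))         ≡⟨ cong sum (map-∘ triples) ⟨
    sum (map (δ ∘ toTree) triples)           ≡⟨ cong sum (map-cong-local (AllL.tabulate λ {x} x∈ →
                                                  sym (dH-δ (proj₁ x) (proj₁ (proj₂ x)) (proj₂ (proj₂ x)) (triple-interval x∈)))) ⟩
    sum (map (uncurry dH ∘ proj₂) triples)   ≡⟨ sum-flagged (uncurry dH) (cartesianProduct ints ncs) ⟩
    2 * sum (map (uncurry dH) (cartesianProduct ints ncs)) ∎
    where open ≡-Reasoning

sum-δ : ∀ k → sum (map δ (trees (suc k))) ≡ 2 * totalDistance (suc k)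
sum-δ k = sum-dH (allInt (suc k)) (allNC (suc k))
  (λ π∈ → proj₂ (∈-filter⁻ isInterval? {xs = allNC (suc k)} π∈))
  (λ π int → ∈-filter⁺ isInterval? (∈-allNC π) int)
  ∈-allNC (Unique.filter⁺ isInterval? (allNC-unique (suc k))) (allNC-unique (suc k))

-- Generating functions

Sequence : Set
Sequence = ℕ → ℕ

infixl 6 _⊕_
infixl 7 _⊛_

_⊕_ : Sequence → Sequence → Sequence
(a ⊕ b) n = a n + b n

_⊛_ : Sequence → Sequence → Sequence
(a ⊛ b) zero    = a 0 * b 0
(a ⊛ b) (suc n) = a 0 * b (suc n) + ((a ∘ suc) ⊛ b) n

zeros unit : Sequence
zeros _       = 0
unit zero     = 1
unit (suc _)  = 0

⊛-cong : ∀ {a a′ b b′} → (∀ n → a n ≡ a′ n) → (∀ n → b n ≡ b′ n) → ∀ n → (a ⊛ b) n ≡ (a′ ⊛ b′) n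
⊛-cong a≗ b≗ zero    = cong₂ _*_ (a≗ 0) (b≗ 0)
⊛-cong a≗ b≗ (suc n) = cong₂ _+_ (cong₂ _*_ (a≗ 0) (b≗ (suc n))) (⊛-cong (a≗ ∘ suc) b≗ n)

⊛-zeroˡ : ∀ b n → (zeros ⊛ b) n ≡ 0
⊛-zeroˡ b zero    = refl
⊛-zeroˡ b (suc n) = ⊛-zeroˡ b n

⊛-unitˡ : ∀ b n → (unit ⊛ b) n ≡ b n
⊛-unitˡ b zero    = +-identityʳ (b 0)
⊛-unitˡ b (suc n) = trans (cong₂ _+_ (+-identityʳ (b (suc n))) (⊛-zeroˡ b n)) (+-identityʳ (b (suc n)))

⊛-distribʳ : ∀ c a b n → ((a ⊕ b) ⊛ c) n ≡ (a ⊛ c) n + (b ⊛ c) n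
⊛-distribʳ c a b zero    = *-distribʳ-+ (c 0) (a 0) (b 0)
⊛-distribʳ c a b (suc n) = trans
  (cong₂ _+_ (*-distribʳ-+ (c (suc n)) (a 0) (b 0)) (⊛-distribʳ c (a ∘ suc) (b ∘ suc) n))
  (solve 4 (λ p q r s → p :+ q :+ (r :+ s) := p :+ r :+ (q :+ s)) refl (a 0 * c (suc n)) (b 0 * c (suc n))
    (((a ∘ suc) ⊛ c) n) (((b ∘ suc) ⊛ c) n))
  where open +-*-Solver

⊛-scaleˡ : ∀ k a b n → ((λ i → k * a i) ⊛ b) n ≡ k * (a ⊛ b) n
⊛-scaleˡ k a b zero    = *-assoc k (a 0) (b 0)
⊛-scaleˡ k a b (suc n) = trans (cong₂ _+_ (*-assoc k (a 0) (b (suc n))) (⊛-scaleˡ k (a ∘ suc) b n))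
  (sym (*-distribˡ-+ k (a 0 * b (suc n)) (((a ∘ suc) ⊛ b) n)))

⊛-sucʳ : ∀ a b n → (a ⊛ b) (suc n) ≡ a (suc n) * b 0 + (a ⊛ (b ∘ suc)) n
⊛-sucʳ a b zero    = +-comm (a 0 * b 1) (a 1 * b 0)
⊛-sucʳ a b (suc n) = trans (cong (a 0 * b (2 + n) +_) (⊛-sucʳ (a ∘ suc) b n))
  (solve 3 (λ p q r → p :+ (q :+ r) := q :+ (p :+ r)) refl (a 0 * b (2 + n)) (a (2 + n) * b 0)
    (((a ∘ suc) ⊛ (b ∘ suc)) n))
  where open +-*-Solver

⊛-comm : ∀ a b n → (a ⊛ b) n ≡ (b ⊛ a) n
⊛-comm a b zero    = *-comm (a 0) (b 0)
⊛-comm a b (suc n) = trans (cong₂ _+_ (*-comm (a 0) (b (suc n))) (⊛-comm (a ∘ suc) b n)) (sym (⊛-sucʳ b a n))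

⊛-assoc : ∀ a b c n → ((a ⊛ b) ⊛ c) n ≡ (a ⊛ (b ⊛ c)) n
⊛-assoc a b c zero    = *-assoc (a 0) (b 0) (c 0)
⊛-assoc a b c (suc n) = begin
  a 0 * b 0 * c (suc n) + (((λ i → a 0 * b (suc i)) ⊕ ((a ∘ suc) ⊛ b)) ⊛ c) n
    ≡⟨ cong (a 0 * b 0 * c (suc n) +_) (⊛-distribʳ c (λ i → a 0 * b (suc i)) ((a ∘ suc) ⊛ b) n) ⟩
  a 0 * b 0 * c (suc n) + (((λ i → a 0 * b (suc i)) ⊛ c) n + (((a ∘ suc) ⊛ b) ⊛ c) n)
    ≡⟨ cong (a 0 * b 0 * c (suc n) +_) (cong₂ _+_ (⊛-scaleˡ (a 0) (b ∘ suc) c n) (⊛-assoc (a ∘ suc) b c n)) ⟩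
  a 0 * b 0 * c (suc n) + (a 0 * ((b ∘ suc) ⊛ c) n + ((a ∘ suc) ⊛ (b ⊛ c)) n)
    ≡⟨ solve 5 (λ a b c p q → a :* b :* c :+ (a :* p :+ q) := a :* (b :* c :+ p) :+ q) refl
         (a 0) (b 0) (c (suc n)) (((b ∘ suc) ⊛ c) n) (((a ∘ suc) ⊛ (b ⊛ c)) n) ⟩
  a 0 * (b 0 * c (suc n) + ((b ∘ suc) ⊛ c) n) + ((a ∘ suc) ⊛ (b ⊛ c)) n ∎
  where
  open ≡-Reasoning
  open +-*-Solver

-- Formal power series over ℕ with the Cauchy product, the semiring in which the elimination is
-- carried out.
sequences : CommutativeSemiring 0ℓ 0ℓ
sequences = record
  { Carrier = Sequence
  ; _≈_ = λ a b → ∀ n → a n ≡ b n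
  ; _+_ = _⊕_
  ; _*_ = _⊛_
  ; 0# = zeros
  ; 1# = unit
  ; isCommutativeSemiring = isCommutativeSemiringˡ (record
    { +-isCommutativeMonoid = record
      { isMonoid = record
        { isSemigroup = record
          { isMagma = record { isEquivalence = equivalence ; ∙-cong = λ p q n → cong₂ _+_ (p n) (q n) }
          ; assoc = λ a b c n → +-assoc (a n) (b n) (c n)
          }
        ; identity = (λ _ _ → refl) , λ a n → +-identityʳ (a n)
        }
      ; comm = λ a b n → +-comm (a n) (b n)
      }
    ; *-isCommutativeMonoid = record
      { isMonoid = record
        { isSemigroup = record
          { isMagma = record { isEquivalence = equivalence ; ∙-cong = ⊛-cong }
          ; assoc = ⊛-assoc
          }
        ; identity = ⊛-unitˡ , λ a n → trans (⊛-comm a unit n) (⊛-unitˡ a n)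
        }
      ; comm = ⊛-comm
      }
    ; distribʳ = ⊛-distribʳ
    ; zeroˡ = ⊛-zeroˡ
    })
  }
  where
  equivalence : IsEquivalence (λ (a b : Sequence) → ∀ n → a n ≡ b n)
  equivalence = record { refl = λ _ → refl ; sym = λ p n → sym (p n) ; trans = λ p q n → trans (p n) (q n) }

z : Sequence
z zero    = 0
z (suc n) = unit n

z⊛-suc : ∀ a n → (z ⊛ a) (suc n) ≡ a n
z⊛-suc = ⊛-unitˡ

-- The Euler operator `z d/dz`, a derivation by `θ-leibniz`.
θ : Sequence → Sequence
θ a n = n * a n

θ-leibniz : ∀ a b n → θ (a ⊛ b) n ≡ (θ a ⊛ b) n + (a ⊛ θ b) n
θ-leibniz a b zero    = sym (*-zeroʳ (a 0))
θ-leibniz a b (suc n) = begin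
  suc n * (p + q)                                     ≡⟨ solve 3 (λ n p q → (con 1 :+ n) :* (p :+ q) :=
                                                           (con 1 :+ n) :* p :+ q :+ n :* q) refl n p q ⟩
  suc n * p + q + n * q                               ≡⟨ cong₂ (λ s t → s + q + t)
                                                           (solve 3 (λ n a b → n :* (a :* b) := a :* (n :* b)) refl (suc n) (a 0) (b (suc n)))
                                                           (θ-leibniz (a ∘ suc) b n) ⟩
  a 0 * (suc n * b (suc n)) + q + ((θ (a ∘ suc) ⊛ b) n + r)
    ≡⟨ solve 4 (λ s q t r → s :+ q :+ (t :+ r) := q :+ t :+ (s :+ r)) refl
         (a 0 * (suc n * b (suc n))) q ((θ (a ∘ suc) ⊛ b) n) r ⟩
  q + (θ (a ∘ suc) ⊛ b) n + (a ⊛ θ b) (suc n)         ≡⟨ cong (_+ (a ⊛ θ b) (suc n)) (⊛-distribʳ b (a ∘ suc) (θ (a ∘ suc)) n) ⟨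
  (((a ∘ suc) ⊕ θ (a ∘ suc)) ⊛ b) n + (a ⊛ θ b) (suc n) ∎
  where
  open ≡-Reasoning
  open +-*-Solver
  p = a 0 * b (suc n)
  q = ((a ∘ suc) ⊛ b) n
  r = ((a ∘ suc) ⊛ θ b) n

-- Sums over trees as coefficients of series

total : ∀ {A : Set} → (A → ℕ) → List A → ℕ
total f xs = sum (map f xs)

total-cong : ∀ {A : Set} {f g : A → ℕ} → (∀ x → f x ≡ g x) → ∀ xs → total f xs ≡ total g xs
total-cong f≗g xs = cong sum (map-cong f≗g xs)

total-++ : ∀ {A : Set} (f : A → ℕ) xs ys → total f (xs ++ ys) ≡ total f xs + total f ys
total-++ f xs ys = trans (cong sum (map-++ f xs ys)) (sum-++ (map f xs) (map f ys))

total-map : ∀ {A B : Set} (f : B → ℕ) (g : A → B) xs → total f (map g xs) ≡ total (f ∘ g) xs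
total-map f g xs = cong sum (sym (map-∘ xs))

total-0 : ∀ {A : Set} (xs : List A) → total (λ _ → 0) xs ≡ 0
total-0 []       = refl
total-0 (_ ∷ xs) = total-0 xs

total-+ : ∀ {A : Set} (f g : A → ℕ) xs → total (λ x → f x + g x) xs ≡ total f xs + total g xs
total-+ f g []       = refl
total-+ f g (x ∷ xs) = trans (cong (f x + g x +_) (total-+ f g xs))
  (solve 4 (λ a b c d → a :+ b :+ (c :+ d) := a :+ c :+ (b :+ d)) refl (f x) (g x) (total f xs) (total g xs))
  where open +-*-Solver

total-scale : ∀ {A : Set} k (f : A → ℕ) xs → total (λ x → k * f x) xs ≡ k * total f xs
total-scale k f []       = sym (*-zeroʳ k)
total-scale k f (x ∷ xs) = trans (cong (k * f x +_) (total-scale k f xs)) (sym (*-distribˡ-+ k (f x) (total f xs)))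

total-product : ∀ {A B : Set} (f : A → ℕ) (g : B → ℕ) xs ys →
  total (λ (x , y) → f x * g y) (cartesianProduct xs ys) ≡ total f xs * total g ys
total-product f g [] ys = refl
total-product f g (x ∷ xs) ys = begin
  total h (map (x ,_) ys ++ cartesianProduct xs ys)           ≡⟨ total-++ h (map (x ,_) ys) (cartesianProduct xs ys) ⟩
  total h (map (x ,_) ys) + total h (cartesianProduct xs ys)  ≡⟨ cong₂ _+_ (trans (total-map h (x ,_) ys) (total-scale (f x) g ys))
                                                                   (total-product f g xs ys) ⟩
  f x * total g ys + total f xs * total g ys                  ≡⟨ *-distribʳ-+ (total g ys) (f x) (total f xs) ⟨
  (f x + total f xs) * total g ys                             ∎
  where
  open ≡-Reasoning
  h = λ (p : _ × _) → f (proj₁ p) * g (proj₂ p)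

-- `pairs` peels off the smallest left size exactly as `⊛` peels off the first coefficient, so the
-- two recursions match.
total-pairs : ∀ f g L R n → total (λ (l , r) → f l * g r) (pairs L R n) ≡ ((total f ∘ L) ⊛ (total g ∘ R)) n
total-pairs f g L R zero    = total-product f g (L 0) (R 0)
total-pairs f g L R (suc n) = trans (total-++ _ (cartesianProduct (L 0) (R (suc n))) (pairs (L ∘ suc) R n))
  (cong₂ _+_ (total-product f g (L 0) (R (suc n))) (total-pairs f g (L ∘ suc) R n))

gf : (Tree → ℕ) → Sequence
gf f n = total f (trees n)

pairSum : (Tree → Tree → ℕ) → Sequence
pairSum h n = total (λ (l , r) → h l r) (pairs trees trees n)

pairSum-+ : ∀ f g n → pairSum (λ l r → f l r + g l r) n ≡ (pairSum f ⊕ pairSum g) n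
pairSum-+ f g n = total-+ (λ (l , r) → f l r) (λ (l , r) → g l r) (pairs trees trees n)

pairSum-* : ∀ {f g a b} → (∀ n → gf f n ≡ a n) → (∀ n → gf g n ≡ b n) → ∀ n → pairSum (λ l r → f l * g r) n ≡ (a ⊛ b) n
pairSum-* {f} {g} f≗ g≗ n = trans (total-pairs f g trees trees n) (⊛-cong f≗ g≗ n)

gf-suc : ∀ f n → gf f (suc n) ≡ pairSum (λ l r → f (node false l r) + f (node true l r)) n
gf-suc f n = begin
  total f (trees (suc n))                              ≡⟨ cong (total f) (trees-suc n) ⟩
  total f (map u ps ++ map v ps ++ [])                 ≡⟨ cong (λ xs → total f (map u ps ++ xs)) (++-identityʳ (map v ps)) ⟩
  total f (map u ps ++ map v ps)                       ≡⟨ total-++ f (map u ps) (map v ps) ⟩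
  total f (map u ps) + total f (map v ps)              ≡⟨ cong₂ _+_ (total-map f u ps) (total-map f v ps) ⟩
  total (f ∘ u) ps + total (f ∘ v) ps                  ≡⟨ total-+ (f ∘ u) (f ∘ v) ps ⟨
  total (λ p → f (u p) + f (v p)) ps                   ∎
  where
  open ≡-Reasoning
  ps = pairs trees trees n
  u v : Tree × Tree → Tree
  u (l , r) = node false l r
  v (l , r) = node true l r

one empty nonempty : Tree → ℕ
one _ = 1
empty nil             = 1
empty (node _ _ _)    = 0
nonempty nil          = 0
nonempty (node _ _ _) = 1

linkedBit linkedNonempty lastBit : Tree → ℕ
linkedBit t      = bit (linked t)
linkedNonempty t = nonempty t * bit (linked t)
lastBit t        = bit (lastOr false t)

open CommutativeSemiring sequences using (+-cong; _≈_) renaming (refl to ≈-refl; trans to ≈-trans)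

-- C counts the trees, so that C n = 2ⁿ Catₙ; the other series are P = C - 1, Q + 1,
-- Y and D weighted by linkedBit, lastBit and δ, T = z C′ and B = C + z C′.
C P Q Y D T B : Sequence
P = gf nonempty
C = unit ⊕ P
Q = gf linkedNonempty
Y = gf lastBit
D = gf δ
T = θ P
B = C ⊕ T

gf-empty : gf empty ≈ unit
gf-empty zero    = refl
gf-empty (suc n) = trans (gf-suc empty n) (total-0 (pairs trees trees n))

gf-one : gf one ≈ C
gf-one n = trans (total-cong (λ { nil → refl ; (node _ _ _) → refl }) (trees n))
  (trans (total-+ empty nonempty (trees n)) (cong (_+ P n) (gf-empty n)))

gf-linked : gf linkedBit ≈ unit ⊕ Q
gf-linked n = trans (total-cong (λ { nil → refl ; (node x l r) → sym (+-identityʳ _) }) (trees n))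
  (trans (total-+ empty linkedNonempty (trees n)) (cong (_+ Q n) (gf-empty n)))

from-suc : ∀ {a b : Sequence} → a 0 ≡ 0 → (∀ n → a (suc n) ≡ b n) → a ≈ z ⊛ b
from-suc a0 a+ zero    = a0
from-suc {b = b} a0 a+ (suc n) = trans (a+ n) (sym (z⊛-suc b n))

P-equation : P ≈ z ⊛ (C ⊛ C ⊕ C ⊛ C)
P-equation = from-suc refl λ n → trans (gf-suc nonempty n) (trans (pairSum-+ (λ _ _ → 1) (λ _ _ → 1) n)
  (+-cong (pairSum-* {one} {one} gf-one gf-one) (pairSum-* {one} {one} gf-one gf-one) n))

-- The product with `unit` is the case of an empty `r`, where `x` must be set and `l` is linked or
-- empty; the other two come from a nonempty linked `r`, one for each root flag.
Q-equation : Q ≈ z ⊛ ((unit ⊕ Q) ⊛ unit ⊕ (C ⊛ Q ⊕ C ⊛ Q))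
Q-equation = from-suc refl λ n → trans (gf-suc linkedNonempty n)
  (trans (total-cong (λ (l , r) → by-cases l r) (pairs trees trees n))
  (trans (pairSum-+ (λ l r → linkedBit l * empty r) _ n) (cong₂ _+_ (pairSum-* {linkedBit} {empty} gf-linked gf-empty n)
    (trans (pairSum-+ _ _ n) (+-cong CQ CQ n)))))
  where
  CQ : pairSum (λ l r → one l * linkedNonempty r) ≈ C ⊛ Q
  CQ = pairSum-* {one} {linkedNonempty} gf-one (λ _ → refl)
  by-cases : ∀ l r → linkedNonempty (node false l r) + linkedNonempty (node true l r) ≡
    linkedBit l * empty r + (one l * linkedNonempty r + one l * linkedNonempty r)
  by-cases l nil = solve 1 (λ b → con 0 :+ (b :+ con 0) := b :* con 1 :+ con 0) refl (linkedBit l)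
    where open +-*-Solver
  by-cases l r@(node _ _ _) = solve 2 (λ b c → (c :+ con 0) :+ (c :+ con 0) :=
    b :* con 0 :+ ((c :+ con 0 :+ con 0) :+ (c :+ con 0 :+ con 0))) refl (linkedBit l) (linkedBit r)
    where open +-*-Solver

-- The three groups say where the last flag sits: at the root, in `l` with `r` empty, or in `r`.
Y-equation : Y ≈ z ⊛ (unit ⊛ unit ⊕ ((Y ⊛ unit ⊕ Y ⊛ unit) ⊕ (C ⊛ Y ⊕ C ⊛ Y)))
Y-equation = from-suc refl λ n → trans (gf-suc lastBit n)
  (trans (total-cong (λ (l , r) → by-cases l r) (pairs trees trees n))
  (trans (pairSum-+ (λ l r → empty l * empty r) _ n) (cong₂ _+_ (pairSum-* {empty} {empty} gf-empty gf-empty n)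
    (trans (pairSum-+ (λ l r → lastBit l * empty r + lastBit l * empty r) _ n)
      (cong₂ _+_ (trans (pairSum-+ _ _ n) (+-cong YE YE n)) (trans (pairSum-+ _ _ n) (+-cong CY CY n)))))))
  where
  YE : pairSum (λ l r → lastBit l * empty r) ≈ Y ⊛ unit
  YE = pairSum-* {lastBit} {empty} (λ _ → refl) gf-empty
  CY : pairSum (λ l r → one l * lastBit r) ≈ C ⊛ Y
  CY = pairSum-* {one} {lastBit} gf-one (λ _ → refl)
  by-cases : ∀ l r → lastBit (node false l r) + lastBit (node true l r) ≡
    empty l * empty r + ((lastBit l * empty r + lastBit l * empty r) + (one l * lastBit r + one l * lastBit r))
  by-cases nil nil = refl
  by-cases l@(node _ _ _) nil = solve 1 (λ b → b :+ b := con 0 :+ ((b :* con 1 :+ b :* con 1) :+ con 0)) refl (lastBit l)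
    where open +-*-Solver
  by-cases l r@(node _ _ _) = solve 3 (λ e b c → c :+ c := e :* con 0 :+ ((b :* con 0 :+ b :* con 0) :+
    ((c :+ con 0) :+ (c :+ con 0)))) refl (empty l) (lastBit l) (lastBit r)
    where open +-*-Solver

-- Over both root flags `nodeStep` sums to 3, or to 1 if `l` is linked; the deficit of 2 is moved to
-- the left. On the right stand the distances inside `l` and inside `r`, the leaf cost `P ⊛ unit`,
-- the three copies of `C ⊛ P` from `nodeStep`, and the last flags of `l`.
D-equation : D ⊕ z ⊛ ((unit ⊕ Q) ⊛ P ⊕ (unit ⊕ Q) ⊛ P) ≈
  z ⊛ (((D ⊛ C ⊕ D ⊛ C) ⊕ (C ⊛ D ⊕ C ⊛ D)) ⊕ (P ⊛ unit ⊕ ((C ⊛ P ⊕ (C ⊛ P ⊕ C ⊛ P)) ⊕ (Y ⊛ P ⊕ Y ⊛ P))))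
D-equation = from-suc refl λ n → trans (cong₂ _+_ (gf-suc δ n) (trans (z⊛-suc _ n) (sym (trans (pairSum-+ _ _ n) (+-cong AP AP n)))))
  (trans (sym (pairSum-+ _ _ n)) (trans (total-cong (λ (l , r) → by-cases l r) (pairs trees trees n))
  (trans (pairSum-+ (λ l r → (δ l * one r + δ l * one r) + (one l * δ r + one l * δ r)) _ n)
    (cong₂ _+_ (trans (pairSum-+ (λ l r → δ l * one r + δ l * one r) _ n)
        (cong₂ _+_ (trans (pairSum-+ _ _ n) (+-cong DC DC n)) (trans (pairSum-+ _ _ n) (+-cong CD CD n))))
      (trans (pairSum-+ (λ l r → nonempty l * empty r) _ n) (cong₂ _+_ (pairSum-* {nonempty} {empty} (λ _ → refl) gf-empty n)
        (trans (pairSum-+ (λ l r → one l * nonempty r + (one l * nonempty r + one l * nonempty r)) _ n)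
          (cong₂ _+_ (trans (pairSum-+ (λ l r → one l * nonempty r) _ n) (cong₂ _+_ (CP n) (trans (pairSum-+ _ _ n) (+-cong CP CP n))))
            (trans (pairSum-+ _ _ n) (+-cong YP YP n))))))))))
  where
  AP : pairSum (λ l r → linkedBit l * nonempty r) ≈ (unit ⊕ Q) ⊛ P
  AP = pairSum-* {linkedBit} {nonempty} gf-linked (λ _ → refl)
  DC : pairSum (λ l r → δ l * one r) ≈ D ⊛ C
  DC = pairSum-* {δ} {one} (λ _ → refl) gf-one
  CD : pairSum (λ l r → one l * δ r) ≈ C ⊛ D
  CD = pairSum-* {one} {δ} gf-one (λ _ → refl)
  CP : pairSum (λ l r → one l * nonempty r) ≈ C ⊛ P
  CP = pairSum-* {one} {nonempty} gf-one (λ _ → refl)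
  YP : pairSum (λ l r → lastBit l * nonempty r) ≈ Y ⊛ P
  YP = pairSum-* {lastBit} {nonempty} (λ _ → refl) (λ _ → refl)
  steps : ∀ b → 1 + nodeStep true b + 2 * bit b ≡ 3
  steps false = refl
  steps true  = refl
  by-cases : ∀ l r → δ (node false l r) + δ (node true l r) + (linkedBit l * nonempty r + linkedBit l * nonempty r) ≡
    ((δ l * one r + δ l * one r) + (one l * δ r + one l * δ r)) +
    (nonempty l * empty r + ((one l * nonempty r + (one l * nonempty r + one l * nonempty r)) +
      (lastBit l * nonempty r + lastBit l * nonempty r)))
  by-cases nil nil = refl
  by-cases l@(node _ _ _) nil = solve 3 (λ d a y → (d :+ con 0) :+ (d :+ con 1) :+ (a :* con 0 :+ a :* con 0) :=
    ((d :* con 1 :+ d :* con 1) :+ con 0) :+ (con 1 :+ (con 0 :+ (y :* con 0 :+ y :* con 0))))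
    refl (δ l) (linkedBit l) (lastBit l)
    where open +-*-Solver
  by-cases l r@(node _ _ _) = trans
    (solve 5 (λ d e s a y → d :+ e :+ (con 1 :+ y) :+ (d :+ e :+ (s :+ y)) :+ (a :* con 1 :+ a :* con 1) :=
      d :+ d :+ e :+ e :+ y :+ y :+ (con 1 :+ s :+ con 2 :* a)) refl (δ l) (δ r) (nodeStep true (linked l)) (linkedBit l) (lastBit l))
    (trans (cong (δ l + δ l + δ r + δ r + lastBit l + lastBit l +_) (steps (linked l)))
    (solve 4 (λ d e y m → d :+ d :+ e :+ e :+ y :+ y :+ con 3 :=
      ((d :* con 1 :+ d :* con 1) :+ ((e :+ con 0) :+ (e :+ con 0))) :+
      (m :* con 0 :+ (con 3 :+ (y :* con 1 :+ y :* con 1)))) refl (δ l) (δ r) (lastBit l) (nonempty l)))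
    where open +-*-Solver

-- This is `θ` applied to `P-equation`, with `θ z = z`; `θ C = T` since `θ` kills the constant term.
T-equation : T ≈ z ⊛ (C ⊛ C ⊕ C ⊛ C) ⊕ z ⊛ ((T ⊛ C ⊕ C ⊛ T) ⊕ (T ⊛ C ⊕ C ⊛ T))
T-equation n = begin
  n * P n                            ≡⟨ cong (n *_) (P-equation n) ⟩
  θ (z ⊛ W) n                        ≡⟨ θ-leibniz z W n ⟩
  (θ z ⊛ W) n + (z ⊛ θ W) n          ≡⟨ cong₂ _+_ (⊛-cong θz (λ _ → refl) n) (⊛-cong {z} (λ _ → refl) θW n) ⟩
  (z ⊛ W) n + (z ⊛ ((T ⊛ C ⊕ C ⊛ T) ⊕ (T ⊛ C ⊕ C ⊛ T))) n ∎
  where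
  open ≡-Reasoning
  W = C ⊛ C ⊕ C ⊛ C
  θz : θ z ≈ z
  θz zero          = refl
  θz (suc zero)    = refl
  θz (suc (suc n)) = *-zeroʳ n
  θC : θ C ≈ T
  θC zero    = refl
  θC (suc n) = refl
  θCC : θ (C ⊛ C) ≈ T ⊛ C ⊕ C ⊛ T
  θCC n = trans (θ-leibniz C C n) (cong₂ _+_ (⊛-cong θC (λ _ → refl) n) (⊛-cong {C} (λ _ → refl) θC n))
  θW : θ W ≈ (T ⊛ C ⊕ C ⊛ T) ⊕ (T ⊛ C ⊕ C ⊛ T)
  θW n = trans (*-distribˡ-+ n ((C ⊛ C) n) ((C ⊛ C) n)) (cong₂ _+_ (θCC n) (θCC n))

module _ where

  open Solver sequences
  open Elimination sequences

  private
    e₁ = ≈-trans P-equation (solve 2 (λ z p → let one = con 1; two = one :+ one; c = one :+ p in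
      z :* (c :* c :+ c :* c) := two :* z :* (c :* c)) ≈-refl z P)

    e₂ = ≈-trans Q-equation (solve 3 (λ z p q → let one = con 1; two = one :+ one; c = one :+ p in
      z :* ((one :+ q) :* one :+ (c :* q :+ c :* q)) := z :* (one :+ q) :+ two :* z :* c :* q) ≈-refl z P Q)

    e₃ = ≈-trans Y-equation (solve 3 (λ z p y → let one = con 1; two = one :+ one; c = one :+ p in
      z :* (one :* one :+ ((y :* one :+ y :* one) :+ (c :* y :+ c :* y))) :=
      z :+ two :* z :* y :+ two :* z :* c :* y) ≈-refl z P Y)

    e₄ = ≈-trans (solve 4 (λ z p q d → let one = con 1; two = one :+ one in
        d :+ two :* z :* ((one :+ q) :* p) := d :+ z :* ((one :+ q) :* p :+ (one :+ q) :* p)) ≈-refl z P Q D)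
      (≈-trans D-equation (solve 4 (λ z p y d → let one = con 1; two = one :+ one; three = two :+ one; four = two :+ two; c = one :+ p in
        z :* (((d :* c :+ d :* c) :+ (c :* d :+ c :* d)) :+ (p :* one :+ ((c :* p :+ (c :* p :+ c :* p)) :+ (y :* p :+ y :* p)))) :=
        four :* z :* (d :* c) :+ z :* p :+ three :* z :* (c :* p) :+ two :* z :* (y :* p)) ≈-refl z P Y D))

    e₅ = ≈-trans T-equation (solve 3 (λ z p t → let one = con 1; two = one :+ one; four = two :+ two; c = one :+ p in
      z :* (c :* c :+ c :* c) :+ z :* ((t :* c :+ c :* t) :+ (t :* c :+ c :* t)) :=
      two :* z :* (c :* c) :+ four :* z :* (c :* t)) ≈-refl z P T)

    cancel : ∀ {a b : Sequence} c → a ⊕ c ≈ b ⊕ c → a ≈ b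
    cancel c eq n = +-cancelʳ-≡ (c n) _ _ (eq n)

  -- Multiples are spelled out as repeated sums: at an index these unfold to sums in ℕ, whereas a
  -- numeral of the semiring is a constant series to be convolved.
  central : B ⊕ (z ⊛ C ⊕ z ⊛ C ⊕ z ⊛ C ⊕ z ⊛ C) ≈
    unit ⊕ (z ⊛ B ⊕ z ⊛ B ⊕ z ⊛ B ⊕ z ⊛ B ⊕ z ⊛ B ⊕ z ⊛ B ⊕ z ⊛ B ⊕ z ⊛ B)
  central = ≈-trans (solve 3 (λ z c b → let one = con 1; two = one :+ one; four = two :+ two in
      b :+ (z :* c :+ z :* c :+ z :* c :+ z :* c) := b :+ four :* z :* c) ≈-refl z C B)
    (≈-trans (central-recurrence cancel e₁ e₂ e₃ e₄ e₅)
    (solve 2 (λ z b → let one = con 1; two = one :+ one; four = two :+ two in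
      one :+ (four :+ four) :* z :* b :=
      one :+ (z :* b :+ z :* b :+ z :* b :+ z :* b :+ z :* b :+ z :* b :+ z :* b :+ z :* b)) ≈-refl z B))

  distances : z ⊛ D ⊕ z ⊛ D ⊕ (z ⊛ (z ⊛ D) ⊕ z ⊛ (z ⊛ D)) ⊕
      (z ⊛ B ⊕ z ⊛ B ⊕ z ⊛ B ⊕ z ⊛ B ⊕ z ⊛ B ⊕ z ⊛ B ⊕ z ⊛ B) ⊕ unit ≈
    B ⊕ (z ⊛ (z ⊛ B) ⊕ z ⊛ (z ⊛ B) ⊕ z ⊛ (z ⊛ B) ⊕ z ⊛ (z ⊛ B)) ⊕ (z ⊕ z ⊕ z)
  distances = ≈-trans (solve 3 (λ z d b → let one = con 1; two = one :+ one; three = two :+ one; four = two :+ two in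
      z :* d :+ z :* d :+ (z :* (z :* d) :+ z :* (z :* d)) :+
        (z :* b :+ z :* b :+ z :* b :+ z :* b :+ z :* b :+ z :* b :+ z :* b) :+ one :=
      two :* z :* ((one :+ z) :* d) :+ (four :+ three) :* z :* b :+ one) ≈-refl z D B)
    (≈-trans (distance-equation cancel e₁ e₂ e₃ e₄ e₅)
    (solve 2 (λ z b → let one = con 1; two = one :+ one; three = two :+ one; four = two :+ two in
      b :+ four :* (z :* z) :* b :+ three :* z :=
      b :+ (z :* (z :* b) :+ z :* (z :* b) :+ z :* (z :* b) :+ z :* (z :* b)) :+ (z :+ z :+ z)) ≈-refl z B))

-- Recurrences for the coefficients

B-≡ : ∀ n → B n ≡ suc n * C n
B-≡ zero    = refl
B-≡ (suc n) = refl

-- The coefficient of `z^(n+1)` in `central`; substituting `B n = (n + 1) C n` leaves two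
-- consecutive values of `C`. It is the Catalan recurrence with a factor 2 for the extra flag.
C-recurrence : ∀ n → (2 + n) * C (suc n) ≡ (8 * n + 4) * C n
C-recurrence n = +-cancelʳ-≡ (4 * C n) _ _ (begin
  (2 + n) * C (suc n) + 4 * C n              ≡⟨ cong (_+ 4 * C n) (sym (B-≡ (suc n))) ⟩
  B (suc n) + 4 * C n                        ≡⟨ solve 2 (λ b c → b :+ con 4 :* c := b :+ (c :+ c :+ c :+ c)) refl (B (suc n)) (C n) ⟩
  B (suc n) + (C n + C n + C n + C n)        ≡⟨ cong (λ c → B (suc n) + (c + c + c + c)) (z⊛-suc C n) ⟨
  (B ⊕ (z ⊛ C ⊕ z ⊛ C ⊕ z ⊛ C ⊕ z ⊛ C)) (suc n) ≡⟨ central (suc n) ⟩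
  zB + zB + zB + zB + zB + zB + zB + zB      ≡⟨ cong (λ b → b + b + b + b + b + b + b + b) (trans (z⊛-suc B n) (B-≡ n)) ⟩
  b + b + b + b + b + b + b + b              ≡⟨ solve 2 (λ n c → let b = (con 1 :+ n) :* c in
                                                  b :+ b :+ b :+ b :+ b :+ b :+ b :+ b := (con 8 :* n :+ con 4) :* c :+ con 4 :* c)
                                                  refl n (C n) ⟩
  (8 * n + 4) * C n + 4 * C n                ∎)
  where
  open ≡-Reasoning
  open +-*-Solver
  zB = (z ⊛ B) (suc n)
  b = suc n * C n

-- The coefficient of `z^(n+2)` in `distances`, where the polynomial terms `1` and `3z` contribute
-- nothing.
D-recurrence : ∀ n → 2 * D (suc n) + 2 * D n + 7 * B (suc n) ≡ B (2 + n) + 4 * B n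
D-recurrence n = begin
  2 * D (suc n) + 2 * D n + 7 * B (suc n)
    ≡⟨ solve 3 (λ d e b → con 2 :* d :+ con 2 :* e :+ con 7 :* b :=
         d :+ d :+ (e :+ e) :+ (b :+ b :+ b :+ b :+ b :+ b :+ b) :+ con 0) refl (D (suc n)) (D n) (B (suc n)) ⟩
  lhs (D (suc n)) (D n) (B (suc n))
    ≡⟨ cong₂ (λ d e → lhs d e (B (suc n))) (z⊛-suc D (suc n)) (shift² D) ⟨
  lhs ((z ⊛ D) (2 + n)) ((z ⊛ (z ⊛ D)) (2 + n)) (B (suc n))
    ≡⟨ cong (lhs ((z ⊛ D) (2 + n)) ((z ⊛ (z ⊛ D)) (2 + n))) (z⊛-suc B (suc n)) ⟨
  lhs ((z ⊛ D) (2 + n)) ((z ⊛ (z ⊛ D)) (2 + n)) ((z ⊛ B) (2 + n))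
    ≡⟨ distances (2 + n) ⟩
  B (2 + n) + (zzB + zzB + zzB + zzB) + 0
    ≡⟨ cong (λ b → B (2 + n) + (b + b + b + b) + 0) (shift² B) ⟩
  B (2 + n) + (B n + B n + B n + B n) + 0
    ≡⟨ solve 2 (λ c b → c :+ (b :+ b :+ b :+ b) :+ con 0 := c :+ con 4 :* b) refl (B (2 + n)) (B n) ⟩
  B (2 + n) + 4 * B n ∎
  where
  open ≡-Reasoning
  open +-*-Solver
  shift² : ∀ a → (z ⊛ (z ⊛ a)) (2 + n) ≡ a n
  shift² a = trans (z⊛-suc (z ⊛ a) (suc n)) (z⊛-suc a n)
  zzB = (z ⊛ (z ⊛ B)) (2 + n)
  lhs : ℕ → ℕ → ℕ → ℕ
  lhs d e b = d + d + (e + e) + (b + b + b + b + b + b + b) + 0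

-- For the averages dₙ = D n / C n this says (8n + 4) dₙ₊₁ + (n + 2) dₙ = 6n².
distance-recurrence : ∀ n → (2 + n) * (D (suc n) + D n) ≡ 6 * (n * n) * C n
distance-recurrence n = *-cancelˡ-≡ _ _ 2 (+-cancelʳ-≡ (7 * (2 + n) * ((8 * n + 4) * C n)) _ _ (begin
  2 * ((2 + n) * (D (suc n) + D n)) + 7 * (2 + n) * ((8 * n + 4) * C n)
    ≡⟨ cong (λ b → 2 * ((2 + n) * (D (suc n) + D n)) + 7 * (2 + n) * b) (sym (trans (B-≡ (suc n)) (C-recurrence n))) ⟩
  2 * ((2 + n) * (D (suc n) + D n)) + 7 * (2 + n) * B (suc n)
    ≡⟨ solve 4 (λ n d e b → con 2 :* ((con 2 :+ n) :* (d :+ e)) :+ con 7 :* (con 2 :+ n) :* b :=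
         (con 2 :+ n) :* (con 2 :* d :+ con 2 :* e :+ con 7 :* b)) refl n (D (suc n)) (D n) (B (suc n)) ⟩
  (2 + n) * (2 * D (suc n) + 2 * D n + 7 * B (suc n))
    ≡⟨ cong ((2 + n) *_) (D-recurrence n) ⟩
  (2 + n) * (B (2 + n) + 4 * B n)
    ≡⟨ cong₂ (λ b c → (2 + n) * (b + 4 * c)) (trans (B-≡ (2 + n)) (C-recurrence (suc n))) (B-≡ n) ⟩
  (2 + n) * ((8 * suc n + 4) * C (suc n) + 4 * (suc n * C n))
    ≡⟨ solve 3 (λ n c e → (con 2 :+ n) :* ((con 8 :* (con 1 :+ n) :+ con 4) :* c :+ con 4 :* ((con 1 :+ n) :* e)) :=
         (con 8 :* (con 1 :+ n) :+ con 4) :* ((con 2 :+ n) :* c) :+ (con 2 :+ n) :* (con 4 :* ((con 1 :+ n) :* e)))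
         refl n (C (suc n)) (C n) ⟩
  (8 * suc n + 4) * ((2 + n) * C (suc n)) + (2 + n) * (4 * (suc n * C n))
    ≡⟨ cong (λ c → (8 * suc n + 4) * c + (2 + n) * (4 * (suc n * C n))) (C-recurrence n) ⟩
  (8 * suc n + 4) * ((8 * n + 4) * C n) + (2 + n) * (4 * (suc n * C n))
    ≡⟨ solve 2 (λ n c → (con 8 :* (con 1 :+ n) :+ con 4) :* ((con 8 :* n :+ con 4) :* c) :+ (con 2 :+ n) :* (con 4 :* ((con 1 :+ n) :* c)) :=
         con 2 :* (con 6 :* (n :* n) :* c) :+ con 7 :* (con 2 :+ n) :* ((con 8 :* n :+ con 4) :* c)) refl n (C n) ⟩
  2 * (6 * (n * n) * C n) + 7 * (2 + n) * ((8 * n + 4) * C n) ∎))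
  where
  open ≡-Reasoning
  open +-*-Solver

-- Asymptotics

open import Data.Integer.Base using (+_; -[1+_])

-- 27 C n times the deviation of the average distance from 2n/3 - 28/27.
deviation : ℕ → ℤ
deviation n = + (27 * D n + 28 * C n) ℤ.- + (18 * (n * C n))

difference-step : ∀ k {a a′ b b′ c} → k * (a′ + a) ≡ k * (b′ + b) + c →
  + k ℤ.* (+ a′ ℤ.- + b′) ≡ + c ℤ.- + k ℤ.* (+ a ℤ.- + b)
difference-step k {a} {a′} {b} {b′} {c} eq = begin
  + k ℤ.* (+ a′ ℤ.- + b′)
    ≡⟨ solve 4 (λ k a a′ b′ → k :* (a′ :- b′) := k :* (a′ :+ a) :- k :* a :- k :* b′) refl (+ k) (+ a) (+ a′) (+ b′) ⟩
  + k ℤ.* + (a′ + a) ℤ.- + k ℤ.* + a ℤ.- + k ℤ.* + b′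
    ≡⟨ cong (λ s → s ℤ.- + k ℤ.* + a ℤ.- + k ℤ.* + b′) (trans (sym (ℤ.pos-* k (a′ + a)))
         (trans (cong +_ eq) (cong (ℤ._+ + c) (ℤ.pos-* k (b′ + b))))) ⟩
  + k ℤ.* (+ b′ ℤ.+ + b) ℤ.+ + c ℤ.- + k ℤ.* + a ℤ.- + k ℤ.* + b′
    ≡⟨ solve 5 (λ k a b b′ c → k :* (b′ :+ b) :+ c :- k :* a :- k :* b′ := c :- k :* (a :- b)) refl (+ k) (+ a) (+ b) (+ b′) (+ c) ⟩
  + c ℤ.- + k ℤ.* (+ a ℤ.- + b) ∎
  where
  open ≡-Reasoning
  open ℤSolver.+-*-Solver

-- Putting x = 2n/3 - 28/27 and its successor x′ into `(8n + 4) x′ + (n + 2) x` gives `6n² - 32/9`: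
-- the quadratic and linear coefficients agree with `6n²`, and 96 = 27 · 32/9 is what remains.
deviation-recurrence : ∀ n → + (2 + n) ℤ.* deviation (suc n) ≡ + (96 * C n) ℤ.- + (2 + n) ℤ.* deviation n
deviation-recurrence n = difference-step (2 + n) {27 * D n + 28 * C n} {27 * D (suc n) + 28 * C (suc n)}
  {18 * (n * C n)} {18 * (suc n * C (suc n))} {96 * C n} (begin
  (2 + n) * (27 * D (suc n) + 28 * C (suc n) + (27 * D n + 28 * C n))
    ≡⟨ solve 5 (λ n d e b c → (con 2 :+ n) :* (con 27 :* d :+ con 28 :* b :+ (con 27 :* e :+ con 28 :* c)) :=
         con 27 :* ((con 2 :+ n) :* (d :+ e)) :+ con 28 :* ((con 2 :+ n) :* b) :+ con 28 :* ((con 2 :+ n) :* c))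
         refl n (D (suc n)) (D n) (C (suc n)) (C n) ⟩
  27 * ((2 + n) * (D (suc n) + D n)) + 28 * ((2 + n) * C (suc n)) + 28 * ((2 + n) * C n)
    ≡⟨ cong₂ (λ d b → 27 * d + 28 * b + 28 * ((2 + n) * C n)) (distance-recurrence n) (C-recurrence n) ⟩
  27 * (6 * (n * n) * C n) + 28 * ((8 * n + 4) * C n) + 28 * ((2 + n) * C n)
    ≡⟨ solve 2 (λ n c → con 27 :* (con 6 :* (n :* n) :* c) :+ con 28 :* ((con 8 :* n :+ con 4) :* c) :+ con 28 :* ((con 2 :+ n) :* c) :=
         con 18 :* ((con 1 :+ n) :* ((con 8 :* n :+ con 4) :* c)) :+ con 18 :* ((con 2 :+ n) :* (n :* c)) :+ con 96 :* c) refl n (C n) ⟩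
  18 * (suc n * ((8 * n + 4) * C n)) + 18 * ((2 + n) * (n * C n)) + 96 * C n
    ≡⟨ cong (λ b → 18 * (suc n * b) + 18 * ((2 + n) * (n * C n)) + 96 * C n) (sym (C-recurrence n)) ⟩
  18 * (suc n * ((2 + n) * C (suc n))) + 18 * ((2 + n) * (n * C n)) + 96 * C n
    ≡⟨ solve 3 (λ n b c → con 18 :* ((con 1 :+ n) :* ((con 2 :+ n) :* b)) :+ con 18 :* ((con 2 :+ n) :* (n :* c)) :+ con 96 :* c :=
         (con 2 :+ n) :* (con 18 :* ((con 1 :+ n) :* b) :+ con 18 :* (n :* c)) :+ con 96 :* c) refl n (C (suc n)) (C n) ⟩
  (2 + n) * (18 * (suc n * C (suc n)) + 18 * (n * C n)) + 96 * C n ∎)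
  where
  open ≡-Reasoning
  open +-*-Solver

-- Per C n, the recurrence damps the deviation by a factor tending to 1/8.
deviation-bound : ∀ k → suc k * ℤ.∣ deviation (suc k) ∣ ≤ 54 * C (suc k)
-- Since the deviation carries a factor 27, the constant 54 bounds the error of the average by 2/n.
deviation-bound zero = ≤ᵇ⇒≤ (1 * ℤ.∣ deviation 1 ∣) (54 * C 1) tt
deviation-bound (suc k) = *-cancelˡ-≤ (n * m) (begin
  n * m * (suc n * e′)
    ≡⟨ solve 3 (λ n m e → n :* m :* ((con 1 :+ n) :* e) := n :* (con 1 :+ n) :* (m :* e)) refl n m e′ ⟩
  n * suc n * (m * e′)
    ≤⟨ *-monoʳ-≤ (n * suc n) step ⟩
  n * suc n * (96 * c + m * e)
    ≡⟨ solve 4 (λ n m c e → n :* (con 1 :+ n) :* (con 96 :* c :+ m :* e) :=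
         con 96 :* (n :* (con 1 :+ n)) :* c :+ (con 1 :+ n) :* m :* (n :* e)) refl n m c e ⟩
  96 * (n * suc n) * c + suc n * m * (n * e)
    ≤⟨ +-monoʳ-≤ (96 * (n * suc n) * c) (*-monoʳ-≤ (suc n * m) (deviation-bound k)) ⟩
  96 * (n * suc n) * c + suc n * m * (54 * c)
    -- The slack is `54n(8n + 4) - 96n(n + 1) - 54(n + 1)(n + 2) = 282n² - 42n -
    -- 108`, rewritten in `k = n - 1` to have positive coefficients.
    ≤⟨ m≤m+n _ ((282 * (k * k) + 522 * k + 132) * c) ⟩
  96 * (n * suc n) * c + suc n * m * (54 * c) + (282 * (k * k) + 522 * k + 132) * c
    ≡⟨ solve 2 (λ k c → let n = con 1 :+ k in
         con 96 :* (n :* (con 1 :+ n)) :* c :+ (con 1 :+ n) :* (con 2 :+ n) :* (con 54 :* c)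
           :+ (con 282 :* (k :* k) :+ con 522 :* k :+ con 132) :* c :=
         n :* (con 54 :* ((con 8 :* n :+ con 4) :* c))) refl k c ⟩
  n * (54 * ((8 * n + 4) * c))
    ≡⟨ cong (λ b → n * (54 * b)) (sym (C-recurrence n)) ⟩
  n * (54 * (m * C (suc n)))
    ≡⟨ solve 3 (λ n m c → n :* (con 54 :* (m :* c)) := n :* m :* (con 54 :* c)) refl n m (C (suc n)) ⟩
  n * m * (54 * C (suc n)) ∎)
  where
  open ≤-Reasoning
  open +-*-Solver
  n = suc k
  m = 2 + n
  c = C n
  e = ℤ.∣ deviation n ∣
  e′ = ℤ.∣ deviation (suc n) ∣
  step : m * e′ ≤ 96 * c + m * e
  step = begin
    m * e′                                         ≡⟨ ℤ.abs-* (+ m) (deviation (suc n)) ⟨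
    ℤ.∣ + m ℤ.* deviation (suc n) ∣                ≡⟨ cong ℤ.∣_∣ (deviation-recurrence n) ⟩
    ℤ.∣ + (96 * c) ℤ.- + m ℤ.* deviation n ∣       ≤⟨ ℤ.∣i-j∣≤∣i∣+∣j∣ (+ (96 * c)) (+ m ℤ.* deviation n) ⟩
    96 * c + ℤ.∣ + m ℤ.* deviation n ∣             ≡⟨ cong (_+_ (96 * c)) (ℤ.abs-* (+ m) (deviation n)) ⟩
    96 * c + m * e                                 ∎

-- The closed form obeys the recurrence of `C`, which identifies the number of flagged trees with
-- `2^n` times the Catalan number.
C-closed : ∀ n → C n * (n ! * suc n !) ≡ 2 ^ n * (2 * n) !
C-closed zero    = refl
C-closed (suc n) = begin
  C (suc n) * (suc n * n ! * ((2 + n) * suc n !))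
    ≡⟨ solve 4 (λ n c f g → c :* ((con 1 :+ n) :* f :* ((con 2 :+ n) :* g)) :=
         (con 1 :+ n) :* (((con 2 :+ n) :* c) :* (f :* g))) refl n (C (suc n)) (n !) (suc n !) ⟩
  suc n * ((2 + n) * C (suc n) * (n ! * suc n !))
    ≡⟨ cong (λ c → suc n * (c * (n ! * suc n !))) (C-recurrence n) ⟩
  suc n * ((8 * n + 4) * C n * (n ! * suc n !))
    ≡⟨ cong (suc n *_) (trans (*-assoc (8 * n + 4) (C n) _) (cong ((8 * n + 4) *_) (C-closed n))) ⟩
  suc n * ((8 * n + 4) * (2 ^ n * (2 * n) !))
    ≡⟨ solve 3 (λ n p f → (con 1 :+ n) :* ((con 8 :* n :+ con 4) :* (p :* f)) :=
         (con 2 :* p) :* ((con 2 :+ con 2 :* n) :* ((con 1 :+ con 2 :* n) :* f))) refl n (2 ^ n) ((2 * n) !) ⟩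
  2 * 2 ^ n * ((2 + 2 * n) * ((1 + 2 * n) * (2 * n) !))
    ≡⟨ cong (λ m → 2 * 2 ^ n * m !) (sym (*-suc 2 n)) ⟩
  2 ^ suc n * (2 * suc n) ! ∎
  where
  open ≡-Reasoning
  open +-*-Solver

C-nonZero : ∀ n → NonZero (C n)
C-nonZero n = m*n≢0⇒m≢0 (C n) ⦃ subst NonZero (sym (C-closed n)) (m*n≢0 (2 ^ n) ((2 * n) !) ⦃ m^n≢0 2 n ⦄ ⦃ (2 * n) !≢0 ⦄) ⦄

-- Passage to the rationals

embed : ℤ → ℚ
embed i = i / 1

toℚᵘ-embed : ∀ i → ℚ.toℚᵘ (embed i) ℚᵘ.≃ mkℚᵘ i 0
toℚᵘ-embed i = ℚ.toℚᵘ-fromℚᵘ (mkℚᵘ i 0)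

embed-* : ∀ i j → embed i ℚ.* embed j ≡ embed (i ℤ.* j)
embed-* i j = ℚ.toℚᵘ-injective (begin
  ℚ.toℚᵘ (embed i ℚ.* embed j)                ≈⟨ ℚ.toℚᵘ-homo-* (embed i) (embed j) ⟩
  ℚ.toℚᵘ (embed i) ℚᵘ.* ℚ.toℚᵘ (embed j)      ≈⟨ ℚᵘ.*-cong (toℚᵘ-embed i) (toℚᵘ-embed j) ⟩
  mkℚᵘ i 0 ℚᵘ.* mkℚᵘ j 0                      ≈⟨ *≡* refl ⟩
  mkℚᵘ (i ℤ.* j) 0                            ≈⟨ toℚᵘ-embed (i ℤ.* j) ⟨
  ℚ.toℚᵘ (embed (i ℤ.* j))                    ∎)
  where open ℚᵘ.≃-Reasoning

embed-+ : ∀ i j → embed i ℚ.+ embed j ≡ embed (i ℤ.+ j)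
embed-+ i j = ℚ.toℚᵘ-injective (begin
  ℚ.toℚᵘ (embed i ℚ.+ embed j)                ≈⟨ ℚ.toℚᵘ-homo-+ (embed i) (embed j) ⟩
  ℚ.toℚᵘ (embed i) ℚᵘ.+ ℚ.toℚᵘ (embed j)      ≈⟨ ℚᵘ.+-cong (toℚᵘ-embed i) (toℚᵘ-embed j) ⟩
  mkℚᵘ i 0 ℚᵘ.+ mkℚᵘ j 0                      ≈⟨ *≡* (cong (ℤ._* + 1) (cong₂ ℤ._+_ (ℤ.*-identityʳ i) (ℤ.*-identityʳ j))) ⟩
  mkℚᵘ (i ℤ.+ j) 0                            ≈⟨ toℚᵘ-embed (i ℤ.+ j) ⟨
  ℚ.toℚᵘ (embed (i ℤ.+ j))                    ∎)
  where open ℚᵘ.≃-Reasoning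

embed-neg : ∀ i → - embed i ≡ embed (ℤ.- i)
embed-neg i = ℚ.toℚᵘ-injective (begin
  ℚ.toℚᵘ (- embed i)                          ≈⟨ ℚ.toℚᵘ-homo‿- (embed i) ⟩
  ℚᵘ.- ℚ.toℚᵘ (embed i)                       ≈⟨ ℚᵘ.-‿cong (toℚᵘ-embed i) ⟩
  mkℚᵘ (ℤ.- i) 0                              ≈⟨ toℚᵘ-embed (ℤ.- i) ⟨
  ℚ.toℚᵘ (embed (ℤ.- i))                      ∎)
  where open ℚᵘ.≃-Reasoning

embed-∣∣ : ∀ i → ℚ.∣ embed i ∣ ≡ embed (+ ℤ.∣ i ∣)
embed-∣∣ i = ℚ.toℚᵘ-injective (begin
  ℚ.toℚᵘ ℚ.∣ embed i ∣                        ≈⟨ ℚ.toℚᵘ-homo-∣-∣ (embed i) ⟩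
  ℚᵘ.∣ ℚ.toℚᵘ (embed i) ∣                     ≈⟨ ℚᵘ.∣-∣-cong (toℚᵘ-embed i) ⟩
  mkℚᵘ (+ ℤ.∣ i ∣) 0                          ≈⟨ toℚᵘ-embed (+ ℤ.∣ i ∣) ⟨
  ℚ.toℚᵘ (embed (+ ℤ.∣ i ∣))                  ∎)
  where open ℚᵘ.≃-Reasoning

embed-< : ∀ {i j} → i ℤ.< j → embed i ℚ.< embed j
embed-< {i} {j} i<j = ℚ.toℚᵘ-cancel-< (ℚᵘ.<-respˡ-≃ (ℚᵘ.≃-sym (toℚᵘ-embed i)) (ℚᵘ.<-respʳ-≃ (ℚᵘ.≃-sym (toℚᵘ-embed j))
  (*<* (subst₂ ℤ._<_ (sym (ℤ.*-identityʳ i)) (sym (ℤ.*-identityʳ j)) i<j))))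

embed-pos : ∀ n .{{_ : NonZero n}} → ℚ.Positive (embed (+ n))
embed-pos n = ℚ.normalize-pos n 1

/-*-embed : ∀ i n .{{_ : NonZero n}} → (i / n) ℚ.* embed (+ n) ≡ embed i
/-*-embed i (suc n) = ℚ.toℚᵘ-injective (begin
  ℚ.toℚᵘ ((i / suc n) ℚ.* embed (+ suc n))              ≈⟨ ℚ.toℚᵘ-homo-* (i / suc n) (embed (+ suc n)) ⟩
  ℚ.toℚᵘ (i / suc n) ℚᵘ.* ℚ.toℚᵘ (embed (+ suc n))      ≈⟨ ℚᵘ.*-cong (ℚ.toℚᵘ-fromℚᵘ (mkℚᵘ i n)) (toℚᵘ-embed (+ suc n)) ⟩
  mkℚᵘ i n ℚᵘ.* mkℚᵘ (+ suc n) 0                        ≈⟨ *≡* (trans (ℤ.*-identityʳ (i ℤ.* + suc n)) (cong (λ m → i ℤ.* + m) (sym (*-identityʳ (suc n))))) ⟩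
  mkℚᵘ i 0                                              ≈⟨ toℚᵘ-embed i ⟨
  ℚ.toℚᵘ (embed i)                                      ∎)
  where open ℚᵘ.≃-Reasoning

*-cancelʳ-pos : ∀ r .{{_ : ℚ.Positive r}} {p q} → p ℚ.* r ≡ q ℚ.* r → p ≡ q
*-cancelʳ-pos r eq = ℚ.≤-antisym (ℚ.*-cancelʳ-≤-pos r (ℚ.≤-reflexive eq)) (ℚ.*-cancelʳ-≤-pos r (ℚ.≤-reflexive (sym eq)))

module _ (k : ℕ) where

  private
    n G′ F : ℕ
    n = suc k
    G′ = n ! * suc n !
    F = (2 * n) !

    instance
      G′≢0 : NonZero G′
      G′≢0 = n !* suc n !≢0

    N : ℚ
    N = normalizer n

  C-normalizer : embed (+ C n) ≡ embed (+ 2) ℚ.* N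
  C-normalizer = *-cancelʳ-pos (embed (+ G′)) {{embed-pos G′}} (begin
    embed (+ C n) ℚ.* embed (+ G′)                   ≡⟨ embed-* (+ C n) (+ G′) ⟩
    embed (+ C n ℤ.* + G′)                           ≡⟨ cong embed (trans (sym (ℤ.pos-* (C n) G′)) (cong +_ (C-closed n))) ⟩
    embed (+ (2 * 2 ^ k * F))                        ≡⟨ cong embed (trans (cong +_ (*-assoc 2 (2 ^ k) F)) (ℤ.pos-* 2 (2 ^ k * F))) ⟩
    embed (+ 2 ℤ.* + (2 ^ k * F))                    ≡⟨ embed-* (+ 2) (+ (2 ^ k * F)) ⟨
    embed (+ 2) ℚ.* embed (+ (2 ^ k * F))            ≡⟨ cong (λ i → embed (+ 2) ℚ.* embed i) (ℤ.pos-* (2 ^ k) F) ⟩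
    embed (+ 2) ℚ.* embed (+ (2 ^ k) ℤ.* + F)        ≡⟨ cong (embed (+ 2) ℚ.*_) (embed-* (+ (2 ^ k)) (+ F)) ⟨
    embed (+ 2) ℚ.* (p ℚ.* embed (+ F))              ≡⟨ cong (λ f → embed (+ 2) ℚ.* (p ℚ.* f)) (/-*-embed (+ F) G′) ⟨
    embed (+ 2) ℚ.* (p ℚ.* (Cat n ℚ.* embed (+ G′))) ≡⟨ cong (embed (+ 2) ℚ.*_) (ℚ.*-assoc p (Cat n) (embed (+ G′))) ⟨
    embed (+ 2) ℚ.* (N ℚ.* embed (+ G′))             ≡⟨ ℚ.*-assoc (embed (+ 2)) N (embed (+ G′)) ⟨
    embed (+ 2) ℚ.* N ℚ.* embed (+ G′)               ∎)
    where
    open ≡-Reasoning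
    p = embed (+ (2 ^ k))

  -- The spare bit doubles the normaliser (`C-normalizer`) and the total distance (`sum-δ`) alike,
  -- so it cancels in the average.
  d-* : d n ℚ.* embed (+ C n) ≡ embed (+ D n)
  d-* = begin
    d n ℚ.* embed (+ C n)                               ≡⟨ cong (d n ℚ.*_) C-normalizer ⟩
    1/N ℚ.* t ℚ.* (embed (+ 2) ℚ.* N)                   ≡⟨ solve 4 (λ i t c n → i :* t :* (c :* n) := i :* n :* (c :* t)) refl 1/N t (embed (+ 2)) N ⟩
    1/N ℚ.* N ℚ.* (embed (+ 2) ℚ.* t)                   ≡⟨ cong (ℚ._* (embed (+ 2) ℚ.* t)) (ℚ.*-inverseˡ N {{normalizer-nonZero n}}) ⟩
    1ℚ ℚ.* (embed (+ 2) ℚ.* t)                          ≡⟨ ℚ.*-identityˡ (embed (+ 2) ℚ.* t) ⟩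
    embed (+ 2) ℚ.* t                                   ≡⟨ embed-* (+ 2) (+ totalDistance n) ⟩
    embed (+ 2 ℤ.* + totalDistance n)                   ≡⟨ cong embed (trans (sym (ℤ.pos-* 2 (totalDistance n))) (cong +_ (sym (sum-δ k)))) ⟩
    embed (+ D n)                                       ∎
    where
    open ≡-Reasoning
    open ℚSolver.+-*-Solver
    1/N = (1/ N) {{normalizer-nonZero n}}
    t = embed (+ totalDistance n)

  private
    ℓ y r : ℚ
    ℓ = - (+ 28 / 27)
    y = (d n - (+ 2 / 3) ℚ.* embed (+ n)) - ℓ
    r = embed (+ 27) ℚ.* embed (+ C n)

  deviation-* : y ℚ.* r ≡ embed (deviation n)
  deviation-* = begin
    y ℚ.* (e27 ℚ.* c)
      -- The rearrangement leaves the closed products `- (ℓ * 27)` and `2/3 * 27`, which evaluate to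
      -- 28 and 18.
      ≡⟨ solve 6 (λ d a m ℓ k c → (d :- a :* m :- ℓ) :* (k :* c) := (k :* (d :* c) :+ :- (ℓ :* k) :* c) :+ :- (a :* k :* (m :* c)))
           refl (d n) (+ 2 / 3) (embed (+ n)) ℓ e27 c ⟩
    (e27 ℚ.* (d n ℚ.* c) ℚ.+ embed (+ 28) ℚ.* c) ℚ.+ - (embed (+ 18) ℚ.* (embed (+ n) ℚ.* c))
      ≡⟨ cong₂ (λ u v → (e27 ℚ.* u ℚ.+ embed (+ 28) ℚ.* c) ℚ.+ - (embed (+ 18) ℚ.* v)) d-* (embed-*ℕ n (C n)) ⟩
    (e27 ℚ.* embed (+ D n) ℚ.+ embed (+ 28) ℚ.* c) ℚ.+ - (embed (+ 18) ℚ.* embed (+ (n * C n)))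
      ≡⟨ cong₂ (λ u v → u ℚ.+ - v) (trans (cong₂ ℚ._+_ (embed-*ℕ 27 (D n)) (embed-*ℕ 28 (C n))) (embed-+ (+ (27 * D n)) (+ (28 * C n))))
           (embed-*ℕ 18 (n * C n)) ⟩
    embed (+ (27 * D n + 28 * C n)) ℚ.+ - embed (+ (18 * (n * C n)))
      ≡⟨ trans (cong (embed (+ (27 * D n + 28 * C n)) ℚ.+_) (embed-neg (+ (18 * (n * C n)))))
           (embed-+ (+ (27 * D n + 28 * C n)) (ℤ.- + (18 * (n * C n)))) ⟩
    embed (deviation n) ∎
    where
    open ≡-Reasoning
    open ℚSolver.+-*-Solver
    e27 c : ℚ
    e27 = embed (+ 27)
    c = embed (+ C n)
    embed-*ℕ : ∀ i j → embed (+ i) ℚ.* embed (+ j) ≡ embed (+ (i * j))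
    embed-*ℕ i j = trans (embed-* (+ i) (+ j)) (cong embed (sym (ℤ.pos-* i j)))

  private
    -- The error is at most `2/n`, and ε with numerator `suc p` and denominator `suc q` is at least
    -- `1/(q + 1)`; so a threshold depending on the denominator alone suffices.
    bound-step : ∀ p q → 2 * suc q < n → ℤ.∣ deviation n ∣ * suc q < suc p * (27 * C n)
    bound-step p q 2q<n = *-cancelˡ-< n _ _ (begin-strict
      n * (e * suc q)              ≡⟨ *-assoc n e (suc q) ⟨
      n * e * suc q                ≤⟨ *-monoˡ-≤ (suc q) (deviation-bound k) ⟩
      54 * C n * suc q             ≡⟨ solve 2 (λ c q → con 54 :* c :* q := con 27 :* c :* (con 2 :* q)) refl (C n) (suc q) ⟩
      27 * C n * (2 * suc q)       <⟨ *-monoʳ-< (27 * C n) {{m*n≢0 27 (C n) {{_}} {{C-nonZero n}}}} 2q<n ⟩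
      27 * C n * n                 ≤⟨ *-monoˡ-≤ n (m≤m+n (27 * C n) (p * (27 * C n))) ⟩
      suc p * (27 * C n) * n       ≡⟨ *-comm (suc p * (27 * C n)) n ⟩
      n * (suc p * (27 * C n))     ∎)
      where
      open ≤-Reasoning
      open +-*-Solver
      e = ℤ.∣ deviation n ∣

  deviation-< : ∀ p q .(c : Coprime (suc p) (suc q)) → 2 * suc q < n → ℚ.∣ y ∣ ℚ.< mkℚ (+ suc p) q c
  deviation-< p q c 2q<n = ℚ.*-cancelʳ-<-nonNeg (r ℚ.* s) {{ℚ.pos⇒nonNeg (r ℚ.* s) {{rs-pos}}}} (subst₂ ℚ._<_ lhs rhs
    (embed-< (ℤ.+<+ (bound-step p q 2q<n))))
    where
    s ε : ℚ
    s = embed (+ suc q)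
    ε = mkℚ (+ suc p) q c
    instance
      C≢0 : NonZero (C n)
      C≢0 = C-nonZero n
    r-pos : ℚ.Positive r
    r-pos = ℚ.pos*pos⇒pos (embed (+ 27)) (embed (+ C n)) {{embed-pos (C n)}}
    rs-pos : ℚ.Positive (r ℚ.* s)
    rs-pos = ℚ.pos*pos⇒pos r {{r-pos}} s {{embed-pos (suc q)}}
    lhs : embed (+ (ℤ.∣ deviation n ∣ * suc q)) ≡ ℚ.∣ y ∣ ℚ.* (r ℚ.* s)
    lhs = begin
      embed (+ (ℤ.∣ deviation n ∣ * suc q))              ≡⟨ cong embed (ℤ.pos-* ℤ.∣ deviation n ∣ (suc q)) ⟩
      embed (+ ℤ.∣ deviation n ∣ ℤ.* + suc q)            ≡⟨ embed-* (+ ℤ.∣ deviation n ∣) (+ suc q) ⟨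
      embed (+ ℤ.∣ deviation n ∣) ℚ.* s                  ≡⟨ cong (ℚ._* s) (embed-∣∣ (deviation n)) ⟨
      ℚ.∣ embed (deviation n) ∣ ℚ.* s                    ≡⟨ cong (λ v → ℚ.∣ v ∣ ℚ.* s) deviation-* ⟨
      ℚ.∣ y ℚ.* r ∣ ℚ.* s                                ≡⟨ cong (ℚ._* s) (ℚ.∣p*q∣≡∣p∣*∣q∣ y r) ⟩
      ℚ.∣ y ∣ ℚ.* ℚ.∣ r ∣ ℚ.* s                          ≡⟨ cong (λ v → ℚ.∣ y ∣ ℚ.* v ℚ.* s) (ℚ.0≤p⇒∣p∣≡p (ℚ.<⇒≤ (ℚ.positive⁻¹ r {{r-pos}}))) ⟩
      ℚ.∣ y ∣ ℚ.* r ℚ.* s                                ≡⟨ ℚ.*-assoc ℚ.∣ y ∣ r s ⟩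
      ℚ.∣ y ∣ ℚ.* (r ℚ.* s)                              ∎
      where open ≡-Reasoning
    rhs : embed (+ (suc p * (27 * C n))) ≡ ε ℚ.* (r ℚ.* s)
    rhs = begin
      embed (+ (suc p * (27 * C n)))                     ≡⟨ cong embed (trans (ℤ.pos-* (suc p) (27 * C n)) (cong (+ suc p ℤ.*_) (ℤ.pos-* 27 (C n)))) ⟩
      embed (+ suc p ℤ.* (+ 27 ℤ.* + C n))               ≡⟨ embed-* (+ suc p) (+ 27 ℤ.* + C n) ⟨
      embed (+ suc p) ℚ.* embed (+ 27 ℤ.* + C n)         ≡⟨ cong₂ ℚ._*_ (sym (trans (cong (ℚ._* s) (sym (ℚ.fromℚᵘ-toℚᵘ ε))) (/-*-embed (+ suc p) (suc q))))
                                                              (sym (embed-* (+ 27) (+ C n))) ⟩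
      ε ℚ.* s ℚ.* r                                      ≡⟨ ℚ.*-assoc ε s r ⟩
      ε ℚ.* (s ℚ.* r)                                    ≡⟨ cong (ε ℚ.*_) (ℚ.*-comm s r) ⟩
      ε ℚ.* (r ℚ.* s)                                    ∎
      where open ≡-Reasoning

theorem1p3 : (λ n → d n - (+ 2 / 3) ℚ.* (+ n / 1)) ⟶ (- (+ 28 / 27))
theorem1p3 (mkℚ (+ suc p) q c) 0<ε = suc (2 * suc q) , λ { (suc k) N≤n → deviation-< k p q c N≤n }
theorem1p3 (mkℚ (+ zero) q c) (ℚ.*<* (ℤ.+<+ ()))
theorem1p3 (mkℚ -[1+ p ] q c) (ℚ.*<* ())
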